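{- For $n,k\ge 1$ let $p_*(n,k)$ be the number of permutations in $S_n$ of genus one having $k$ cycles, and for $j=0,1,2$ let $p_j(n,k)$ be the number of permutations in $S_n$ of genus one having $k$ cycles and exactly $j$ back points. Let $P_*(x,y)=\sum_{n,k}p_*(n,k)x^ny^k$ and $P_j(x,y)=\sum_{n,k}p_j(n,k)x^ny^k$. Then, writing $\Delta=1-2(1+y)x+x^2(1-y)^2$, $$P_*(x,y)=\frac{x^3y}{\Delta^{5/2}},\quad P_0(x,y)=\frac{x^4y^2}{\Delta^{5/2}},\quad P_2(x,y)=\frac{x^4y}{\Delta^{5/2}},\quad P_1(x,y)=\frac{x^3y(1-xy-x)}{\Delta^{5/2}}.$$
   Context: For $n\ge 1$ let $\zeta_n\in S_n$ be the cyclic permutation $\zeta_n(i)=i+1$ for $i<n$, $\zeta_n(n)=1$. Permutations are composed right to left, and $z(\pi)$ denotes the number of cycles of $\pi$ (fixed points included). The genus $g(\alpha)$ of $\alpha\in S_n$ is the non-negative integer defined by $n+1-2g(\alpha)=z(\alpha)+z(\alpha^{ -1}\zeta_n)$. An element $i\in\{1,\dots,n\}$ is a back point of $\alpha$ if $\alpha(i)<i$ and $\alpha(i)$ is not the smallest element of its cycle of $\alpha$. -}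

module Defs where

open import Data.Nat as ℕ using (ℕ; zero; suc; _+_; _*_; _∸_; _<?_; _≤ᵇ_; _<ᵇ_; _≡ᵇ_; s≤s)
open import Data.Integer as ℤ using (ℤ; +_)
open import Data.Fin using (Fin; zero; suc; toℕ; fromℕ<)
open import Data.Vec using (Vec; []; _∷_; lookup)
open import Data.List using (List; []; _∷_; [_]; map; concatMap; allFin; length; filterᵇ; upTo; foldr)
open import Data.Bool using (Bool; true; false; _∧_; _∨_; not; if_then_else_)
open import Relation.Nullary using (yes; no)
open import Relation.Binary.PropositionalEquality using (_≡_)
open import Data.Product using (_×_)

-- Permutations of {1..n}, represented 0-based as Fin n, a permutation
-- being given by its table of values (a Vec (Fin n) n that is injective).

allTables : (m n : ℕ) → List (Vec (Fin n) m)
allTables zero    n = [ [] ]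
allTables (suc m) n = concatMap (λ i → map (i ∷_) (allTables m n)) (allFin n)

allB : ∀ {A : Set} → (A → Bool) → List A → Bool
allB p = foldr (λ a b → p a ∧ b) true

anyB : ∀ {A : Set} → (A → Bool) → List A → Bool
anyB p = foldr (λ a b → p a ∨ b) false

_==_ : ∀ {n} → Fin n → Fin n → Bool
i == j = toℕ i ≡ᵇ toℕ j

isInjective : ∀ {n} → Vec (Fin n) n → Bool
isInjective {n} v =
  allB (λ i → allB (λ j → (i == j) ∨ not (lookup v i == lookup v j)) (allFin n)) (allFin n)

Sym : (n : ℕ) → List (Vec (Fin n) n)
Sym n = filterᵇ isInjective (allTables n n)

iter : ∀ {n} → (Fin n → Fin n) → ℕ → Fin n → Fin n
iter f zero    i = i
iter f (suc t) i = f (iter f t i)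

isCycleMin : ∀ {n} → (Fin n → Fin n) → Fin n → Bool
isCycleMin {n} f i = allB (λ t → toℕ i ≤ᵇ toℕ (iter f (suc t) i)) (upTo n)

-- number of cycles (fixed points included): one per cycle minimum
z : ∀ {n} → (Fin n → Fin n) → ℕ
z {n} f = length (filterᵇ (isCycleMin f) (allFin n))

-- inverse of a permutation (by search; correct for bijections)
findPre : ∀ {n} → (Fin n → Fin n) → Fin n → List (Fin n) → Fin n
findPre f j []       = j
findPre f j (i ∷ is) = if f i == j then i else findPre f j is

inv : ∀ {n} → (Fin n → Fin n) → Fin n → Fin n
inv {n} f j = findPre f j (allFin n)

ζ : ∀ {n} → Fin n → Fin n
ζ {suc m} i with toℕ i <? m
... | yes p = fromℕ< (s≤s p)
... | no _  = zero

HasGenus : ∀ {n} → (Fin n → Fin n) → ℕ → Bool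
HasGenus {n} α g = (n + 1) ≡ᵇ (2 * g + (z α + z (λ j → inv α (ζ j))))

isBackPoint : ∀ {n} → (Fin n → Fin n) → Fin n → Bool
isBackPoint α i = (toℕ (α i) <ᵇ toℕ i) ∧ not (isCycleMin α (α i))

backPoints : ∀ {n} → (Fin n → Fin n) → ℕ
backPoints {n} α = length (filterᵇ (isBackPoint α) (allFin n))

pStarB : ∀ {n} → ℕ → Vec (Fin n) n → Bool
pStarB k v = HasGenus (lookup v) 1 ∧ (z (lookup v) ≡ᵇ k)

pStar : ℕ → ℕ → ℕ
pStar n k = length (filterᵇ (pStarB k) (Sym n))

pBack : ℕ → ℕ → ℕ → ℕ
pBack j n k = length (filterᵇ (λ v → pStarB k v ∧ (backPoints (lookup v) ≡ᵇ j)) (Sym n))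

-- Formal power series in x, y over ℤ: coefficient of x^n y^k

PS : Set
PS = ℕ → ℕ → ℤ

_≐_ : PS → PS → Set
f ≐ g = ∀ n k → f n k ≡ g n k

gf : (ℕ → ℕ → ℕ) → PS
gf c zero    k       = + 0
gf c (suc n) zero    = + 0
gf c (suc n) (suc k) = + c (suc n) (suc k)

P* : PS
P* = gf pStar

P : ℕ → PS
P j = gf (pBack j)

constPS : ℤ → PS
constPS c zero zero = c
constPS c _    _    = + 0

X : PS
X (suc zero) zero = + 1
X _          _    = + 0

Y : PS
Y zero (suc zero) = + 1
Y _    _          = + 0

_⊕_ : PS → PS → PS
(f ⊕ g) n k = f n k ℤ.+ g n k

⊖_ : PS → PS
(⊖ f) n k = ℤ.- f n k

_⊝_ : PS → PS → PS
f ⊝ g = f ⊕ (⊖ g)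

sumℤ : List ℤ → ℤ
sumℤ = foldr ℤ._+_ (+ 0)

_⊗_ : PS → PS → PS
(f ⊗ g) n k = sumℤ (map (λ a → sumℤ (map (λ b → f a b ℤ.* g (n ∸ a) (k ∸ b)) (upTo (suc k)))) (upTo (suc n)))

infixl 6 _⊕_ _⊝_
infixl 7 _⊗_
infix 4 _≐_

𝟙 : PS
𝟙 = constPS (+ 1)

Δ : PS
Δ = 𝟙 ⊝ constPS (+ 2) ⊗ (𝟙 ⊕ Y) ⊗ X ⊕ X ⊗ X ⊗ ((𝟙 ⊝ Y) ⊗ (𝟙 ⊝ Y))

-- S is the power series Δ^{-1/2}: constant term 1 and S² Δ = 1
-- (this characterises Δ^{-1/2} uniquely in ℤ[[x,y]])
IsInvSqrtΔ : PS → Set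
IsInvSqrtΔ S = (S 0 0 ≡ + 1) × (S ⊗ S ⊗ Δ ≐ 𝟙)

pow : PS → ℕ → PS
pow f zero    = 𝟙
pow f (suc m) = f ⊗ pow f m

{-# OPTIONS --safe #-}

-- A permutation α of n+1 letters arises from one of n letters by inserting the new largest letter
-- after some letter a, or as a fixed point.  This changes β = α⁻¹ζ as follows: if a lies on the cycle
-- w of β through the largest letter then w is cut before a and the genus is kept; otherwise the cycle
-- of a is joined to w and the genus goes up by one.  A back point appears exactly when a was an
-- excedance (a < α a).  In genus zero w has no excedances and every other cycle of β has exactly one,
-- so only the length of w and the sizes of the other cycles matter; in genus one only the excedance
-- word along w matters.  The resulting linear recursions are solved in terms of the power series
-- E = (1 + xE)(1 + xyE): with C = 1 + xE and V = 1 + xyE, a genus one state with ℓ non-excedances and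
-- no excedance contributes V Cˡ, and the genus zero solutions are Cˡ times polynomials in ℓ whose
-- coefficients involve Δ^{-1/2}.
module Submission where

-- The genus never drops and only joins raise it, so a continuation that ends in genus one contains
-- exactly one join. A genus zero value is therefore a sum over the cycle to be joined, and the
-- recursions stay linear. In genus zero a cycle other than w is a suffix that was cut off w: the
-- letter at the cut acquires the new largest letter as image and becomes an excedance, while the
-- letters behind it keep their marks. The join leaves at most two excedances on w, or one together
-- with a back point, and later steps add none to w. So there are at most two back points and only
-- `ω 0`, `ω 1`, `ω 2` matter; an arbitrary weight `ω` treats the four series at once. Powers of C
-- are forced: taking differences in the length of w leaves a three-term recursion whose
-- characteristic equation has C as its only power series root.

open import Defs
open import Data.Product using (_×_)

-- Formal power series in two variables as a commutative ring

module PowerSeries where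

  open import Level using (0ℓ)
  open import Function using (_∘_; id)
  open import Algebra.Bundles using (CommutativeRing; RawRing)
  open import Algebra.Morphism.Structures using (IsRingMonomorphism)
  import Algebra.Morphism.RingMonomorphism as RingMono
  open import Algebra.Solver.Ring.AlmostCommutativeRing using (_-Raw-AlmostCommutative⟶_; fromCommutativeRing)
  open import Data.Nat as ℕ using (ℕ; zero; suc; _∸_; s≤s; z≤n)
  open import Data.Integer as ℤ using (ℤ; +_)
  import Data.Integer.Properties as ℤ
  open import Data.Product using (_,_)
  open import Data.List using (List; map; upTo)
  open import Data.List.Properties using (map-upTo)
  open import Relation.Binary.PropositionalEquality as ≡ using (_≡_; cong; cong₂)

  module Series (R : CommutativeRing 0ℓ 0ℓ) where
    open CommutativeRing R
    open import Algebra.Properties.CommutativeSemigroup +-commutativeSemigroup using (interchange)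
    open import Relation.Binary.Reasoning.Setoid setoid

    -- Recursion on the degree avoids the truncated subtraction in `_⊗_`, so that the ring laws
    -- become plain inductions; `⊗-conv` identifies the two products.
    conv : (ℕ → Carrier) → (ℕ → Carrier) → ℕ → Carrier
    conv f g zero    = f 0 * g 0
    conv f g (suc n) = f 0 * g (suc n) + conv (f ∘ suc) g n

    conv-cong≤ : ∀ {f f′ g g′} n → (∀ i → i ℕ.≤ n → f i ≈ f′ i) → (∀ i → i ℕ.≤ n → g i ≈ g′ i) →
                 conv f g n ≈ conv f′ g′ n
    conv-cong≤ zero    p q = *-cong (p 0 z≤n) (q 0 z≤n)
    conv-cong≤ (suc n) p q = +-cong (*-cong (p 0 z≤n) (q (suc n) (s≤s (≤-refl))))
      (conv-cong≤ n (λ i i≤n → p (suc i) (s≤s i≤n)) (λ i i≤n → q i (m≤n⇒m≤1+n i≤n)))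
      where open import Data.Nat.Properties using (≤-refl; m≤n⇒m≤1+n)

    conv-cong : ∀ {f f′ g g′} → (∀ i → f i ≈ f′ i) → (∀ i → g i ≈ g′ i) → ∀ n → conv f g n ≈ conv f′ g′ n
    conv-cong p q n = conv-cong≤ n (λ i _ → p i) (λ i _ → q i)

    conv-sucʳ : ∀ f g n → conv f g (suc n) ≈ conv f (g ∘ suc) n + f (suc n) * g 0
    conv-sucʳ f g zero    = refl
    conv-sucʳ f g (suc n) = begin
      f 0 * g (2 ℕ.+ n) + conv (f ∘ suc) g (suc n)
        ≈⟨ +-congˡ (conv-sucʳ (f ∘ suc) g n) ⟩
      f 0 * g (2 ℕ.+ n) + (conv (f ∘ suc) (g ∘ suc) n + f (2 ℕ.+ n) * g 0)
        ≈⟨ +-assoc _ _ _ ⟨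
      f 0 * g (2 ℕ.+ n) + conv (f ∘ suc) (g ∘ suc) n + f (2 ℕ.+ n) * g 0 ∎

    conv-comm : ∀ f g n → conv f g n ≈ conv g f n
    conv-comm f g zero    = *-comm _ _
    conv-comm f g (suc n) = begin
      f 0 * g (suc n) + conv (f ∘ suc) g n ≈⟨ +-cong (*-comm _ _) (conv-comm (f ∘ suc) g n) ⟩
      g (suc n) * f 0 + conv g (f ∘ suc) n ≈⟨ +-comm _ _ ⟩
      conv g (f ∘ suc) n + g (suc n) * f 0 ≈⟨ conv-sucʳ g f n ⟨
      conv g f (suc n) ∎

    conv-distribʳ : ∀ f g h n → conv (λ i → f i + g i) h n ≈ conv f h n + conv g h n
    conv-distribʳ f g h zero    = distribʳ _ _ _
    conv-distribʳ f g h (suc n) =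
      trans (+-cong (distribʳ _ _ _) (conv-distribʳ (f ∘ suc) (g ∘ suc) h n)) (interchange _ _ _ _)

    conv-*ˡ : ∀ c f g n → conv (λ i → c * f i) g n ≈ c * conv f g n
    conv-*ˡ c f g zero    = *-assoc _ _ _
    conv-*ˡ c f g (suc n) = trans (+-cong (*-assoc _ _ _) (conv-*ˡ c (f ∘ suc) g n)) (sym (distribˡ _ _ _))

    conv-assoc : ∀ f g h n → conv (conv f g) h n ≈ conv f (conv g h) n
    conv-assoc f g h zero    = *-assoc _ _ _
    conv-assoc f g h (suc n) = begin
      f 0 * g 0 * h (suc n) + conv (λ i → f 0 * g (suc i) + conv (f ∘ suc) g i) h n
        ≈⟨ +-cong (*-assoc _ _ _) (conv-distribʳ (λ i → f 0 * g (suc i)) (conv (f ∘ suc) g) h n) ⟩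
      f 0 * (g 0 * h (suc n)) + (conv (λ i → f 0 * g (suc i)) h n + conv (conv (f ∘ suc) g) h n)
        ≈⟨ +-congˡ (+-cong (conv-*ˡ (f 0) (g ∘ suc) h n) (conv-assoc (f ∘ suc) g h n)) ⟩
      f 0 * (g 0 * h (suc n)) + (f 0 * conv (g ∘ suc) h n + conv (f ∘ suc) (conv g h) n)
        ≈⟨ +-assoc _ _ _ ⟨
      f 0 * (g 0 * h (suc n)) + f 0 * conv (g ∘ suc) h n + conv (f ∘ suc) (conv g h) n
        ≈⟨ +-congʳ (distribˡ _ _ _) ⟨
      f 0 * conv g h (suc n) + conv (f ∘ suc) (conv g h) n ∎

    conv-zeroˡ : ∀ {f} g → (∀ i → f i ≈ 0#) → ∀ n → conv f g n ≈ 0#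
    conv-zeroˡ g p zero    = trans (*-congʳ (p 0)) (zeroˡ _)
    conv-zeroˡ g p (suc n) =
      trans (+-cong (trans (*-congʳ (p 0)) (zeroˡ _)) (conv-zeroˡ g (p ∘ suc) n)) (+-identityˡ _)

    const : Carrier → ℕ → Carrier
    const c zero    = c
    const c (suc _) = 0#

    conv-constˡ : ∀ c f n → conv (const c) f n ≈ c * f n
    conv-constˡ c f zero    = refl
    conv-constˡ c f (suc n) = trans (+-congˡ (conv-zeroˡ f (λ _ → refl) n)) (+-identityʳ _)

    conv-identityˡ : ∀ f n → conv (const 1#) f n ≈ f n
    conv-identityˡ f n = trans (conv-constˡ 1# f n) (*-identityˡ _)

    -- The product in degree 0 kills `f 0`; what is left is the product of the tail of `f` with `h`,
    -- and the argument repeats. Used once in y and once in x, it cancels a factor with constant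
    -- term 2.
    cancel : ∀ {h} → (∀ c → c * h 0 ≈ 0# → c ≈ 0#) → ∀ f → (∀ n → conv f h n ≈ 0#) → ∀ n → f n ≈ 0#
    cancel     nzd f p zero    = nzd _ (p 0)
    cancel {h} nzd f p (suc n) = cancel nzd (f ∘ suc) tail n
      where
      tail : ∀ m → conv (f ∘ suc) h m ≈ 0#
      tail m = begin
        conv (f ∘ suc) h m                     ≈⟨ +-identityˡ _ ⟨
        0# + conv (f ∘ suc) h m                ≈⟨ +-congʳ (trans (*-congʳ (nzd _ (p 0))) (zeroˡ _)) ⟨
        f 0 * h (suc m) + conv (f ∘ suc) h m   ≈⟨ p (suc m) ⟩
        0# ∎

    series : CommutativeRing 0ℓ 0ℓ
    series = record
      { Carrier = ℕ → Carrier
      ; _≈_ = λ f g → ∀ n → f n ≈ g n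
      ; _+_ = λ f g n → f n + g n
      ; _*_ = conv
      ; -_ = λ f n → - f n
      ; 0# = λ _ → 0#
      ; 1# = const 1#
      ; isCommutativeRing = record
        { isRing = record
          { +-isAbelianGroup = record
            { isGroup = record
              { isMonoid = record
                { isSemigroup = record
                  { isMagma = record
                    { isEquivalence = record
                      { refl = λ _ → refl
                      ; sym = λ p n → sym (p n)
                      ; trans = λ p q n → trans (p n) (q n) }
                    ; ∙-cong = λ p q n → +-cong (p n) (q n) }
                  ; assoc = λ f g h n → +-assoc _ _ _ }
                ; identity = (λ f n → +-identityˡ _) , (λ f n → +-identityʳ _) }
              ; inverse = (λ f n → -‿inverseˡ _) , (λ f n → -‿inverseʳ _)
              ; ⁻¹-cong = λ p n → -‿cong (p n) }
            ; comm = λ f g n → +-comm _ _ }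
          ; *-cong = λ p q → conv-cong p q
          ; *-assoc = conv-assoc
          ; *-identity = conv-identityˡ , (λ f n → trans (conv-comm f (const 1#) n) (conv-identityˡ f n))
          ; distrib = (λ f g h n → trans (conv-comm f _ n) (trans (conv-distribʳ g h f n)
                         (+-cong (conv-comm g f n) (conv-comm h f n))))
                    , (λ f g h → conv-distribʳ g h f)
          }
        ; *-comm = conv-comm }
      }

  module ℤ[y] = Series ℤ.+-*-commutativeRing
  module ℤ[y][x] = Series ℤ[y].series

  sumℤ-conv : ∀ f g n → sumℤ (map (λ i → f i ℤ.* g (n ∸ i)) (upTo (suc n))) ≡ ℤ[y].conv f g n
  sumℤ-conv f g n = ≡.trans (cong sumℤ (map-upTo (λ i → f i ℤ.* g (n ∸ i)) (suc n))) (go f n)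
    where
    open import Data.List using (applyUpTo)
    go : ∀ f n → sumℤ (applyUpTo (λ i → f i ℤ.* g (n ∸ i)) (suc n)) ≡ ℤ[y].conv f g n
    go f zero    = ℤ.+-identityʳ _
    go f (suc n) = cong (λ r → f 0 ℤ.* g (suc n) ℤ.+ r) (go (f ∘ suc) n)

  ⊗-conv : ∀ f g → f ⊗ g ≐ ℤ[y][x].conv f g
  ⊗-conv f g n k = ≡.trans
    (cong sumℤ (map-cong (λ a → sumℤ-conv (f a) (g (n ∸ a)) k) (upTo (suc n))))
    (≡.trans (cong sumℤ (map-upTo (λ a → ℤ[y].conv (f a) (g (n ∸ a)) k) (suc n))) (go f n))
    where
    open import Data.List using (applyUpTo)
    open import Data.List.Properties using (map-cong)
    go : ∀ f n → sumℤ (applyUpTo (λ a → ℤ[y].conv (f a) (g (n ∸ a)) k) (suc n)) ≡ ℤ[y][x].conv f g n k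
    go f zero    = ℤ.+-identityʳ _
    go f (suc n) = cong (λ r → ℤ[y].conv (f 0) (g (suc n)) k ℤ.+ r) (go (f ∘ suc) n)

  rawPS : RawRing 0ℓ 0ℓ
  rawPS = record { Carrier = PS ; _≈_ = _≐_ ; _+_ = _⊕_ ; _*_ = _⊗_ ; -_ = ⊖_ ; 0# = λ _ _ → + 0 ; 1# = 𝟙 }

  -- The ring laws are pulled back along the identity map into the iterated series ring, where the
  -- product is `conv`.
  PS-ring : CommutativeRing 0ℓ 0ℓ
  PS-ring = record
    { isCommutativeRing = RingMono.isCommutativeRing mono (CommutativeRing.isCommutativeRing ℤ[y][x].series) }
    where
    mono : IsRingMonomorphism rawPS (CommutativeRing.rawRing ℤ[y][x].series) id
    mono = record
      { isRingHomomorphism = record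
        { isSemiringHomomorphism = record
          { isNearSemiringHomomorphism = record
            { +-isMonoidHomomorphism = record
              { isMagmaHomomorphism = record
                { isRelHomomorphism = record { cong = id }
                ; homo = λ _ _ _ _ → ≡.refl }
              ; ε-homo = λ _ _ → ≡.refl }
            ; *-homo = ⊗-conv }
          ; 1#-homo = λ { zero zero → ≡.refl ; zero (suc k) → ≡.refl ; (suc n) k → ≡.refl } }
        ; -‿homo = λ _ _ _ → ≡.refl }
      ; injective = id }

  module PSR = CommutativeRing PS-ring

  const⊗ : ∀ c f → constPS c ⊗ f ≐ λ n k → c ℤ.* f n k
  const⊗ c f n k = begin
    (constPS c ⊗ f) n k                          ≡⟨ ⊗-conv (constPS c) f n k ⟩
    ℤ[y][x].conv (constPS c) f n k               ≡⟨ ℤ[y][x].conv-cong const≈ (λ _ _ → ≡.refl) n k ⟩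
    ℤ[y][x].conv (ℤ[y][x].const (ℤ[y].const c)) f n k ≡⟨ ℤ[y][x].conv-constˡ (ℤ[y].const c) f n k ⟩
    ℤ[y].conv (ℤ[y].const c) (f n) k              ≡⟨ ℤ[y].conv-constˡ c (f n) k ⟩
    c ℤ.* f n k ∎
    where
    open ≡.≡-Reasoning
    const≈ : ∀ n k → constPS c n k ≡ ℤ[y][x].const (ℤ[y].const c) n k
    const≈ zero    zero    = ≡.refl
    const≈ zero    (suc k) = ≡.refl
    const≈ (suc n) k       = ≡.refl

  X⊗-zero : ∀ f k → (X ⊗ f) 0 k ≡ + 0
  X⊗-zero f k = ≡.trans (⊗-conv X f 0 k) (ℤ[y].conv-zeroˡ (f 0) (λ _ → ≡.refl) k)

  X⊗-suc : ∀ f n k → (X ⊗ f) (suc n) k ≡ f n k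
  X⊗-suc f n k = begin
    (X ⊗ f) (suc n) k                                              ≡⟨ ⊗-conv X f (suc n) k ⟩
    ℤ[y].conv (X 0) (f (suc n)) k ℤ.+ ℤ[y][x].conv (X ∘ suc) f n k
      ≡⟨ cong₂ ℤ._+_ (ℤ[y].conv-zeroˡ (f (suc n)) (λ _ → ≡.refl) k) (≡.sym (⊗-conv (X ∘ suc) f n k)) ⟩
    + 0 ℤ.+ ((X ∘ suc) ⊗ f) n k                                    ≡⟨ ℤ.+-identityˡ _ ⟩
    ((X ∘ suc) ⊗ f) n k                                            ≡⟨ PSR.*-congʳ {f} Xsuc n k ⟩
    (𝟙 ⊗ f) n k                                                    ≡⟨ PSR.*-identityˡ f n k ⟩
    f n k ∎
    where
    open ≡.≡-Reasoning
    Xsuc : (X ∘ suc) ≐ 𝟙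
    Xsuc zero    zero    = ≡.refl
    Xsuc zero    (suc k) = ≡.refl
    Xsuc (suc n) k       = ≡.refl

  Y⊗-zero : ∀ f n → (Y ⊗ f) n 0 ≡ + 0
  Y⊗-zero f zero    = ≡.trans (⊗-conv Y f 0 0) ≡.refl
  Y⊗-zero f (suc n) = ≡.trans (⊗-conv Y f (suc n) 0)
    (≡.trans (ℤ.+-identityˡ _) (ℤ[y][x].conv-zeroˡ f (λ _ _ → ≡.refl) n 0))

  Y⊗-suc : ∀ f n k → (Y ⊗ f) n (suc k) ≡ f n k
  Y⊗-suc f n k = begin
    (Y ⊗ f) n (suc k)                                   ≡⟨ ⊗-conv Y f n (suc k) ⟩
    ℤ[y][x].conv Y f n (suc k)                          ≡⟨ ℤ[y][x].conv-cong Y≈ (λ _ _ → ≡.refl) n (suc k) ⟩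
    ℤ[y][x].conv (ℤ[y][x].const (Y 0)) f n (suc k)      ≡⟨ ℤ[y][x].conv-constˡ (Y 0) f n (suc k) ⟩
    + 0 ℤ.* f n (suc k) ℤ.+ ℤ[y].conv (Y 0 ∘ suc) (f n) k ≡⟨ ℤ.+-identityˡ _ ⟩
    ℤ[y].conv (Y 0 ∘ suc) (f n) k                        ≡⟨ ℤ[y].conv-cong Ysuc (λ _ → ≡.refl) k ⟩
    ℤ[y].conv (ℤ[y].const (+ 1)) (f n) k                 ≡⟨ ℤ[y].conv-identityˡ (f n) k ⟩
    f n k ∎
    where
    open ≡.≡-Reasoning
    Y≈ : ∀ n k → Y n k ≡ ℤ[y][x].const (Y 0) n k
    Y≈ zero    k = ≡.refl
    Y≈ (suc n) k = ≡.refl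
    Ysuc : ∀ k → Y 0 (suc k) ≡ ℤ[y].const (+ 1) k
    Ysuc zero    = ≡.refl
    Ysuc (suc k) = ≡.refl

  -- Gives the ring solver integer coefficients with decidable equality inside `PS`.
  constHom : CommutativeRing.rawRing ℤ.+-*-commutativeRing -Raw-AlmostCommutative⟶ fromCommutativeRing PS-ring
  constHom = record
    { ⟦_⟧ = constPS
    ; +-homo = λ { a b zero zero → ≡.refl ; a b zero (suc k) → ≡.refl ; a b (suc n) k → ≡.refl }
    ; *-homo = λ { a b zero zero → ≡.sym (const⊗ a (constPS b) 0 0)
                 ; a b zero (suc k) → ≡.sym (≡.trans (const⊗ a (constPS b) 0 (suc k)) (ℤ.*-zeroʳ a))
                 ; a b (suc n) k → ≡.sym (≡.trans (const⊗ a (constPS b) (suc n) k) (ℤ.*-zeroʳ a)) }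
    ; -‿homo = λ { a zero zero → ≡.refl ; a zero (suc k) → ≡.refl ; a (suc n) k → ≡.refl }
    ; 0-homo = λ { zero zero → ≡.refl ; zero (suc k) → ≡.refl ; (suc n) k → ≡.refl }
    ; 1-homo = λ _ _ → ≡.refl
    }

-- Closed solutions of the recursions over an arbitrary commutative ring

module ClosedForms where

  open import Level using (0ℓ)
  open import Function using (_∘_)
  open import Algebra.Bundles using (CommutativeRing)
  open import Algebra.Solver.Ring.AlmostCommutativeRing using (_-Raw-AlmostCommutative⟶_; fromCommutativeRing)
  import Algebra.Solver.Ring as RingSolver
  open import Data.Bool using (Bool; true; false; if_then_else_)
  open import Data.Nat as ℕ using (ℕ; zero; suc)
  open import Data.Integer as ℤ using (ℤ; +_)
  import Data.Integer.Properties as ℤ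
  open import Data.Maybe using (Maybe; just; nothing)
  open import Data.Product using (_×_; _,_; proj₁)
  open import Data.List using (List; []; _∷_; _++_; map; replicate)
  open import Relation.Nullary using (yes; no)
  import Relation.Binary.PropositionalEquality as ≡

  splits : {A : Set} → List A → List (List A × A × List A)
  splits []       = []
  splits (a ∷ as) = ([] , a , as) ∷ map (λ (p , b , q) → a ∷ p , b , q) (splits as)

  picks : {A : Set} → List A → List (A × List A)
  picks []       = []
  picks (a ∷ as) = (a , as) ∷ map (λ (b , bs) → b , a ∷ bs) (picks as)

  bump : Bool → ℕ → ℕ
  bump a b = if a then suc b else b

  module Closed
    (R : CommutativeRing 0ℓ 0ℓ)
    (hom : CommutativeRing.rawRing ℤ.+-*-commutativeRing -Raw-AlmostCommutative⟶ fromCommutativeRing R)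
    where

    open CommutativeRing R
    open _-Raw-AlmostCommutative⟶_ hom using (⟦_⟧)
    open import Relation.Binary.Reasoning.Setoid setoid
    open import Algebra.Properties.CommutativeSemigroup +-commutativeSemigroup using (interchange)
    coeff≟ : (a b : ℤ) → Maybe (⟦ a ⟧ ≈ ⟦ b ⟧)
    coeff≟ a b with a ℤ.≟ b
    ... | yes ≡.refl = just refl
    ... | no _       = nothing

    module Solver = RingSolver (CommutativeRing.rawRing ℤ.+-*-commutativeRing) (fromCommutativeRing R) hom coeff≟
    open Solver using (solve; _:=_; _:+_; _:*_; _:-_; :-_; con; Polynomial)

    -- Images of integers instead of `0#` and `1#`, so that they are literally the values of the
    -- solver constants `con`.
    O I : Carrier
    O = ⟦ + 0 ⟧
    I = ⟦ + 1 ⟧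

    𝟎 𝟏 : ∀ {n} → Polynomial n
    𝟎 = con (+ 0)
    𝟏 = con (+ 1)

    O+O : O ≈ O + O
    O+O = solve 0 (𝟎 := 𝟎 :+ 𝟎) refl

    O≈*O : ∀ c → O ≈ c * O
    O≈*O = solve 1 (λ c → 𝟎 := c :* 𝟎) refl

    Σ : {A : Set} → (A → Carrier) → List A → Carrier
    Σ f []       = O
    Σ f (a ∷ as) = f a + Σ f as

    module _ {A : Set} where
      Σ-cong : ∀ {f g : A → Carrier} → (∀ a → f a ≈ g a) → ∀ as → Σ f as ≈ Σ g as
      Σ-cong p []       = refl
      Σ-cong p (a ∷ as) = +-cong (p a) (Σ-cong p as)

      Σ-+ : ∀ (f g : A → Carrier) as → Σ (λ a → f a + g a) as ≈ Σ f as + Σ g as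
      Σ-+ f g []       = O+O
      Σ-+ f g (a ∷ as) = trans (+-congˡ (Σ-+ f g as)) (interchange _ _ _ _)

      Σ-* : ∀ c (f : A → Carrier) as → Σ (λ a → c * f a) as ≈ c * Σ f as
      Σ-* c f []       = O≈*O c
      Σ-* c f (a ∷ as) = trans (+-congˡ (Σ-* c f as)) (sym (distribˡ _ _ _))

      Σ-map : ∀ {B : Set} (f : A → Carrier) (g : B → A) bs → Σ f (map g bs) ≈ Σ (f ∘ g) bs
      Σ-map f g []       = refl
      Σ-map f g (b ∷ bs) = +-congˡ (Σ-map f g bs)

    Σ-picks : ∀ {A : Set} (f : A → Carrier) as → Σ (f ∘ proj₁) (picks as) ≈ Σ f as
    Σ-picks f []       = refl
    Σ-picks f (a ∷ as) = +-congˡ (trans (Σ-map (f ∘ proj₁) _ (picks as)) (Σ-picks f as))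

    -- Sum of K i j over i + j + 1 = n.
    dsum : (ℕ → ℕ → Carrier) → ℕ → Carrier
    dsum K zero    = O
    dsum K (suc n) = K 0 n + dsum (K ∘ suc) n

    dsum-cong : ∀ {K K′} → (∀ i j → K i j ≈ K′ i j) → ∀ n → dsum K n ≈ dsum K′ n
    dsum-cong p zero    = refl
    dsum-cong p (suc n) = +-cong (p 0 n) (dsum-cong (p ∘ suc) n)

    dsum-+ : ∀ K K′ n → dsum (λ i j → K i j + K′ i j) n ≈ dsum K n + dsum K′ n
    dsum-+ K K′ zero    = O+O
    dsum-+ K K′ (suc n) = trans (+-congˡ (dsum-+ (K ∘ suc) (K′ ∘ suc) n)) (interchange _ _ _ _)

    dsum-* : ∀ c K n → dsum (λ i j → c * K i j) n ≈ c * dsum K n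
    dsum-* c K zero    = O≈*O c
    dsum-* c K (suc n) = trans (+-congˡ (dsum-* c (K ∘ suc) n)) (sym (distribˡ _ _ _))

    dsum-Σ : {A : Set} (K : A → ℕ → ℕ → Carrier) (as : List A) → ∀ n →
             dsum (λ i j → Σ (λ a → K a i j) as) n ≈ Σ (λ a → dsum (K a) n) as
    dsum-Σ K []       n = zeros n
      where
      zeros : ∀ n → dsum (λ _ _ → O) n ≈ O
      zeros zero    = refl
      zeros (suc n) = trans (+-congˡ (zeros n)) (sym O+O)
    dsum-Σ K (a ∷ as) n = trans (dsum-+ (K a) _ n) (+-congˡ (dsum-Σ K as n))

    dsum-snoc : ∀ (f : ℕ → Carrier) n → dsum (λ i _ → f i) (suc n) ≈ dsum (λ i _ → f i) n + f n
    dsum-snoc f zero    = +-comm _ _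
    dsum-snoc f (suc n) = trans (+-congˡ (dsum-snoc (f ∘ suc) n)) (sym (+-assoc _ _ _))

    Σ-splits-replicate : ∀ {A : Set} (a : A) (H : List A × A × List A → Carrier) n →
      Σ H (splits (replicate n a)) ≈ dsum (λ i j → H (replicate i a , a , replicate j a)) n
    Σ-splits-replicate a H zero    = refl
    Σ-splits-replicate a H (suc n) = +-congˡ (trans (Σ-map H _ (splits (replicate n a)))
      (Σ-splits-replicate a (λ (p , b , q) → H (a ∷ p , b , q)) n))

    -- β j n = C(n+j-1, j)
    β : ℕ → ℕ → Carrier
    β zero    n       = I
    β (suc j) zero    = O
    β (suc j) (suc n) = β (suc j) n + β j (suc n)

    _^_ : Carrier → ℕ → Carrier
    c ^ zero  = I
    c ^ suc n = c * c ^ n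

    -- All powers of `C` combine to `C ^ n` because the exponents `j` and `suc i` add up to `n`. The
    -- induction splits off `i = 0`; in the rest `β 1` is larger by one, which turns `a` into
    -- `a + b`.
    dsum-poly : ∀ C A B b a n →
      dsum (λ i j → (A + B * β 1 j) * C ^ j * (C ^ suc i * (a + b * β 1 (suc i)))) n ≈
      C ^ n * (A * (a * β 1 n + b * β 2 n) + B * (a * (β 2 n - β 1 n) + b * (β 3 n - β 2 n)))
    dsum-poly C A B b a zero    = solve 4 (λ A B b a →
      𝟎 := 𝟏 :* (A :* (a :* 𝟎 :+ b :* 𝟎) :+ B :* (a :* (𝟎 :- 𝟎) :+ b :* (𝟎 :- 𝟎)))) refl A B b a
    dsum-poly C A B b a (suc n) = begin
      (A + B * β 1 n) * C ^ n * (C ^ 1 * (a + b * (O + I))) +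
        dsum (λ i j → (A + B * β 1 j) * C ^ j * (C ^ suc (suc i) * (a + b * (β 1 (suc i) + I)))) n
        ≈⟨ +-congˡ (trans (dsum-cong (λ i j → solve 6 (λ C K P a b v →
             K :* (C :* P :* (a :+ b :* (v :+ 𝟏))) := C :* (K :* (P :* (a :+ b :+ b :* v)))) refl
             C ((A + B * β 1 j) * C ^ j) (C ^ suc i) a b (β 1 (suc i))) n) (dsum-* C _ n)) ⟩
      (A + B * β 1 n) * C ^ n * (C ^ 1 * (a + b * (O + I))) +
        C * dsum (λ i j → (A + B * β 1 j) * C ^ j * (C ^ suc i * ((a + b) + b * β 1 (suc i)))) n
        ≈⟨ +-congˡ (*-congˡ (dsum-poly C A B b (a + b) n)) ⟩
      (A + B * β 1 n) * C ^ n * (C ^ 1 * (a + b * (O + I))) +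
        C * (C ^ n * (A * ((a + b) * β 1 n + b * β 2 n) + B * ((a + b) * (β 2 n - β 1 n) + b * (β 3 n - β 2 n))))
        ≈⟨ solve 9 (λ C A B b a P u v w →
             (A :+ B :* u) :* P :* (C :* 𝟏 :* (a :+ b :* (𝟎 :+ 𝟏))) :+
               C :* (P :* (A :* ((a :+ b) :* u :+ b :* v) :+ B :* ((a :+ b) :* (v :- u) :+ b :* (w :- v))))
             := C :* P :* (A :* (a :* (u :+ 𝟏) :+ b :* (v :+ (u :+ 𝟏))) :+
               B :* (a :* ((v :+ (u :+ 𝟏)) :- (u :+ 𝟏)) :+ b :* ((w :+ (v :+ (u :+ 𝟏))) :- (v :+ (u :+ 𝟏))))))
             refl C A B b a (C ^ n) (β 1 n) (β 2 n) (β 3 n) ⟩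
      C ^ suc n * (A * (a * β 1 (suc n) + b * β 2 (suc n)) +
        B * (a * (β 2 (suc n) - β 1 (suc n)) + b * (β 3 (suc n) - β 2 (suc n)))) ∎

    -- Algebra of E, where xyE is the Narayana series of nonempty noncrossing partitions by size and
    -- blocks

    module _ (x y E : Carrier) (E-eq : E ≈ (I + x * E) * (I + x * (y * E))) where

      -- Rt is the square root of Δ, and T = 1 - x y C².
      C V T Rt : Carrier
      C  = I + x * E
      V  = I + x * (y * E)
      Rt = I - x * ((I + y) + ⟦ + 2 ⟧ * (x * (y * E)))
      T  = C * Rt

      Cₚ Vₚ Rₚ : ∀ {n} → Polynomial n → Polynomial n → Polynomial n → Polynomial n
      Cₚ x y E = 𝟏 :+ x :* E
      Vₚ x y E = 𝟏 :+ x :* (y :* E)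
      Rₚ x y E = 𝟏 :- x :* ((𝟏 :+ y) :+ con (+ 2) :* (x :* (y :* E)))

      diff≈0 : ∀ {a b} → a ≈ b → a - b ≈ O
      diff≈0 {a} {b} p = trans (+-congʳ p) (solve 1 (λ b → b :- b := 𝟎) refl b)

      -- For identities that hold only modulo a relation `d ≈ e`: the cofactor `c` is supplied by
      -- hand and the solver checks the remaining free polynomial identity. Nested uses handle
      -- several relations.
      modulo : ∀ {a b} c {d e} → a ≈ b + c * (d - e) → d ≈ e → a ≈ b
      modulo {a} {b} c {d} {e} p q = trans p (trans (+-congˡ (*-congˡ (diff≈0 q)))
        (solve 2 (λ b c → b :+ c :* 𝟎 := b) refl b c))

      -- `Rt` is one minus the derivative of (1 + xE)(1 + xyE) with respect to E, so its square is
      -- the discriminant of the quadratic equation for E.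
      Rt² : Rt * Rt ≈ (I - ⟦ + 2 ⟧ * (I + y) * x) + x * x * ((I - y) * (I - y))
      Rt² = modulo (⟦ ℤ.- (+ 4) ⟧ * (x * (x * y))) (solve 3 (λ x y E →
        Rₚ x y E :* Rₚ x y E := ((𝟏 :- con (+ 2) :* (𝟏 :+ y) :* x) :+ x :* x :* ((𝟏 :- y) :* (𝟏 :- y)))
          :+ con (ℤ.- (+ 4)) :* (x :* (x :* y)) :* (E :- Cₚ x y E :* Vₚ x y E)) refl x y E) E-eq

      T+t : T + x * y * (C * C) ≈ I
      T+t = modulo x (solve 3 (λ x y E → Cₚ x y E :* Rₚ x y E :+ x :* y :* (Cₚ x y E :* Cₚ x y E)
        := 𝟏 :+ x :* (E :- Cₚ x y E :* Vₚ x y E)) refl x y E) E-eq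

      module Walks (S : Carrier) (SR : S * Rt ≈ I) (ω : ℕ → Carrier) where

        -- For constant `ω` every letter contributes the factor C = 1 + xE. At an excedance the
        -- summand xE also raises the number of back points, since inserting after an excedance
        -- creates one.
        Q : List Bool → ℕ → Carrier
        Q []          b = ω b
        Q (false ∷ u) b = C * Q u b
        Q (true  ∷ u) b = Q u b + x * E * Q u (suc b)

        Q-snoc : ∀ u b → Q (u ++ false ∷ []) b ≈ C * Q u b
        Q-snoc []          b = refl
        Q-snoc (false ∷ u) b = *-congˡ (Q-snoc u b)
        Q-snoc (true  ∷ u) b = trans (+-cong (Q-snoc u b) (*-congˡ (Q-snoc u (suc b))))
          (solve 4 (λ C q e q′ → C :* q :+ e :* (C :* q′) := C :* (q :+ e :* q′)) refl C _ _ _)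

        cut : ℕ → List Bool × Bool × List Bool → Carrier
        cut b (p , a , q) = Q (p ++ false ∷ []) (bump a b)

        xVC : x * (V * C) ≈ x * E
        xVC = *-congˡ (trans (*-comm V C) (sym E-eq))

        -- The sum over cuts telescopes along the word. Because xVC = xE, the cut before the first
        -- letter completes the bare `ω b` to the full factor of that letter, and the cuts further
        -- right are covered by induction.
        Q-cuts : ∀ w b → ω b + x * (V * Σ (cut b) (splits w)) ≈ Q w b
        Q-cuts []      b = solve 3 (λ o x v → o :+ x :* (v :* 𝟎) := o) refl (ω b) x V
        Q-cuts (a ∷ w) b = trans (+-congˡ (*-congˡ (*-congˡ (+-congˡ (Σ-map (cut b) _ (splits w)))))) (first a)
          where
          first : ∀ a → ω b + x * (V * (C * ω (bump a b) +
                    Σ (λ (p , a′ , q) → Q (a ∷ p ++ false ∷ []) (bump a′ b)) (splits w))) ≈ Q (a ∷ w) b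
          first false = begin
            ω b + x * (V * (C * ω b + Σ _ (splits w)))
              ≈⟨ +-congˡ (*-congˡ (*-congˡ (+-congˡ (Σ-* C (cut b) (splits w))))) ⟩
            ω b + x * (V * (C * ω b + C * Σ (cut b) (splits w)))
              ≈⟨ solve 6 (λ o x e C v s → o :+ x :* (v :* (C :* o :+ C :* s)) :=
                   ((𝟏 :+ e) :* o :+ C :* (x :* (v :* s))) :+ o :* (x :* (v :* C) :- e)) refl (ω b) x (x * E) C V _ ⟩
            ((I + x * E) * ω b + C * (x * (V * Σ (cut b) (splits w)))) + ω b * (x * (V * C) - x * E)
              ≈⟨ modulo (ω b) refl xVC ⟩
            C * ω b + C * (x * (V * Σ (cut b) (splits w)))
              ≈⟨ distribˡ _ _ _ ⟨
            C * (ω b + x * (V * Σ (cut b) (splits w)))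
              ≈⟨ *-congˡ (Q-cuts w b) ⟩
            C * Q w b ∎
          first true  = begin
            ω b + x * (V * (C * ω (suc b) + Σ _ (splits w)))
              ≈⟨ +-congˡ (*-congˡ (*-congˡ (+-congˡ (trans
                   (Σ-cong (λ { (p , false , q) → refl ; (p , true , q) → refl }) (splits w))
                   (trans (Σ-+ (cut b) (λ s → x * E * cut (suc b) s) (splits w))
                     (+-congˡ (Σ-* (x * E) (cut (suc b)) (splits w)))))))) ⟩
            ω b + x * (V * (C * ω (suc b) + (Σ (cut b) (splits w) + x * E * Σ (cut (suc b)) (splits w))))
              ≈⟨ solve 8 (λ o o′ x e C v s s′ → o :+ x :* (v :* (C :* o′ :+ (s :+ e :* s′))) :=
                   ((o :+ x :* (v :* s)) :+ e :* (o′ :+ x :* (v :* s′))) :+ o′ :* (x :* (v :* C) :- e))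
                   refl (ω b) (ω (suc b)) x (x * E) C V _ _ ⟩
            ((ω b + x * (V * Σ (cut b) (splits w))) + x * E * (ω (suc b) + x * (V * Σ (cut (suc b)) (splits w))))
               + ω (suc b) * (x * (V * C) - x * E)
              ≈⟨ modulo (ω (suc b)) refl xVC ⟩
            (ω b + x * (V * Σ (cut b) (splits w))) + x * E * (ω (suc b) + x * (V * Σ (cut (suc b)) (splits w)))
              ≈⟨ +-cong (Q-cuts w b) (*-congˡ (Q-cuts w (suc b))) ⟩
            Q w b + x * E * Q w (suc b) ∎

        live₁ : List Bool → ℕ → Carrier
        live₁ w b = V * Q w b

        -- The summands are stopping, a new fixed point and the cuts; a join would lead to genus
        -- two. The appended non-excedance of a fixed point multiplies by C, and xVC = xE then turns
        -- `Q` into (1 + xyE) `Q`.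
        live₁-rec : ∀ w b → live₁ w b ≈
          ω b + x * (y * live₁ (w ++ false ∷ []) b + Σ (λ (p , a , q) → live₁ (p ++ false ∷ []) (bump a b)) (splits w))
        live₁-rec w b = sym (begin
          ω b + x * (y * (V * Q (w ++ false ∷ []) b) + Σ _ (splits w))
            ≈⟨ +-congˡ (*-congˡ (+-cong (*-congˡ (*-congˡ (Q-snoc w b))) (Σ-* V (cut b) (splits w)))) ⟩
          ω b + x * (y * (V * (C * Q w b)) + V * Σ (cut b) (splits w))
            ≈⟨ solve 7 (λ o x y v C q s → o :+ x :* (y :* (v :* (C :* q)) :+ v :* s) :=
                 (o :+ x :* (v :* s)) :+ y :* q :* (x :* (v :* C))) refl _ x y V C _ _ ⟩
          (ω b + x * (V * Σ (cut b) (splits w))) + y * Q w b * (x * (V * C))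
            ≈⟨ +-cong (Q-cuts w b) (*-congˡ xVC) ⟩
          Q w b + y * Q w b * (x * E)
            ≈⟨ solve 4 (λ q x y E → q :+ y :* q :* (x :* E) := Vₚ x y E :* q) refl _ x y E ⟩
          V * Q w b ∎)

        -- Subtracting the instances at `l` and `suc l` removes the sum over all shorter lengths, so
        -- the instance at 0 and a three-term relation suffice.
        from-differences : ∀ (f g : ℕ → Carrier) → f 0 ≈ g 0 + x * (y * f 1) →
              (∀ l → f (suc l) + g l + x * (y * f (suc l)) ≈
                     f l + g (suc l) + x * (y * f (suc (suc l))) + x * f (suc l)) →
              ∀ l → f l ≈ g l + x * (y * f (suc l) + dsum (λ i _ → f (suc i)) l)
        from-differences f g base step zero    = trans base
          (solve 4 (λ g x y f → g :+ x :* (y :* f) := g :+ x :* (y :* f :+ 𝟎)) refl (g 0) x y (f 1))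
        from-differences f g base step (suc l) = trans (modulo I (modulo I (solve 8 (λ x y f₀ f₁ f₂ g₀ g₁ d →
            f₁ := ((g₁ :+ x :* (y :* f₂ :+ (d :+ f₁))) :+ 𝟏 :* ((f₁ :+ g₀ :+ x :* (y :* f₁)) :-
              (f₀ :+ g₁ :+ x :* (y :* f₂) :+ x :* f₁)) :+ 𝟏 :* (f₀ :- (g₀ :+ x :* (y :* f₁ :+ d)))))
            refl x y (f l) (f (suc l)) (f (suc (suc l))) (g l) (g (suc l)) (dsum (λ i _ → f (suc i)) l))
            (from-differences f g base step l)) (step l))
          (+-congˡ (*-congˡ (+-congˡ (sym (dsum-snoc (f ∘ suc) l)))))

        -- For f l = C^l h l the recursion of from-differences turns into e l - t e (l+1) =
        -- C^(1-l) (g l - g (l-1)) with e l = h l - h (l-1).  If g l / C^l is a combination of the β j, this is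
        -- triangular in the coefficients of h, with diagonal T = 1 - t = 1/σ.
        κ σ t : Carrier
        κ = x * E
        σ = S * (I - x * V)
        t = x * y * (C * C)

        -- The characteristic equation of the homogeneous relation in `from-differences`, evaluated
        -- at its root `C`. The other root is 1/(xyC), which is not a power series.
        C-char : C * (I + x * y - x) ≈ I + t
        C-char = modulo x (solve 3 (λ x y E → Cₚ x y E :* (𝟏 :+ x :* y :- x) :=
          (𝟏 :+ x :* y :* (Cₚ x y E :* Cₚ x y E)) :+ x :* (E :- Cₚ x y E :* Vₚ x y E)) refl x y E) E-eq

        C⁻¹ : C * (I - x * V) ≈ I
        C⁻¹ = modulo x (solve 3 (λ x y E → Cₚ x y E :* (𝟏 :- x :* Vₚ x y E) :=
          𝟏 :+ x :* (E :- Cₚ x y E :* Vₚ x y E)) refl x y E) E-eq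

        V⁻¹ : V * (I - x * (y * C)) ≈ I
        V⁻¹ = modulo (x * y) (solve 3 (λ x y E → Vₚ x y E :* (𝟏 :- x :* (y :* Cₚ x y E)) :=
          𝟏 :+ (x :* y) :* (E :- Cₚ x y E :* Vₚ x y E)) refl x y E) E-eq

        σT : σ * T ≈ I
        σT = begin
          σ * T                                 ≈⟨ solve 4 (λ S r C v → S :* v :* (C :* r) := (S :* r) :* (C :* v)) refl S Rt C (I - x * V) ⟩
          (S * Rt) * (C * (I - x * V))          ≈⟨ *-cong SR C⁻¹ ⟩
          I * I                                 ≈⟨ solve 0 (𝟏 :* 𝟏 := 𝟏) refl ⟩
          I ∎

        -- `σ` inverts 1 - `t`, so `σ * r` is the solution k of k = t k + r. Each unknown
        -- coefficient below is defined in this way.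
        σ-solves : ∀ r → σ * r ≈ t * (σ * r) + r
        σ-solves r = begin
          σ * r                          ≈⟨ solve 2 (λ σ r → σ :* r := 𝟏 :* (σ :* r)) refl σ r ⟩
          I * (σ * r)                    ≈⟨ *-congʳ T+t ⟨
          (T + t) * (σ * r)              ≈⟨ solve 4 (λ T t σ r → (T :+ t) :* (σ :* r) := t :* (σ :* r) :+ (σ :* T) :* r) refl T t σ r ⟩
          t * (σ * r) + σ * T * r        ≈⟨ +-congˡ (*-congʳ σT) ⟩
          t * (σ * r) + I * r            ≈⟨ solve 2 (λ a r → a :+ 𝟏 :* r := a :+ r) refl _ r ⟩
          t * (σ * r) + r ∎

        -- W l s is the contribution of the joins with a given cycle of s + 1 letters to a genus zero state
        -- with l letters on w, and U l that of the joins with cycles that are yet to be cut off.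
        α₀ α₁ : Carrier
        α₁ = σ * (x * κ)
        α₀ = V * (x + x * (y * (C * α₁)))

        Ω : ℕ → Carrier
        Ω l = C ^ l * (α₀ + α₁ * β 1 l)

        -- The source is itself a homogeneous solution up to a constant, so a factor linear in `l`
        -- is required. Its slope satisfies α₁ = t α₁ + xκ, and α₀ is read off at `l = 0`, where 1 -
        -- xyC is inverted by `V`.
        Ω-rec : ∀ l → Ω l ≈ x * C ^ l + x * (y * Ω (suc l) + dsum (λ i _ → Ω (suc i)) l)
        Ω-rec = from-differences Ω (λ l → x * C ^ l)
          (modulo ((x + x * (y * (C * α₁))) * (x * y)) (solve 4 (λ x y E a →
              𝟏 :* (Vₚ x y E :* (x :+ x :* (y :* (Cₚ x y E :* a))) :+ a :* 𝟎) :=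
              (x :* 𝟏 :+ x :* (y :* ((Cₚ x y E :* 𝟏) :* (Vₚ x y E :* (x :+ x :* (y :* (Cₚ x y E :* a))) :+ a :* (𝟎 :+ 𝟏))))) :+
              (x :+ x :* (y :* (Cₚ x y E :* a))) :* (x :* y) :* (E :- Cₚ x y E :* Vₚ x y E)) refl x y E α₁) E-eq)
          (λ l → modulo (C ^ l) (modulo (C ^ l * (α₀ + α₁ * (β 1 l + I))) (solve 7 (λ x y E a₀ a₁ P u →
              Cₚ x y E :* P :* (a₀ :+ a₁ :* (u :+ 𝟏)) :+ x :* P :+ x :* (y :* (Cₚ x y E :* P :* (a₀ :+ a₁ :* (u :+ 𝟏)))) :=
              ((P :* (a₀ :+ a₁ :* u) :+ x :* (Cₚ x y E :* P) :+
                 x :* (y :* (Cₚ x y E :* (Cₚ x y E :* P) :* (a₀ :+ a₁ :* (u :+ 𝟏 :+ 𝟏)))) :+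
                 x :* (Cₚ x y E :* P :* (a₀ :+ a₁ :* (u :+ 𝟏)))) :+
               P :* (a₁ :- (x :* y :* (Cₚ x y E :* Cₚ x y E) :* a₁ :+ x :* (x :* E)))) :+
              P :* (a₀ :+ a₁ :* (u :+ 𝟏)) :* (Cₚ x y E :* (𝟏 :+ x :* y :- x) :- (𝟏 :+ x :* y :* (Cₚ x y E :* Cₚ x y E))))
              refl x y E α₀ α₁ (C ^ l) (β 1 l)) C-char) (σ-solves (x * κ)))

        -- Up to powers of `C`, `A` belongs to a join at the excedance of the cycle, which creates a
        -- back point and leaves one excedance on w; `B` belongs to a join at a non-excedance, which
        -- creates no back point and leaves two.
        A B : Carrier
        A = E * (ω 1 + x * E * ω 2)
        B = V * (ω 0 + x * E * ω 1 + x * E * (ω 1 + x * E * ω 2))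

        W : ℕ → ℕ → Carrier
        W l s = (A + B * β 1 s) * C ^ s * Ω l

        -- A cycle off w is unchanged until it is joined, so its factor passes through the recursion
        -- of `Ω`. The last summand is the join itself.
        W-rec : ∀ l s → W l s ≈ x * (y * W (suc l) s + dsum (λ i _ → W (suc i) s) l + C ^ l * (C ^ s * (A + B * β 1 s)))
        W-rec l s = begin
          K * Ω l
            ≈⟨ *-congˡ (Ω-rec l) ⟩
          K * (x * C ^ l + x * (y * Ω (suc l) + dsum (λ i _ → Ω (suc i)) l))
            ≈⟨ solve 7 (λ k c P x y o d → k :* c :* (x :* P :+ x :* (y :* o :+ d)) :=
                 x :* (y :* (k :* c :* o) :+ k :* c :* d :+ P :* (c :* k))) refl (A + B * β 1 s) (C ^ s) (C ^ l) x y _ _ ⟩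
          x * (y * W (suc l) s + K * dsum (λ i _ → Ω (suc i)) l + C ^ l * (C ^ s * (A + B * β 1 s)))
            ≈⟨ *-congˡ (+-congʳ (+-congˡ (sym (dsum-* K (λ i _ → Ω (suc i)) l)))) ⟩
          x * (y * W (suc l) s + dsum (λ i _ → W (suc i) s) l + C ^ l * (C ^ s * (A + B * β 1 s))) ∎
          where K = (A + B * β 1 s) * C ^ s

        -- The coefficients k i - k (i+1) of U solve T k i = k (i+1) + κ s (i-1) + s i.
        s₁ s₂ s₃ k₁ k₂ k₃ k₄ : Carrier
        s₁ = x * ((A - B) * α₀)
        s₂ = x * (A * α₁ + B * (α₀ - α₁))
        s₃ = x * (B * α₁)
        k₄ = σ * (κ * s₃)
        k₃ = σ * (k₄ + κ * s₂ + s₃)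
        k₂ = σ * (k₃ + κ * s₁ + s₂)
        k₁ = σ * (k₂ + s₁)

        source : ℕ → Carrier
        source l = C ^ l * (s₁ * β 1 l + s₂ * β 2 l + s₃ * β 3 l)

        U : ℕ → Carrier
        U l = C ^ l * (x * (y * (E * k₁)) + (k₁ - k₂) * β 1 l + (k₂ - k₃) * β 2 l + (k₃ - k₄) * β 3 l + k₄ * β 4 l)

        -- A cut at the next step leaves `suc i` letters on w and creates a cycle of `suc j`
        -- letters. The later joins of these new cycles are the inhomogeneous part of the recursion
        -- for `U`.
        source-dsum : ∀ l → x * dsum (λ i j → W (suc i) j) l ≈ source l
        source-dsum l = trans (*-congˡ (dsum-poly C A B α₁ α₀ l))
          (solve 9 (λ x A B a₀ a₁ P u v w →
            x :* (P :* (A :* (a₀ :* u :+ a₁ :* v) :+ B :* (a₀ :* (v :- u) :+ a₁ :* (w :- v)))) :=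
            P :* (x :* ((A :- B) :* a₀) :* u :+ x :* (A :* a₁ :+ B :* (a₀ :- a₁)) :* v :+ x :* (B :* a₁) :* w))
            refl x A B α₀ α₁ (C ^ l) (β 1 l) (β 2 l) (β 3 l))

        -- This fixes the constant term of `U`. Every `β j 1` with positive j is 1, so the
        -- coefficients telescope and `U 1` is C V k₁ = E k₁, while `source 0` vanishes.
        U-base : U 0 ≈ source 0 + x * (y * U 1)
        U-base = modulo (x * y * k₁) (solve 10 (λ x y E k₁ k₂ k₃ k₄ s₁ s₂ s₃ →
            𝟏 :* (x :* (y :* (E :* k₁)) :+ (k₁ :- k₂) :* 𝟎 :+ (k₂ :- k₃) :* 𝟎 :+ (k₃ :- k₄) :* 𝟎 :+ k₄ :* 𝟎) :=
            (𝟏 :* (s₁ :* 𝟎 :+ s₂ :* 𝟎 :+ s₃ :* 𝟎) :+ x :* (y :* (Cₚ x y E :* 𝟏 :* (x :* (y :* (E :* k₁)) :+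
               (k₁ :- k₂) :* (𝟎 :+ 𝟏) :+ (k₂ :- k₃) :* (𝟎 :+ (𝟎 :+ 𝟏)) :+ (k₃ :- k₄) :* (𝟎 :+ (𝟎 :+ (𝟎 :+ 𝟏))) :+
               k₄ :* (𝟎 :+ (𝟎 :+ (𝟎 :+ (𝟎 :+ 𝟏)))))))) :+
            x :* y :* k₁ :* (E :- Cₚ x y E :* Vₚ x y E)) refl x y E k₁ k₂ k₃ k₄ s₁ s₂ s₃) E-eq

        -- The two sides differ by a multiple of the characteristic equation of `C` plus the four
        -- defining equations of k₁, ..., k₄, whose cofactors are `C ^ l` times 1, `β 1`, `β 2`,
        -- `β 3` at `suc l`.
        U-step : ∀ l → U (suc l) + source l + x * (y * U (suc l)) ≈
                       U l + source (suc l) + x * (y * U (suc (suc l))) + x * U (suc l)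
        U-step l = modulo (C ^ l * β 3 (suc l)) (modulo (C ^ l * β 2 (suc l)) (modulo (C ^ l * β 1 (suc l)) (modulo (C ^ l)
            (modulo (C ^ l * h) (solve 15 (λ x y E P u₁ u₂ u₃ u₄ k₁ k₂ k₃ k₄ s₁ s₂ s₃ →
              let C = Cₚ x y E
                  t = x :* y :* (C :* C)
                  c = x :* (y :* (E :* k₁))
                  H = λ v₁ v₂ v₃ v₄ → c :+ (k₁ :- k₂) :* v₁ :+ (k₂ :- k₃) :* v₂ :+ (k₃ :- k₄) :* v₃ :+ k₄ :* v₄
                  G = λ v₁ v₂ v₃ → s₁ :* v₁ :+ s₂ :* v₂ :+ s₃ :* v₃
                  v₁ = u₁ :+ 𝟏
                  v₂ = u₂ :+ v₁
                  v₃ = u₃ :+ v₂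
                  v₄ = u₄ :+ v₃
                  w₁ = v₁ :+ 𝟏
                  w₂ = v₂ :+ w₁
                  w₃ = v₃ :+ w₂
                  w₄ = v₄ :+ w₃
                  f₁ = C :* P :* H v₁ v₂ v₃ v₄
              in f₁ :+ P :* G u₁ u₂ u₃ :+ x :* (y :* f₁) :=
                 (((((P :* H u₁ u₂ u₃ u₄ :+ C :* P :* G v₁ v₂ v₃ :+ x :* (y :* (C :* (C :* P) :* H w₁ w₂ w₃ w₄)) :+ x :* f₁) :+
                 P :* v₃ :* (k₄ :- (t :* k₄ :+ x :* E :* s₃))) :+
                 P :* v₂ :* (k₃ :- (t :* k₃ :+ (k₄ :+ x :* E :* s₂ :+ s₃)))) :+
                 P :* v₁ :* (k₂ :- (t :* k₂ :+ (k₃ :+ x :* E :* s₁ :+ s₂)))) :+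
                 P :* (k₁ :- (t :* k₁ :+ (k₂ :+ s₁)))) :+
                 P :* H v₁ v₂ v₃ v₄ :* (C :* (𝟏 :+ x :* y :- x) :- (𝟏 :+ t)))
              refl x y E (C ^ l) (β 1 l) (β 2 l) (β 3 l) (β 4 l) k₁ k₂ k₃ k₄ s₁ s₂ s₃)
            C-char) (σ-solves (k₂ + s₁))) (σ-solves (k₃ + κ * s₁ + s₂))) (σ-solves (k₄ + κ * s₂ + s₃))) (σ-solves (κ * s₃))
          where
          h : Carrier
          h = x * (y * (E * k₁)) + (k₁ - k₂) * β 1 (suc l) + (k₂ - k₃) * β 2 (suc l) + (k₃ - k₄) * β 3 (suc l) + k₄ * β 4 (suc l)

        U-rec : ∀ l → U l ≈ x * (y * U (suc l) + dsum (λ i j → U (suc i) + W (suc i) j) l)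
        U-rec l = begin
          U l
            ≈⟨ from-differences U source U-base U-step l ⟩
          source l + x * (y * U (suc l) + dsum (λ i _ → U (suc i)) l)
            ≈⟨ +-congʳ (sym (source-dsum l)) ⟩
          x * dsum (λ i j → W (suc i) j) l + x * (y * U (suc l) + dsum (λ i _ → U (suc i)) l)
            ≈⟨ solve 4 (λ x w u d → x :* w :+ x :* (u :+ d) := x :* (u :+ (d :+ w))) refl x _ _ _ ⟩
          x * (y * U (suc l) + (dsum (λ i _ → U (suc i)) l + dsum (λ i j → W (suc i) j) l))
            ≈⟨ *-congˡ (+-congˡ (sym (dsum-+ _ _ l))) ⟩
          x * (y * U (suc l) + dsum (λ i j → U (suc i) + W (suc i) j) l) ∎

        Q-replicate : ∀ n u b → Q (replicate n false ++ u) b ≈ C ^ n * Q u b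
        Q-replicate zero    u b = solve 1 (λ q → q := 𝟏 :* q) refl _
        Q-replicate (suc n) u b = trans (*-congˡ (Q-replicate n u b)) (sym (*-assoc _ _ _))

        dsum-C : ∀ n → C * dsum (λ i j → C ^ i * C ^ j) n ≈ C ^ n * β 1 n
        dsum-C zero    = solve 1 (λ c → c :* 𝟎 := 𝟏 :* 𝟎) refl C
        dsum-C (suc n) = begin
          C * (I * C ^ n + dsum (λ i j → C ^ suc i * C ^ j) n)
            ≈⟨ *-congˡ (+-congˡ (trans (dsum-cong (λ i j → *-assoc _ _ _) n) (dsum-* C _ n))) ⟩
          C * (I * C ^ n + C * dsum (λ i j → C ^ i * C ^ j) n)
            ≈⟨ *-congˡ (+-congˡ (dsum-C n)) ⟩
          C * (I * C ^ n + C ^ n * β 1 n)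
            ≈⟨ solve 3 (λ c p u → c :* (𝟏 :* p :+ p :* u) := c :* p :* (u :+ 𝟏)) refl C (C ^ n) (β 1 n) ⟩
          C ^ suc n * β 1 (suc n) ∎

        merge : List Bool → ℕ → List Bool → Carrier
        merge w b c = Σ (λ (p , a , q) → live₁ (w ++ true ∷ q ++ p ++ false ∷ []) (bump a b)) (splits c)

        -- The head of the cycle gives the `A` term. Each of the `s` other letters gives the same
        -- `B` term wherever it lies, because only the sum of `i` and `j` enters; hence the factor
        -- `β 1 s`.
        merge-closed : ∀ l s → merge (replicate l false) 0 (true ∷ replicate s false) ≈ C ^ l * (C ^ s * (A + B * β 1 s))
        merge-closed l s = begin
          live₁ (replicate l false ++ true ∷ replicate s false ++ false ∷ []) 1 + Σ _ (map _ (splits (replicate s false)))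
            ≈⟨ +-cong head (trans (Σ-map _ _ (splits (replicate s false))) (trans (Σ-splits-replicate false _ s)
                 (trans (dsum-cong tail s) (trans (dsum-* _ _ s) (trans (*-assoc _ _ _) (*-congˡ (dsum-C s))))))) ⟩
          C ^ l * (C ^ s * A) + C ^ l * B * (C ^ s * β 1 s)
            ≈⟨ solve 5 (λ P R A B u → P :* (R :* A) :+ P :* B :* (R :* u) := P :* (R :* (A :+ B :* u))) refl _ _ A B _ ⟩
          C ^ l * (C ^ s * (A + B * β 1 s)) ∎
          where
          head : live₁ (replicate l false ++ true ∷ replicate s false ++ false ∷ []) 1 ≈ C ^ l * (C ^ s * A)
          head = begin
            V * Q (replicate l false ++ true ∷ replicate s false ++ false ∷ []) 1
              ≈⟨ *-congˡ (trans (Q-replicate l _ 1) (*-congˡ (+-cong (Q-replicate s _ 1) (*-congˡ (Q-replicate s _ 2))))) ⟩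
            V * (C ^ l * (C ^ s * (C * ω 1) + x * E * (C ^ s * (C * ω 2))))
              ≈⟨ solve 7 (λ V C P R e o o′ → V :* (P :* (R :* (C :* o) :+ e :* (R :* (C :* o′)))) :=
                   P :* (R :* ((C :* V) :* (o :+ e :* o′)))) refl V C (C ^ l) (C ^ s) (x * E) (ω 1) (ω 2) ⟩
            C ^ l * (C ^ s * (C * V * (ω 1 + x * E * ω 2)))
              ≈⟨ *-congˡ (*-congˡ (*-congʳ (sym E-eq))) ⟩
            C ^ l * (C ^ s * A) ∎
          tail : ∀ i j → live₁ (replicate l false ++ true ∷ replicate j false ++ true ∷ replicate i false ++ false ∷ []) 0
                 ≈ C ^ l * B * C * (C ^ i * C ^ j)
          tail i j = begin
            V * Q (replicate l false ++ true ∷ replicate j false ++ true ∷ replicate i false ++ false ∷ []) 0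
              ≈⟨ *-congˡ (trans (Q-replicate l _ 0) (*-congˡ (+-cong (two 0) (*-congˡ (two 1))))) ⟩
            V * (C ^ l * (C ^ j * (C ^ i * (C * ω 0) + x * E * (C ^ i * (C * ω 1))) +
              x * E * (C ^ j * (C ^ i * (C * ω 1) + x * E * (C ^ i * (C * ω 2))))))
              ≈⟨ solve 9 (λ V C P L M e o o′ o″ →
                   V :* (P :* (M :* (L :* (C :* o) :+ e :* (L :* (C :* o′))) :+ e :* (M :* (L :* (C :* o′) :+ e :* (L :* (C :* o″)))))) :=
                   P :* (V :* (o :+ e :* o′ :+ e :* (o′ :+ e :* o″))) :* C :* (L :* M))
                   refl V C (C ^ l) (C ^ i) (C ^ j) (x * E) (ω 0) (ω 1) (ω 2) ⟩
            C ^ l * B * C * (C ^ i * C ^ j) ∎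
            where
            two : ∀ b → Q (replicate j false ++ true ∷ replicate i false ++ false ∷ []) b ≈
                  C ^ j * (C ^ i * (C * ω b) + x * E * (C ^ i * (C * ω (suc b))))
            two b = trans (Q-replicate j _ b) (*-congˡ (+-cong (Q-replicate i _ b) (*-congˡ (Q-replicate i _ (suc b)))))

        -- Exactly one cycle gets joined: either one that is still to be cut off, or one of those
        -- present.
        live₀ : ℕ → List ℕ → Carrier
        live₀ l ss = U l + Σ (W l) ss

        live₀-rec : ∀ l ss → live₀ l ss ≈ x * ((y * live₀ (suc l) ss + dsum (λ i j → live₀ (suc i) (j ∷ ss)) l) +
                      Σ (λ s → merge (replicate l false) 0 (true ∷ replicate s false)) ss)
        live₀-rec l ss = begin
          U l + Σ (W l) ss
            ≈⟨ +-cong (U-rec l) (trans (Σ-cong (W-rec l) ss) (trans (Σ-* x _ ss) (*-congˡ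
                 (trans (Σ-+ _ _ ss) (+-congʳ (trans (Σ-+ _ _ ss) (+-congʳ (Σ-* y _ ss)))))))) ⟩
          x * (y * U (suc l) + dsum (λ i j → U (suc i) + W (suc i) j) l) +
            x * ((y * Σ (W (suc l)) ss + Σ (λ s → dsum (λ i _ → W (suc i) s) l) ss) + Σ (λ s → C ^ l * (C ^ s * (A + B * β 1 s))) ss)
            ≈⟨ solve 7 (λ x y u d w e m → x :* (y :* u :+ d) :+ x :* ((y :* w :+ e) :+ m) :=
                 x :* ((y :* (u :+ w) :+ (d :+ e)) :+ m)) refl x y _ _ _ _ _ ⟩
          x * ((y * live₀ (suc l) ss + (dsum (λ i j → U (suc i) + W (suc i) j) l + Σ (λ s → dsum (λ i _ → W (suc i) s) l) ss)) +
            Σ (λ s → C ^ l * (C ^ s * (A + B * β 1 s))) ss)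
            ≈⟨ *-congˡ (+-cong (+-congˡ (trans (+-congˡ (sym (dsum-Σ (λ s i _ → W (suc i) s) ss l)))
                 (trans (sym (dsum-+ _ _ l)) (dsum-cong (λ i j → +-assoc _ _ _) l))))
                 (Σ-cong (λ s → sym (merge-closed l s)) ss)) ⟩
          x * ((y * live₀ (suc l) ss + dsum (λ i j → live₀ (suc i) (j ∷ ss)) l) +
            Σ (λ s → merge (replicate l false) 0 (true ∷ replicate s false)) ss) ∎

        -- Evaluation at the one-letter state

        1+κσ : I + κ * σ ≈ S * (I - x * (y * C))
        1+κσ = modulo (S * x) (modulo (⟦ ℤ.- (+ 1) ⟧) (solve 4 (λ x y E S →
            𝟏 :+ x :* E :* (S :* (𝟏 :- x :* Vₚ x y E)) :=
            ((S :* (𝟏 :- x :* (y :* Cₚ x y E)) :+ S :* x :* (E :- Cₚ x y E :* Vₚ x y E)) :+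
            con (ℤ.- (+ 1)) :* (S :* Rₚ x y E :- 𝟏))) refl x y E S) SR) E-eq

        σ≈1+σt : σ ≈ I + σ * t
        σ≈1+σt = trans (solve 1 (λ σ → σ := σ :* 𝟏) refl σ) (trans (σ-solves I)
          (solve 2 (λ σ t → t :* (σ :* 𝟏) :+ 𝟏 := 𝟏 :+ σ :* t) refl σ t))

        Cσ≈S : C * σ ≈ S
        Cσ≈S = trans (solve 3 (λ C S c → C :* (S :* c) := S :* (C :* c)) refl C S (I - x * V))
          (trans (*-congˡ C⁻¹) (solve 1 (λ s → s :* 𝟏 := s) refl S))

        α₀+σα₁ : α₀ + σ * α₁ ≈ x * (S * S * (I - x * V - x * y))
        α₀+σα₁ = begin
          V * (x + x * (y * (C * (σ * (x * κ))))) + σ * (σ * (x * κ))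
            ≈⟨ modulo (- (x * κ * σ)) (solve 6 (λ V C x y σ κ →
                 V :* (x :+ x :* (y :* (C :* (σ :* (x :* κ))))) :+ σ :* (σ :* (x :* κ)) :=
                 x :* (V :* (𝟏 :+ κ :* σ) :+ κ :* σ :* (σ :- 𝟏)) :+ (:- (x :* κ :* σ)) :* (V :* (𝟏 :- x :* (y :* C)) :- 𝟏))
                 refl V C x y σ κ) V⁻¹ ⟩
          x * (V * (I + κ * σ) + κ * σ * (σ - I))
            ≈⟨ *-congˡ (+-cong (*-congˡ 1+κσ) (*-congˡ (+-congʳ σ≈1+σt))) ⟩
          x * (V * (S * (I - x * (y * C))) + κ * σ * (I + σ * t - I))
            ≈⟨ solve 8 (λ x y V S v κ σ C → x :* (V :* (S :* v) :+ κ :* σ :* (𝟏 :+ σ :* (x :* y :* (C :* C)) :- 𝟏)) :=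
                 x :* (S :* (V :* v) :+ κ :* x :* y :* (C :* σ) :* (C :* σ))) refl x y V S _ κ σ C ⟩
          x * (S * (V * (I - x * (y * C))) + κ * x * y * (C * σ) * (C * σ))
            ≈⟨ *-congˡ (+-cong (*-congˡ (trans V⁻¹ (sym SR))) (*-cong (*-congˡ Cσ≈S) Cσ≈S)) ⟩
          x * (S * (S * Rt) + κ * x * y * S * S)
            ≈⟨ solve 4 (λ x y E S → x :* (S :* (S :* Rₚ x y E) :+ x :* E :* x :* y :* S :* S) :=
                 x :* (S :* S :* (𝟏 :- x :* Vₚ x y E :- x :* y))) refl x y E S ⟩
          x * (S * S * (I - x * V - x * y)) ∎

        -- The weights enter the result only here. The choices 1, 1, 1 and the three unit vectors
        -- give 1, xy, 1 - xy - x and x, the numerators of the four series over x³y.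
        bracket : Carrier
        bracket = (x * y * ω 0 + (I - x * y - x) * ω 1) + x * ω 2

        A+Bσ : A + B * (σ - I) ≈ E * (S * bracket)
        A+Bσ = begin
          A + B * (σ - I)
            ≈⟨ +-congˡ (*-congˡ (+-congʳ σ≈1+σt)) ⟩
          E * a + V * b * (I + σ * t - I)
            ≈⟨ solve 8 (λ E V a b σ x y C → E :* a :+ V :* b :* (𝟏 :+ σ :* (x :* y :* (C :* C)) :- 𝟏) :=
                 E :* (a :* 𝟏) :+ (C :* V) :* (b :* x :* y :* (C :* σ))) refl E V a b σ x y C ⟩
          E * (a * I) + C * V * (b * x * y * (C * σ))
            ≈⟨ +-cong (*-congˡ (*-congˡ (sym SR))) (*-cong (sym E-eq) (*-congˡ Cσ≈S)) ⟩
          E * (a * (S * Rt)) + E * (b * x * y * S)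
            ≈⟨ modulo (E * S * x * ω 2) (solve 7 (λ x y E S o o′ o″ →
                 E :* ((o′ :+ x :* E :* o″) :* (S :* Rₚ x y E)) :+
                   E :* ((o :+ x :* E :* o′ :+ x :* E :* (o′ :+ x :* E :* o″)) :* x :* y :* S) :=
                 E :* (S :* ((x :* y :* o :+ (𝟏 :- x :* y :- x) :* o′) :+ x :* o″)) :+
                   E :* S :* x :* o″ :* (E :- Cₚ x y E :* Vₚ x y E)) refl x y E S (ω 0) (ω 1) (ω 2)) E-eq ⟩
          E * (S * bracket) ∎
          where
          a b : Carrier
          a = ω 1 + x * E * ω 2
          b = ω 0 + x * E * ω 1 + x * E * (ω 1 + x * E * ω 2)

        -- Back substitution gives k₁ = (1 + κσ)(s₁σ + s₂σ² + s₃σ³), and s₁ + s₂σ + s₃σ² factors as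
        -- x (A + B(σ - 1))(α₀ + σα₁). The factors σ, 1 + κσ and A + B(σ - 1) carry one `S` each and
        -- α₀ + σα₁ carries two, which is the exponent 5. The rest cancels by C(1 - xV) = V(1 - xyC)
        -- = E(1 - xV - xy) = 1.
        Ek₁ : E * k₁ ≈ x * x * (S * (S * (S * (S * S)))) * bracket
        Ek₁ = begin
          E * k₁
            ≈⟨ solve 8 (λ E σ κ x A B a₀ a₁ →
                 let s₁ = x :* ((A :- B) :* a₀)
                     s₂ = x :* (A :* a₁ :+ B :* (a₀ :- a₁))
                     s₃ = x :* (B :* a₁)
                 in E :* (σ :* (σ :* (σ :* (σ :* (κ :* s₃) :+ κ :* s₂ :+ s₃) :+ κ :* s₁ :+ s₂) :+ s₁)) :=
                    E :* (σ :* (𝟏 :+ κ :* σ) :* (x :* ((A :+ B :* (σ :- 𝟏)) :* (a₀ :+ σ :* a₁)))))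
                 refl E σ κ x A B α₀ α₁ ⟩
          E * (σ * (I + κ * σ) * (x * ((A + B * (σ - I)) * (α₀ + σ * α₁))))
            ≈⟨ *-cong E-eq (*-cong (*-congˡ 1+κσ) (*-congˡ (*-cong A+Bσ α₀+σα₁))) ⟩
          C * V * (S * (I - x * V) * (S * (I - x * (y * C))) * (x * (E * (S * bracket) * (x * (S * S * (I - x * V - x * y))))))
            ≈⟨ solve 9 (λ C V S c v x E b m → C :* V :* (S :* c :* (S :* v) :* (x :* (E :* (S :* b) :* (x :* (S :* S :* m))))) :=
                 x :* x :* (S :* (S :* (S :* (S :* S)))) :* b :* ((C :* c) :* (V :* v) :* (E :* m)))
                 refl C V S (I - x * V) (I - x * (y * C)) x E bracket (I - x * V - x * y) ⟩
          x * x * (S * (S * (S * (S * S)))) * bracket * (C * (I - x * V) * (V * (I - x * (y * C))) * (E * (I - x * V - x * y)))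
            ≈⟨ *-congˡ (*-cong (*-cong C⁻¹ V⁻¹) (modulo I (solve 3 (λ x y E → E :* (𝟏 :- x :* Vₚ x y E :- x :* y) :=
                 𝟏 :+ 𝟏 :* (E :- Cₚ x y E :* Vₚ x y E)) refl x y E) E-eq)) ⟩
          x * x * (S * (S * (S * (S * S)))) * bracket * (I * I * I)
            ≈⟨ solve 1 (λ a → a :* (𝟏 :* 𝟏 :* 𝟏) := a) refl _ ⟩
          x * x * (S * (S * (S * (S * S)))) * bracket ∎

        U₁ : U 1 ≈ x * x * (S * (S * (S * (S * S)))) * bracket
        U₁ = begin
          U 1
            ≈⟨ solve 7 (λ x y E k₁ k₂ k₃ k₄ → Cₚ x y E :* 𝟏 :* (x :* (y :* (E :* k₁)) :+
                 (k₁ :- k₂) :* (𝟎 :+ 𝟏) :+ (k₂ :- k₃) :* (𝟎 :+ (𝟎 :+ 𝟏)) :+ (k₃ :- k₄) :* (𝟎 :+ (𝟎 :+ (𝟎 :+ 𝟏))) :+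
                 k₄ :* (𝟎 :+ (𝟎 :+ (𝟎 :+ (𝟎 :+ 𝟏))))) := Cₚ x y E :* Vₚ x y E :* k₁) refl x y E k₁ k₂ k₃ k₄ ⟩
          C * V * k₁   ≈⟨ *-congʳ (sym E-eq) ⟩
          E * k₁       ≈⟨ Ek₁ ⟩
          x * x * (S * (S * (S * (S * S)))) * bracket ∎

        -- The root is the one-letter permutation: one letter, one cycle, w a single non-excedance.
        total : Carrier
        total = x * (y * live₀ 1 [])

        total≈ : total ≈ x * (y * (x * x * (S * (S * (S * (S * S)))) * bracket))
        total≈ = *-congˡ (*-congˡ (trans (solve 1 (λ u → u :+ 𝟎 := u) refl (U 1)) U₁))

        bracket-cong : ∀ {a b c} → ω 0 ≈ a → ω 1 ≈ b → ω 2 ≈ c →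
          total ≈ x * (y * (x * x * (S * (S * (S * (S * S)))) * ((x * y * a + (I - x * y - x) * b) + x * c)))
        bracket-cong p q r = trans total≈ (*-congˡ (*-congˡ (*-congˡ (+-cong (+-cong (*-congˡ p) (*-congˡ q)) (*-congˡ r)))))

        total₁₁₁ : ω 0 ≈ I → ω 1 ≈ I → ω 2 ≈ I → total ≈ x ^ 3 * y * S ^ 5
        total₁₁₁ p q r = trans (bracket-cong p q r) (solve 3 (λ x y S →
          x :* (y :* (x :* x :* (S :* (S :* (S :* (S :* S)))) :* ((x :* y :* 𝟏 :+ (𝟏 :- x :* y :- x) :* 𝟏) :+ x :* 𝟏))) :=
          x :* (x :* (x :* 𝟏)) :* y :* (S :* (S :* (S :* (S :* (S :* 𝟏)))))) refl x y S)

        total₁₀₀ : ω 0 ≈ I → ω 1 ≈ O → ω 2 ≈ O →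
          total ≈ x ^ 4 * y ^ 2 * S ^ 5
        total₁₀₀ p q r = trans (bracket-cong p q r) (solve 3 (λ x y S →
          x :* (y :* (x :* x :* (S :* (S :* (S :* (S :* S)))) :* ((x :* y :* 𝟏 :+ (𝟏 :- x :* y :- x) :* 𝟎) :+ x :* 𝟎))) :=
          x :* (x :* (x :* (x :* 𝟏))) :* (y :* (y :* 𝟏)) :* (S :* (S :* (S :* (S :* (S :* 𝟏)))))) refl x y S)

        total₀₁₀ : ω 0 ≈ O → ω 1 ≈ I → ω 2 ≈ O →
          total ≈ x ^ 3 * y * (I - x * y - x) * S ^ 5
        total₀₁₀ p q r = trans (bracket-cong p q r) (solve 3 (λ x y S →
          x :* (y :* (x :* x :* (S :* (S :* (S :* (S :* S)))) :* ((x :* y :* 𝟎 :+ (𝟏 :- x :* y :- x) :* 𝟏) :+ x :* 𝟎))) :=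
          x :* (x :* (x :* 𝟏)) :* y :* (𝟏 :- x :* y :- x) :* (S :* (S :* (S :* (S :* (S :* 𝟏)))))) refl x y S)

        total₀₀₁ : ω 0 ≈ O → ω 1 ≈ O → ω 2 ≈ I →
          total ≈ x ^ 4 * y * S ^ 5
        total₀₀₁ p q r = trans (bracket-cong p q r) (solve 3 (λ x y S →
          x :* (y :* (x :* x :* (S :* (S :* (S :* (S :* S)))) :* ((x :* y :* 𝟎 :+ (𝟏 :- x :* y :- x) :* 𝟎) :+ x :* 𝟏))) :=
          x :* (x :* (x :* (x :* 𝟏))) :* y :* (S :* (S :* (S :* (S :* (S :* 𝟏)))))) refl x y S)

-- Existence of E, the inverse square root, and counting along the generating tree

module GeneratingTree where

  open PowerSeries
  open ClosedForms
  open import Function using (_∘_; id)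
  open import Data.Bool using (Bool; true; false; if_then_else_; _∧_)
  open import Data.Nat as ℕ using (ℕ; zero; suc; s≤s; z≤n; _≡ᵇ_)
  open import Data.Nat.Properties using (≤-trans; ≤-refl; n≤1+n)
  open import Data.Integer as ℤ using (ℤ; +_)
  import Data.Integer.Properties as ℤ
  open import Data.Product using (_×_; _,_; proj₁; proj₂)
  open import Data.Sum using ([_,_]′)
  open import Data.Empty using (⊥-elim)
  open import Data.List using (List; []; _∷_; _++_; map; replicate)
  open import Relation.Binary.PropositionalEquality as ≡ using (_≡_; refl; sym; trans; cong; cong₂; module ≡-Reasoning)

  Agree : ℕ → PS → PS → Set
  Agree N f g = ∀ n k → n ℕ.< N → f n k ≡ g n k

  ⊗-agree : ∀ {N f f′ g g′} → Agree N f f′ → Agree N g g′ → Agree N (f ⊗ g) (f′ ⊗ g′)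
  ⊗-agree {f = f} {f′} {g} {g′} p q n k n<N = begin
    (f ⊗ g) n k                 ≡⟨ ⊗-conv f g n k ⟩
    ℤ[y][x].conv f g n k        ≡⟨ ℤ[y][x].conv-cong≤ n (λ i i≤n k → p i k (≤-trans (s≤s i≤n) n<N))
                                     (λ i i≤n k → q i k (≤-trans (s≤s i≤n) n<N)) k ⟩
    ℤ[y][x].conv f′ g′ n k      ≡⟨ ⊗-conv f′ g′ n k ⟨
    (f′ ⊗ g′) n k ∎
    where open ≡-Reasoning

  X⊗-agree : ∀ {N f g} → Agree N f g → Agree (suc N) (X ⊗ f) (X ⊗ g)
  X⊗-agree {f = f} {g} p zero    k _         = trans (X⊗-zero f k) (sym (X⊗-zero g k))
  X⊗-agree {f = f} {g} p (suc n) k (s≤s n<N) = trans (X⊗-suc f n k) (trans (p n k n<N) (sym (X⊗-suc g n k)))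

  𝟙⊕-agree : ∀ {N f g} → Agree N f g → Agree N (𝟙 ⊕ f) (𝟙 ⊕ g)
  𝟙⊕-agree p n k n<N = cong (λ r → 𝟙 n k ℤ.+ r) (p n k n<N)

  Φ : PS → PS
  Φ f = (𝟙 ⊕ X ⊗ f) ⊗ (𝟙 ⊕ X ⊗ (Y ⊗ f))

  -- Every occurrence of `f` in `Φ f` is multiplied by `X`, so agreement improves by one degree and
  -- the diagonal of the iterates is a fixed point.
  Φ-contracts : ∀ {N f g} → Agree N f g → Agree (suc N) (Φ f) (Φ g)
  Φ-contracts {f = f} {g} p = ⊗-agree (𝟙⊕-agree (X⊗-agree p)) (𝟙⊕-agree (X⊗-agree (⊗-agree {f = Y} {Y} {f} {g} (λ _ _ _ → refl) p)))

  Φ-iterate : ℕ → PS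
  Φ-iterate zero    = 𝟙
  Φ-iterate (suc N) = Φ (Φ-iterate N)

  Φ-stable : ∀ {M N} → M ℕ.≤ N → Agree M (Φ-iterate M) (Φ-iterate N)
  Φ-stable z≤n       n k ()
  Φ-stable (s≤s M≤N) = Φ-contracts (Φ-stable M≤N)

  𝔼 : PS
  𝔼 n k = Φ-iterate (suc n) n k

  𝔼-fix : 𝔼 ≐ Φ 𝔼
  𝔼-fix n k = begin
    Φ-iterate (suc n) n k        ≡⟨ Φ-stable (n≤1+n (suc n)) n k ≤-refl ⟩
    Φ (Φ-iterate (suc n)) n k    ≡⟨ Φ-contracts {suc n} {𝔼} {Φ-iterate (suc n)} 𝔼-agree n k (n≤1+n (suc n)) ⟨
    Φ 𝔼 n k ∎
    where
    open ≡-Reasoning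
    𝔼-agree : Agree (suc n) 𝔼 (Φ-iterate (suc n))
    𝔼-agree m j m<1+n = Φ-stable m<1+n m j ≤-refl

  module CP = Closed PS-ring constHom

  module WithSeries (S : PS) (hS : IsInvSqrtΔ S) where

    ℝ : PS
    ℝ = CP.Rt X Y 𝔼 𝔼-fix

    SR-1 SR+1 : PS
    SR-1 = S ⊗ ℝ ⊝ 𝟙
    SR+1 = S ⊗ ℝ ⊕ 𝟙

    ℝ² : ℝ ⊗ ℝ ≐ Δ
    ℝ² = CP.Rt² X Y 𝔼 𝔼-fix

    SR² : (S ⊗ ℝ) ⊗ (S ⊗ ℝ) ≐ 𝟙
    SR² = PSR.trans {(S ⊗ ℝ) ⊗ (S ⊗ ℝ)} {S ⊗ S ⊗ (ℝ ⊗ ℝ)} {𝟙} (interchange S ℝ S ℝ)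
      (PSR.trans {S ⊗ S ⊗ (ℝ ⊗ ℝ)} {S ⊗ S ⊗ Δ} {𝟙} (PSR.*-congˡ {S ⊗ S} {ℝ ⊗ ℝ} {Δ} ℝ²) (proj₂ hS))
      where open import Algebra.Properties.CommutativeSemigroup PSR.*-commutativeSemigroup using (interchange)

    SR+1₀₀ : SR+1 0 0 ≡ + 2
    SR+1₀₀ = cong (λ r → r ℤ.+ + 1) (trans (⊗-conv S ℝ 0 0) (cong₂ ℤ._*_ (proj₁ hS) ℝ₀₀))
      where
      ℝ₀₀ : ℝ 0 0 ≡ + 1
      ℝ₀₀ = cong (λ r → + 1 ℤ.+ (ℤ.- r)) (X⊗-zero (𝟙 ⊕ Y ⊕ constPS (+ 2) ⊗ (X ⊗ (Y ⊗ 𝔼))) 0)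

    -- By `SR²` the product of `SR-1` and `SR+1` vanishes. The constant term 2 of `SR+1` is no zero
    -- divisor, and this settles the sign of the square root.
    SR-1≐0 : ∀ n k → SR-1 n k ≡ + 0
    SR-1≐0 = ℤ[y][x].cancel {SR+1} (λ c p → ℤ[y].cancel {SR+1 0} nonzero c p) SR-1
      (λ n k → trans (sym (⊗-conv SR-1 SR+1 n k)) (product n k))
      where
      nonzero : ∀ c → c ℤ.* SR+1 0 0 ≡ + 0 → c ≡ + 0
      nonzero c p = [ id , (λ q → ⊥-elim (2≢0 (trans (sym SR+1₀₀) q))) ]′ (ℤ.i*j≡0⇒i≡0∨j≡0 c p)
        where
        2≢0 : + 2 ≡ + 0 → _
        2≢0 ()
      product : SR-1 ⊗ SR+1 ≐ λ _ _ → + 0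
      product n k = trans (CP.Solver.solve 1 (λ s → (s CP.Solver.:- CP.𝟏) CP.Solver.:* (s CP.Solver.:+ CP.𝟏) CP.Solver.:= s CP.Solver.:* s CP.Solver.:- CP.𝟏)
          (λ _ _ → refl) (S ⊗ ℝ) n k)
        (trans (cong (λ r → r ℤ.+ (ℤ.- 𝟙 n k)) (SR² n k)) (ℤ.+-inverseʳ (𝟙 n k)))

    SR : S ⊗ ℝ ≐ 𝟙
    SR n k = ℤ.i-j≡0⇒i≡j _ _ (SR-1≐0 n k)

  sumBy : {A : Set} → (A → ℤ) → List A → ℤ
  sumBy f []       = + 0
  sumBy f (a ∷ as) = f a ℤ.+ sumBy f as

  sumBy-cong : ∀ {A : Set} {f g : A → ℤ} → (∀ a → f a ≡ g a) → ∀ as → sumBy f as ≡ sumBy g as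
  sumBy-cong p []       = refl
  sumBy-cong p (a ∷ as) = cong₂ ℤ._+_ (p a) (sumBy-cong p as)

  sumBy-map : ∀ {A B : Set} (f : A → ℤ) (g : B → A) bs → sumBy f (map g bs) ≡ sumBy (f ∘ g) bs
  sumBy-map f g []       = refl
  sumBy-map f g (b ∷ bs) = cong (λ r → f (g b) ℤ.+ r) (sumBy-map f g bs)

  -- A state has genus g, b back points and k cycles; w and os list the excedance marks along the cycle
  -- of β through the largest letter and along the other cycles.  F ω N counts its N-step continuations
  -- with genus one and κ cycles, weighted by ω of the number of back points.
  F : (ℕ → ℤ) → ℕ → (g b k : ℕ) → List Bool → List (List Bool) → ℕ → ℤ
  F ω zero    g b k w os κ = if (g ≡ᵇ 1) ∧ (k ≡ᵇ κ) then ω b else + 0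
  -- The summands are fixed point, cuts and joins. The letter inserted after gets the mark `true`,
  -- as its image is now the largest letter; the new letter gets `false` and ends its cycle.
  F ω (suc N) g b k w os κ =
    F ω N g b (suc k) (w ++ false ∷ []) os κ ℤ.+
    (sumBy (λ (p , a , q) → F ω N g (bump a b) k (p ++ false ∷ []) ((true ∷ q) ∷ os) κ) (splits w) ℤ.+
     sumBy (λ (c , os′) → sumBy (λ (p , a , q) →
       F ω N (suc g) (bump a b) k (w ++ true ∷ q ++ p ++ false ∷ []) os′ κ) (splits c)) (picks os))

  -- Multiplication by y^k on coefficient sequences in y; it accounts for the cycles already
  -- present.
  shift : ℕ → (ℕ → ℤ) → ℕ → ℤ
  shift zero    f κ       = f κ
  shift (suc k) f zero    = + 0
  shift (suc k) f (suc κ) = shift k f κ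

  shift-cong : ∀ k {f g} → (∀ κ → f κ ≡ g κ) → ∀ κ → shift k f κ ≡ shift k g κ
  shift-cong zero    p κ       = p κ
  shift-cong (suc k) p zero    = refl
  shift-cong (suc k) p (suc κ) = shift-cong k p κ

  shift-+ : ∀ k f g κ → shift k (λ i → f i ℤ.+ g i) κ ≡ shift k f κ ℤ.+ shift k g κ
  shift-+ zero    f g κ       = refl
  shift-+ (suc k) f g zero    = refl
  shift-+ (suc k) f g (suc κ) = shift-+ k f g κ

  shift-0 : ∀ k κ → shift k (λ _ → + 0) κ ≡ + 0
  shift-0 zero    κ       = refl
  shift-0 (suc k) zero    = refl
  shift-0 (suc k) (suc κ) = shift-0 k κ

  shift-Y : ∀ k f n κ → shift k ((Y ⊗ f) n) κ ≡ shift (suc k) (f n) κ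
  shift-Y zero    f n zero    = Y⊗-zero f n
  shift-Y zero    f n (suc κ) = Y⊗-suc f n κ
  shift-Y (suc k) f n zero    = refl
  shift-Y (suc k) f n (suc κ) = shift-Y k f n κ

  shift-const : ∀ k c κ → shift k (constPS c 0) κ ≡ (if k ≡ᵇ κ then c else + 0)
  shift-const zero    c zero    = refl
  shift-const zero    c (suc κ) = refl
  shift-const (suc k) c zero    = refl
  shift-const (suc k) c (suc κ) = shift-const k c κ

  constPS-0 : ∀ n k → constPS (+ 0) n k ≡ + 0
  constPS-0 zero    zero    = refl
  constPS-0 zero    (suc k) = refl
  constPS-0 (suc n) k       = refl

  module _ (k N κ : ℕ) where
    shift-Σ : {A : Set} (G : A → ℤ) (h : A → PS) → (∀ a → G a ≡ shift k (h a N) κ) →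
              ∀ as → sumBy G as ≡ shift k (CP.Σ h as N) κ
    shift-Σ G h p []       = sym (trans (shift-cong k (constPS-0 N) κ) (shift-0 k κ))
    shift-Σ G h p (a ∷ as) = trans (cong₂ ℤ._+_ (p a) (shift-Σ G h p as)) (sym (shift-+ k _ _ κ))

    shift-dsum : ∀ {A : Set} (c : A) (G : List A × A × List A → ℤ) (h : ℕ → ℕ → PS) →
                 (∀ i j → G (replicate i c , c , replicate j c) ≡ shift k (h i j N) κ) →
                 ∀ l → sumBy G (splits (replicate l c)) ≡ shift k (CP.dsum h l N) κ
    shift-dsum c G h p zero    = sym (trans (shift-cong k (constPS-0 N) κ) (shift-0 k κ))
    shift-dsum c G h p (suc l) = trans
      (cong₂ ℤ._+_ (p 0 l) (trans (sumBy-map G _ (splits (replicate l c)))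
        (shift-dsum c (λ (l , a , r) → G (c ∷ l , a , r)) (h ∘ suc) (λ i j → p (suc i) j) l)))
      (sym (shift-+ k _ _ κ))

  module Generating (S : PS) (hS : IsInvSqrtΔ S) (ω : ℕ → ℤ) where

    module L = CP.Walks X Y 𝔼 𝔼-fix S (WithSeries.SR S hS) (constPS ∘ ω)

    sumBy-zero : ∀ {A : Set} (f : A → ℤ) → (∀ a → f a ≡ + 0) → ∀ as → sumBy f as ≡ + 0
    sumBy-zero f p []       = refl
    sumBy-zero f p (a ∷ as) = cong₂ ℤ._+_ (p a) (sumBy-zero f p as)

    F-genus≥2 : ∀ N g b k w os κ → F ω N (suc (suc g)) b k w os κ ≡ + 0
    F-genus≥2 zero    g b k w os κ = refl
    F-genus≥2 (suc N) g b k w os κ = cong₂ ℤ._+_ (F-genus≥2 N g b (suc k) _ os κ) (cong₂ ℤ._+_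
      (sumBy-zero _ (λ (p , a , q) → F-genus≥2 N g (bump a b) k (p ++ false ∷ []) ((true ∷ q) ∷ os) κ) (splits w))
      (sumBy-zero _ (λ (c , os′) → sumBy-zero _ (λ (p , a , q) →
        F-genus≥2 N (suc g) (bump a b) k (w ++ true ∷ q ++ p ++ false ∷ []) os′ κ) (splits c)) (picks os)))

    -- The other cycles `os` could act only through a join, which leads to genus two and counts
    -- nothing; so they are absent on the right.
    F-genus1 : ∀ N b k w os κ → F ω N 1 b k w os κ ≡ shift k (L.live₁ w b N) κ
    F-genus1 zero    b k w os κ = sym (trans (shift-cong k (λ i → begin
        L.live₁ w b 0 i                     ≡⟨ L.live₁-rec w b 0 i ⟩
        constPS (ω b) 0 i ℤ.+ (X ⊗ rest) 0 i ≡⟨ cong (λ r → constPS (ω b) 0 i ℤ.+ r) (X⊗-zero rest i) ⟩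
        constPS (ω b) 0 i ℤ.+ + 0            ≡⟨ ℤ.+-identityʳ _ ⟩
        constPS (ω b) 0 i ∎) κ) (shift-const k (ω b) κ))
      where
      open ≡-Reasoning
      rest : PS
      rest = Y ⊗ L.live₁ (w ++ false ∷ []) b ⊕ CP.Σ (λ (p , a , q) → L.live₁ (p ++ false ∷ []) (bump a b)) (splits w)
    F-genus1 (suc N) b k w os κ = begin
      F ω (suc N) 1 b k w os κ
        ≡⟨ cong₂ ℤ._+_ (trans (F-genus1 N b (suc k) (w ++ false ∷ []) os κ) (sym (shift-Y k fixed N κ)))
             (trans (cong₂ ℤ._+_ (shift-Σ k N κ _ child (λ (p , a , q) →
                 F-genus1 N (bump a b) k (p ++ false ∷ []) ((true ∷ q) ∷ os) κ) (splits w))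
               (sumBy-zero _ (λ (c , os′) → sumBy-zero _ (λ (p , a , q) →
                 F-genus≥2 N 0 (bump a b) k (w ++ true ∷ q ++ p ++ false ∷ []) os′ κ) (splits c)) (picks os)))
               (ℤ.+-identityʳ _)) ⟩
      shift k ((Y ⊗ fixed) N) κ ℤ.+ shift k (CP.Σ child (splits w) N) κ
        ≡⟨ shift-+ k _ _ κ ⟨
      shift k (rest N) κ
        ≡⟨ shift-cong k (λ i → trans (cong (λ r → + 0 ℤ.+ r) (X⊗-suc rest N i)) (ℤ.+-identityˡ _)) κ ⟨
      shift k (λ i → constPS (ω b) (suc N) i ℤ.+ (X ⊗ rest) (suc N) i) κ
        ≡⟨ shift-cong k (λ i → L.live₁-rec w b (suc N) i) κ ⟨
      shift k (L.live₁ w b (suc N)) κ ∎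
      where
      open ≡-Reasoning
      fixed rest : PS
      child : List Bool × Bool × List Bool → PS
      fixed = L.live₁ (w ++ false ∷ []) b
      child = λ (p , a , q) → L.live₁ (p ++ false ∷ []) (bump a b)
      rest = Y ⊗ fixed ⊕ CP.Σ child (splits w)

    replicate-∷ʳ : ∀ {A : Set} n (a : A) → replicate n a ++ a ∷ [] ≡ replicate (suc n) a
    replicate-∷ʳ zero    a = refl
    replicate-∷ʳ (suc n) a = cong (a ∷_) (replicate-∷ʳ n a)

    -- The marks of a cycle cut off w in genus zero, read from the letter at the cut.
    notch : ℕ → List Bool
    notch s = true ∷ replicate s false

    -- Words without excedance on w and notches elsewhere are preserved by fixed points and cuts.
    -- Cuts meet only non-excedances, so no back point arises before the join, where `F-genus1`
    -- takes over.
    F-genus0 : ∀ N k l ss κ → F ω N 0 0 k (replicate l false) (map notch ss) κ ≡ shift k (L.live₀ l ss N) κ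
    F-genus0 zero    k l ss κ = sym (trans (shift-cong k (λ i → trans (L.live₀-rec l ss 0 i) (X⊗-zero rest i)) κ) (shift-0 k κ))
      where
      rest : PS
      rest = Y ⊗ L.live₀ (suc l) ss ⊕ CP.dsum (λ i j → L.live₀ (suc i) (j ∷ ss)) l ⊕
             CP.Σ (λ s → L.merge (replicate l false) 0 (notch s)) ss
    F-genus0 (suc N) k l ss κ = begin
      F ω (suc N) 0 0 k (replicate l false) (map notch ss) κ
        ≡⟨ cong₂ ℤ._+_ grown (cong₂ ℤ._+_ cut merged) ⟩
      shift k (fixed N) κ ℤ.+ (shift k (split N) κ ℤ.+ shift k (joined N) κ)
        ≡⟨ ℤ.+-assoc (shift k (fixed N) κ) _ _ ⟨
      shift k (fixed N) κ ℤ.+ shift k (split N) κ ℤ.+ shift k (joined N) κ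
        ≡⟨ cong (λ r → r ℤ.+ shift k (joined N) κ) (shift-+ k (fixed N) (split N) κ) ⟨
      shift k ((fixed ⊕ split) N) κ ℤ.+ shift k (joined N) κ
        ≡⟨ shift-+ k ((fixed ⊕ split) N) (joined N) κ ⟨
      shift k ((fixed ⊕ split ⊕ joined) N) κ
        ≡⟨ shift-cong k {L.live₀ l ss (suc N)} {(fixed ⊕ split ⊕ joined) N} (λ i →
             trans (L.live₀-rec l ss (suc N) i) (X⊗-suc (fixed ⊕ split ⊕ joined) N i)) κ ⟨
      shift k (L.live₀ l ss (suc N)) κ ∎
      where
      open ≡-Reasoning
      merge : List Bool → PS
      merge = L.merge (replicate l false) 0
      fixed split joined : PS
      fixed = Y ⊗ L.live₀ (suc l) ss
      split = CP.dsum (λ i j → L.live₀ (suc i) (j ∷ ss)) l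
      joined = CP.Σ (λ s → merge (notch s)) ss

      grown : F ω N 0 0 (suc k) (replicate l false ++ false ∷ []) (map notch ss) κ ≡ shift k (fixed N) κ
      grown = begin
        F ω N 0 0 (suc k) (replicate l false ++ false ∷ []) (map notch ss) κ
          ≡⟨ cong (λ u → F ω N 0 0 (suc k) u (map notch ss) κ) (replicate-∷ʳ l false) ⟩
        F ω N 0 0 (suc k) (replicate (suc l) false) (map notch ss) κ
          ≡⟨ F-genus0 N (suc k) (suc l) ss κ ⟩
        shift (suc k) (L.live₀ (suc l) ss N) κ
          ≡⟨ shift-Y k (L.live₀ (suc l) ss) N κ ⟨
        shift k (fixed N) κ ∎

      cuts : List Bool × Bool × List Bool → ℤ
      cuts (p , a , q) = F ω N 0 (bump a 0) k (p ++ false ∷ []) ((true ∷ q) ∷ map notch ss) κ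
      cut : sumBy cuts (splits (replicate l false)) ≡ shift k (split N) κ
      cut = shift-dsum k N κ false cuts (λ i j → L.live₀ (suc i) (j ∷ ss)) (λ i j →
        trans (cong (λ u → F ω N 0 0 k u (map notch (j ∷ ss)) κ) (replicate-∷ʳ i false))
          (F-genus0 N k (suc i) (j ∷ ss) κ)) l

      joins : List Bool × List (List Bool) → ℤ
      joins (c , os′) = sumBy (λ (p , a , q) →
        F ω N 1 (bump a 0) k (replicate l false ++ true ∷ q ++ p ++ false ∷ []) os′ κ) (splits c)
      joins≡ : ∀ c → joins c ≡ shift k (merge (proj₁ c) N) κ
      joins≡ (c , os′) = shift-Σ k N κ _
        (λ (p , a , q) → L.live₁ (replicate l false ++ true ∷ q ++ p ++ false ∷ []) (bump a 0))
        (λ (p , a , q) → F-genus1 N (bump a 0) k (replicate l false ++ true ∷ q ++ p ++ false ∷ []) os′ κ) (splits c)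
      merged : sumBy joins (picks (map notch ss)) ≡ shift k (joined N) κ
      merged = begin
        sumBy joins (picks (map notch ss))
          ≡⟨ shift-Σ k N κ joins (λ c → merge (proj₁ c)) joins≡ (picks (map notch ss)) ⟩
        shift k (CP.Σ (λ c → merge (proj₁ c)) (picks (map notch ss)) N) κ
          ≡⟨ shift-cong k {CP.Σ (λ c → merge (proj₁ c)) (picks (map notch ss)) N} {joined N} (λ i →
               trans (CP.Σ-picks merge (map notch ss) N i) (CP.Σ-map merge notch ss N i)) κ ⟩
        shift k (joined N) κ ∎

    F-total : ∀ n κ → F ω n 0 0 1 (false ∷ []) [] (suc κ) ≡ L.total (suc n) (suc κ)
    F-total n κ = trans (F-genus0 n 1 1 [] (suc κ))
      (sym (trans (X⊗-suc (Y ⊗ L.live₀ 1 []) n (suc κ)) (Y⊗-suc (L.live₀ 1 []) n κ)))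

-- Permutations of an initial segment and insertion of a new largest letter

module Permutations where

  open import Function using (_∘_)
  open import Function.Bundles using (module Equivalence)
  open import Data.Bool using (Bool; true; false; if_then_else_; _∧_; not)
  import Data.Bool.Properties as Bool
  open import Data.Nat as ℕ using (ℕ; zero; suc; _+_; _∸_; _≤_; _<_; s≤s; _≤ᵇ_; _<ᵇ_; _≟_; _<?_)
  open import Data.Nat.Properties
  open import Data.Nat.Induction using (<-rec)
  open import Data.Fin as Fin using (Fin; toℕ; fromℕ<)
  import Data.Fin.Properties as Fin
  open import Data.Product using (_×_; _,_; proj₁; proj₂; ∃)
  open import Data.Sum using (_⊎_; inj₁; inj₂)
  open import Data.List using (List; []; _∷_; _++_; _∷ʳ_; map; upTo; filterᵇ; length)
  open import Data.List.Properties using (upTo-∷ʳ)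
  open import Data.List.Membership.Propositional using (_∈_)
  open import Data.List.Membership.Propositional.Properties using (∈-upTo⁺; ∈-upTo⁻)
  open import Data.List.Relation.Unary.Any using (here; there)
  open import Data.List.Relation.Binary.Permutation.Propositional using (_↭_; refl; prep; swap; trans)
  open import Data.Empty using (⊥-elim)
  open import Relation.Nullary using (¬_; yes; no)
  open import Relation.Binary.Definitions using (tri<; tri≈; tri>)
  open import Relation.Binary.PropositionalEquality as ≡ using (_≡_; _≢_; refl; sym; cong; cong₂; subst)

  transpose : ℕ → ℕ → ℕ → ℕ
  transpose a b x with x ≟ a
  ... | yes _ = b
  ... | no  _ with x ≟ b
  ...   | yes _ = a
  ...   | no  _ = x

  transpose-l : ∀ a b → transpose a b a ≡ b
  transpose-l a b with a ≟ a
  ... | yes _ = refl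
  ... | no a≢a = ⊥-elim (a≢a refl)

  transpose-r : ∀ a b → transpose a b b ≡ a
  transpose-r a b with b ≟ a
  ... | yes b≡a = b≡a
  ... | no _ with b ≟ b
  ...   | yes _ = refl
  ...   | no b≢b = ⊥-elim (b≢b refl)

  transpose-other : ∀ a b {x} → x ≢ a → x ≢ b → transpose a b x ≡ x
  transpose-other a b {x} x≢a x≢b with x ≟ a
  ... | yes x≡a = ⊥-elim (x≢a x≡a)
  ... | no _ with x ≟ b
  ...   | yes x≡b = ⊥-elim (x≢b x≡b)
  ...   | no _ = refl

  transpose-involutive : ∀ a b x → transpose a b (transpose a b x) ≡ x
  transpose-involutive a b x with x ≟ a
  ... | yes refl = transpose-r a b
  ... | no x≢a with x ≟ b
  ...   | yes refl = transpose-l a b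
  ...   | no x≢b = transpose-other a b x≢a x≢b

  transpose-injective : ∀ a b {x y} → transpose a b x ≡ transpose a b y → x ≡ y
  transpose-injective a b {x} {y} p =
    ≡.trans (sym (transpose-involutive a b x)) (≡.trans (cong (transpose a b) p) (transpose-involutive a b y))

  -- Functions on all naturals make a permutation of `n` letters also one of `suc n` letters, so
  -- insertion is composition with a transposition. Boundedness follows: a value at or beyond `n` is
  -- fixed, hence by injectivity equal to its argument.
  record IsPerm (n : ℕ) (f : ℕ → ℕ) : Set where
    constructor isPerm
    field
      injective : ∀ {x y} → f x ≡ f y → x ≡ y
      fixes     : ∀ {x} → n ≤ x → f x ≡ x

    bounded : ∀ {x} → x < n → f x < n
    bounded {x} x<n with f x <? n
    ... | yes p = p
    ... | no ¬p = ⊥-elim (¬p (subst (_< n) (sym (injective (fixes (≮⇒≥ ¬p)))) x<n))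

  open IsPerm

  transpose-perm : ∀ {n} a b → a < n → b < n → IsPerm n (transpose a b)
  transpose-perm a b a<n b<n = isPerm (transpose-injective a b)
    (λ n≤x → transpose-other a b (λ { refl → <⇒≱ a<n n≤x }) (λ { refl → <⇒≱ b<n n≤x }))

  ∘-perm : ∀ {n f g} → IsPerm n f → IsPerm n g → IsPerm n (f ∘ g)
  ∘-perm {f = f} p q = isPerm (injective q ∘ injective p) (λ n≤x → ≡.trans (cong f (fixes q n≤x)) (fixes p n≤x))

  perm-suc : ∀ {n f} → IsPerm n f → IsPerm (suc n) f
  perm-suc p = isPerm (injective p) (λ n<x → fixes p (<⇒≤ n<x))

  -- For a permutation `α` of `n` letters the result sends `a` to `n` and `n` to `α a`; for `a = n`
  -- the transposition is trivial and `n` is a fixed point.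
  insert : ℕ → (ℕ → ℕ) → ℕ → ℕ → ℕ
  insert n α a x = α (transpose a n x)

  insert-perm : ∀ {n α a} → IsPerm n α → a ≤ n → IsPerm (suc n) (insert n α a)
  insert-perm {n} {a = a} p a≤n = ∘-perm (perm-suc p) (transpose-perm a n (s≤s a≤n) ≤-refl)

  iterate : (ℕ → ℕ) → ℕ → ℕ → ℕ
  iterate f zero    x = x
  iterate f (suc t) x = f (iterate f t x)

  iterate-+ : ∀ f s t x → iterate f (s + t) x ≡ iterate f s (iterate f t x)
  iterate-+ f zero    t x = refl
  iterate-+ f (suc s) t x = cong f (iterate-+ f s t x)

  iterate-sucʳ : ∀ f t x → iterate f (suc t) x ≡ iterate f t (f x)
  iterate-sucʳ f zero    x = refl
  iterate-sucʳ f (suc t) x = cong f (iterate-sucʳ f t x)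

  module _ {n : ℕ} {f : ℕ → ℕ} (p : IsPerm n f) where

    iterate-injective : ∀ t {x y} → iterate f t x ≡ iterate f t y → x ≡ y
    iterate-injective zero    q = q
    iterate-injective (suc t) q = iterate-injective t (injective p q)

    iterate-bounded : ∀ t {x} → x < n → iterate f t x < n
    iterate-bounded zero    x<n = x<n
    iterate-bounded (suc t) x<n = bounded p (iterate-bounded t x<n)

    -- Two of the first `suc n` iterates coincide; cancelling the earlier one leaves a return after
    -- `suc e` steps.
    period : ∀ {x} → x < n → ∃ λ e → e < n × iterate f (suc e) x ≡ x
    period {x} x<n with Fin.pigeonhole (n<1+n n) (λ (t : Fin (suc n)) → fromℕ< (iterate-bounded (toℕ t) x<n))
    ... | i , j , i<j , eq = e , e<n , sym (iterate-injective (toℕ i) itn)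
      where
      e = toℕ j ∸ suc (toℕ i)
      open ≡.≡-Reasoning
      i+1+e≡j : toℕ i + suc e ≡ toℕ j
      i+1+e≡j = ≡.trans (+-suc (toℕ i) e) (m+[n∸m]≡n i<j)
      e<n : e < n
      e<n = ≤-trans (m≤n+m (suc e) (toℕ i)) (subst (_≤ n) (sym i+1+e≡j) (ℕ.s≤s⁻¹ (Fin.toℕ<n j)))
      itn : iterate f (toℕ i) x ≡ iterate f (toℕ i) (iterate f (suc e) x)
      itn = begin
        iterate f (toℕ i) x                       ≡⟨ Fin.fromℕ<-injective _ _ _ _ eq ⟩
        iterate f (toℕ j) x                       ≡⟨ cong (λ t → iterate f t x) i+1+e≡j ⟨
        iterate f (toℕ i + suc e) x               ≡⟨ iterate-+ f (toℕ i) (suc e) x ⟩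
        iterate f (toℕ i) (iterate f (suc e) x) ∎

  Minimal : (ℕ → ℕ) → ℕ → Set
  Minimal f x = ∀ t → x ≤ iterate f t x

  minimalᵇ : ℕ → (ℕ → ℕ) → ℕ → Bool
  minimalᵇ n f x = allB (λ t → x ≤ᵇ iterate f (suc t) x) (upTo n)

  allB⁻ : ∀ {A : Set} (p : A → Bool) {xs} → allB p xs ≡ true → ∀ {x} → x ∈ xs → p x ≡ true
  allB⁻ p {x ∷ xs} q x∈ with p x in eq | x∈
  ... | true | here refl = eq
  ... | true | there x∈xs = allB⁻ p q x∈xs

  allB⁺ : ∀ {A : Set} (p : A → Bool) {xs} → (∀ {x} → x ∈ xs → p x ≡ true) → allB p xs ≡ true
  allB⁺ p {[]}     q = refl
  allB⁺ p {x ∷ xs} q rewrite q (here refl) = allB⁺ p (q ∘ there)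

  allB-cong : ∀ {A : Set} {p q : A → Bool} → (∀ x → p x ≡ q x) → ∀ xs → allB p xs ≡ allB q xs
  allB-cong e []       = refl
  allB-cong e (x ∷ xs) = cong₂ _∧_ (e x) (allB-cong e xs)

  ≤ᵇ-true : ∀ {m n} → m ≤ n → (m ≤ᵇ n) ≡ true
  ≤ᵇ-true m≤n = Equivalence.to Bool.T-≡ (≤⇒≤ᵇ m≤n)

  ≤ᵇ-true⁻ : ∀ {m n} → (m ≤ᵇ n) ≡ true → m ≤ n
  ≤ᵇ-true⁻ {m} {n} p = ≤ᵇ⇒≤ m n (Equivalence.from Bool.T-≡ p)

  <ᵇ-true : ∀ {m n} → m < n → (m <ᵇ n) ≡ true
  <ᵇ-true m<n = ≤ᵇ-true m<n

  <ᵇ-false : ∀ {m n} → ¬ m < n → (m <ᵇ n) ≡ false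
  <ᵇ-false {m} {n} m≮n with m <ᵇ n in eq
  ... | false = refl
  ... | true  = ⊥-elim (m≮n (≤ᵇ-true⁻ {suc m} eq))

  ≡-by-true : ∀ {a b} → (a ≡ true → b ≡ true) → (b ≡ true → a ≡ true) → a ≡ b
  ≡-by-true {true}  {b}     f g = sym (f refl)
  ≡-by-true {false} {true}  f g = g refl
  ≡-by-true {false} {false} f g = refl

  ≢true⇒false : ∀ {a} → a ≢ true → a ≡ false
  ≢true⇒false {true}  p = ⊥-elim (p refl)
  ≢true⇒false {false} p = refl

  minimalᵇ⁺ : ∀ n {f x} → Minimal f x → minimalᵇ n f x ≡ true
  minimalᵇ⁺ n p = allB⁺ _ {upTo n} (λ {t} _ → ≤ᵇ-true (p (suc t)))

  minimalᵇ⁻ : ∀ {n f x} → IsPerm n f → x < n → minimalᵇ n f x ≡ true → Minimal f x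
  minimalᵇ⁻ {n} {f} {x} p x<n q = <-rec _ go
    where
    e = proj₁ (period p x<n)
    e<n = proj₁ (proj₂ (period p x<n))
    go : ∀ t → (∀ {s} → s < t → x ≤ iterate f s x) → x ≤ iterate f t x
    go zero    rec = ≤-refl
    go (suc t) rec with t <? n
    ... | yes t<n = ≤ᵇ-true⁻ (allB⁻ _ {upTo n} q (∈-upTo⁺ t<n))
    -- Beyond the tested range one full return of `suc e` steps is removed, which leaves `t ∸ e`.
    ... | no  t≮n = subst (x ≤_) wrap (rec {t ∸ e} (s≤s (m∸n≤m t e)))
      where
      open ≡.≡-Reasoning
      wrap : iterate f (t ∸ e) x ≡ iterate f (suc t) x
      wrap = begin
        iterate f (t ∸ e) x                     ≡⟨ cong (iterate f (t ∸ e)) (proj₂ (proj₂ (period p x<n))) ⟨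
        iterate f (t ∸ e) (iterate f (suc e) x) ≡⟨ iterate-+ f (t ∸ e) (suc e) x ⟨
        iterate f (t ∸ e + suc e) x             ≡⟨ cong (λ s → iterate f s x) (≡.trans (+-suc (t ∸ e) e)
                                                     (cong suc (m∸n+n≡m (≤-trans (<⇒≤ e<n) (≮⇒≥ t≮n))))) ⟩
        iterate f (suc t) x ∎

  module _ {n : ℕ} {α : ℕ → ℕ} {a : ℕ} (p : IsPerm n α) (a≤n : a ≤ n) {x : ℕ} (x<n : x < n) where
    private
      α′ = insert n α a

      -- The new orbit is the old one with a visit to `n` after each visit to `a`. Since `x` lies
      -- below `n`, its minimality is unaffected.
      orbit : ∀ t → (∃ λ s → iterate α′ t x ≡ iterate α s x) ⊎
                    (iterate α′ t x ≡ n × ∃ λ s → iterate α s x ≡ a)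
      orbit zero    = inj₁ (0 , refl)
      orbit (suc t) with orbit t
      ... | inj₂ (eq , s , eq′) = inj₁ (suc s , ≡.trans (cong α′ eq)
              (≡.trans (cong α (transpose-r a n)) (cong α (sym eq′))))
      ... | inj₁ (s , eq) with iterate α s x ≟ a
      ...   | yes eqa = inj₂ (≡.trans (cong α′ (≡.trans eq eqa)) (≡.trans (cong α (transpose-l a n)) (fixes p ≤-refl)) , s , eqa)
      ...   | no  neq = inj₁ (suc s , ≡.trans (cong α′ eq) (cong α (transpose-other a n neq
              (<⇒≢ (iterate-bounded p s x<n)))))

      orbit⁻ : ∀ s → ∃ λ t → iterate α s x ≡ iterate α′ t x
      orbit⁻ zero    = 0 , refl
      orbit⁻ (suc s) with orbit⁻ s
      ... | t , eq with iterate α s x ≟ a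
      ...   | yes eqa = suc (suc t) , (begin
                α (iterate α s x)                  ≡⟨ cong α eqa ⟩
                α a                                ≡⟨ cong α (transpose-r a n) ⟨
                α′ n                               ≡⟨ cong α′ (fixes p ≤-refl) ⟨
                α′ (α n)                           ≡⟨ cong (α′ ∘ α) (transpose-l a n) ⟨
                α′ (α′ a)                          ≡⟨ cong (α′ ∘ α′) (≡.trans (sym eqa) eq) ⟩
                α′ (α′ (iterate α′ t x)) ∎)
        where open ≡.≡-Reasoning
      ...   | no  neq = suc t , ≡.trans (cong α (sym (transpose-other a n neq (<⇒≢ (iterate-bounded p s x<n)))))
                                  (cong α′ eq)

    insert-minimal⁺ : Minimal α x → Minimal α′ x
    insert-minimal⁺ min t with orbit t
    ... | inj₁ (s , eq) = subst (x ≤_) (sym eq) (min s)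
    ... | inj₂ (eq , _) = subst (x ≤_) (sym eq) (<⇒≤ x<n)

    insert-minimal⁻ : Minimal α′ x → Minimal α x
    insert-minimal⁻ min s = subst (x ≤_) (sym (proj₂ (orbit⁻ s))) (min (proj₁ (orbit⁻ s)))

    insert-minimalᵇ : minimalᵇ (suc n) α′ x ≡ minimalᵇ n α x
    insert-minimalᵇ = ≡-by-true
      (λ q → minimalᵇ⁺ n (insert-minimal⁻ (minimalᵇ⁻ (insert-perm p a≤n) (m<n⇒m<1+n x<n) q)))
      (λ q → minimalᵇ⁺ (suc n) (insert-minimal⁺ (minimalᵇ⁻ p x<n q)))

  count : {A : Set} → (A → Bool) → List A → ℕ
  count p []       = 0
  count p (x ∷ xs) = (if p x then 1 else 0) + count p xs

  length-filterᵇ : ∀ {A : Set} (p : A → Bool) xs → length (filterᵇ p xs) ≡ count p xs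
  length-filterᵇ p []       = refl
  length-filterᵇ p (x ∷ xs) with p x
  ... | true  = cong suc (length-filterᵇ p xs)
  ... | false = length-filterᵇ p xs

  count-++ : ∀ {A : Set} (p : A → Bool) xs ys → count p (xs ++ ys) ≡ count p xs + count p ys
  count-++ p []       ys = refl
  count-++ p (x ∷ xs) ys = ≡.trans (cong (_ +_) (count-++ p xs ys)) (sym (+-assoc (if p x then 1 else 0) _ _))

  count-cong : ∀ {A : Set} {p q : A → Bool} xs → (∀ {x} → x ∈ xs → p x ≡ q x) → count p xs ≡ count q xs
  count-cong []       e = refl
  count-cong (x ∷ xs) e = cong₂ (λ b c → (if b then 1 else 0) + c) (e (here refl)) (count-cong xs (e ∘ there))

  count-map : ∀ {A B : Set} (p : B → Bool) (f : A → B) xs → count p (map f xs) ≡ count (p ∘ f) xs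
  count-map p f []       = refl
  count-map p f (x ∷ xs) = cong (_ +_) (count-map p f xs)

  count-↭ : ∀ {A : Set} (p : A → Bool) {xs ys} → xs ↭ ys → count p xs ≡ count p ys
  count-↭ p refl          = refl
  count-↭ p (prep x e)    = cong (_ +_) (count-↭ p e)
  count-↭ p (swap {xs = xs} {ys} x y e) = begin
    px + (py + count p xs) ≡⟨ cong (λ c → px + (py + c)) (count-↭ p e) ⟩
    px + (py + count p ys) ≡⟨ +-assoc px py _ ⟨
    px + py + count p ys   ≡⟨ cong (_+ count p ys) (+-comm px py) ⟩
    py + px + count p ys   ≡⟨ +-assoc py px _ ⟩
    py + (px + count p ys) ∎
    where
    open ≡.≡-Reasoning
    px = if p x then 1 else 0
    py = if p y then 1 else 0
  count-↭ p (trans e f)   = ≡.trans (count-↭ p e) (count-↭ p f)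

  countTo : (ℕ → Bool) → ℕ → ℕ
  countTo p n = count p (upTo n)

  countTo-suc : ∀ p n → countTo p (suc n) ≡ countTo p n + (if p n then 1 else 0)
  countTo-suc p n = begin
    count p (upTo (suc n))                     ≡⟨ cong (count p) (upTo-∷ʳ n) ⟨
    count p (upTo n ∷ʳ n)                      ≡⟨ count-++ p (upTo n) (n ∷ []) ⟩
    countTo p n + ((if p n then 1 else 0) + 0) ≡⟨ cong (countTo p n +_) (+-identityʳ _) ⟩
    countTo p n + (if p n then 1 else 0) ∎
    where open ≡.≡-Reasoning

  countTo-cong : ∀ {p q} n → (∀ {x} → x < n → p x ≡ q x) → countTo p n ≡ countTo q n
  countTo-cong n e = count-cong (upTo n) (e ∘ ∈-upTo⁻)

  -- Predicates that differ at most at `a`; written additively to avoid subtraction.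
  countTo-update : ∀ {p q a} n → a < n → (∀ {x} → x < n → x ≢ a → p x ≡ q x) →
    countTo p n + (if q a then 1 else 0) ≡ countTo q n + (if p a then 1 else 0)
  countTo-update {p} {q} {a} (suc n) a<1+n e with a ≟ n
  ... | yes refl = begin
    countTo p (suc n) + qa ≡⟨ cong (_+ qa) (countTo-suc p n) ⟩
    countTo p n + pa + qa   ≡⟨ cong (λ c → c + pa + qa) (countTo-cong n (λ x<n → e (m<n⇒m<1+n x<n) (<⇒≢ x<n))) ⟩
    countTo q n + pa + qa   ≡⟨ +-assoc (countTo q n) pa qa ⟩
    countTo q n + (pa + qa) ≡⟨ cong (countTo q n +_) (+-comm pa qa) ⟩
    countTo q n + (qa + pa) ≡⟨ +-assoc (countTo q n) qa pa ⟨
    countTo q n + qa + pa   ≡⟨ cong (_+ pa) (countTo-suc q n) ⟨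
    countTo q (suc n) + pa ∎
    where
    open ≡.≡-Reasoning
    pa = if p a then 1 else 0
    qa = if q a then 1 else 0
  ... | no a≢n = begin
    countTo p (suc n) + qa ≡⟨ cong (_+ qa) (≡.trans (countTo-suc p n) (+-comm (countTo p n) _)) ⟩
    pn + countTo p n + qa  ≡⟨ +-assoc pn _ qa ⟩
    pn + (countTo p n + qa) ≡⟨ cong₂ (λ b c → (if b then 1 else 0) + c) (e ≤-refl (a≢n ∘ sym))
                                (countTo-update n (≤∧≢⇒< (ℕ.s≤s⁻¹ a<1+n) a≢n) (λ x<n → e (m<n⇒m<1+n x<n))) ⟩
    qn + (countTo q n + pa) ≡⟨ +-assoc qn _ pa ⟨
    qn + countTo q n + pa  ≡⟨ cong (_+ pa) (≡.trans (countTo-suc q n) (+-comm (countTo q n) _)) ⟨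
    countTo q (suc n) + pa ∎
    where
    open ≡.≡-Reasoning
    pa = if p a then 1 else 0
    qa = if q a then 1 else 0
    pn = if p n then 1 else 0
    qn = if q n then 1 else 0

  cycles : ℕ → (ℕ → ℕ) → ℕ
  cycles n f = countTo (minimalᵇ n f) n

  backᵇ : ℕ → (ℕ → ℕ) → ℕ → Bool
  backᵇ n f x = (f x <ᵇ x) ∧ not (minimalᵇ n f (f x))

  backs : ℕ → (ℕ → ℕ) → ℕ
  backs n f = countTo (backᵇ n f) n

  exc : (ℕ → ℕ) → ℕ → Bool
  exc f x = x <ᵇ f x

  insert-at : ∀ n α a → IsPerm n α → insert n α a a ≡ n
  insert-at n α a p = ≡.trans (cong α (transpose-l a n)) (fixes p ≤-refl)

  insert-new : ∀ n α a → insert n α a n ≡ α a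
  insert-new n α a = cong α (transpose-r a n)

  insert-other : ∀ n α a {x} → x ≢ a → x ≢ n → insert n α a x ≡ α x
  insert-other n α a x≢a x≢n = cong α (transpose-other a n x≢a x≢n)

  not-minimal : ∀ {n f x} → IsPerm n f → x < n → (∃ λ t → iterate f t x < x) → minimalᵇ n f x ≡ false
  not-minimal p x<n (t , lt) = ≢true⇒false (λ q → <⇒≱ lt (minimalᵇ⁻ p x<n q t))

  fixed-minimal : ∀ {f x} → f x ≡ x → Minimal f x
  fixed-minimal {f} {x} eq t = ≤-reflexive (sym (stays t))
    where
    stays : ∀ t → iterate f t x ≡ x
    stays zero    = refl
    stays (suc t) = ≡.trans (cong f (stays t)) eq

  module _ {n : ℕ} {α : ℕ → ℕ} (p : IsPerm n α) where

    cycles-fixed : cycles (suc n) (insert n α n) ≡ suc (cycles n α)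
    cycles-fixed = begin
      cycles (suc n) α′
        ≡⟨ countTo-suc _ n ⟩
      countTo (minimalᵇ (suc n) α′) n + (if minimalᵇ (suc n) α′ n then 1 else 0)
        ≡⟨ cong₂ _+_ (countTo-cong n (insert-minimalᵇ p ≤-refl))
             (cong (λ b → if b then 1 else 0) (minimalᵇ⁺ (suc n) {α′} (fixed-minimal {α′} (insert-at n α n p)))) ⟩
      cycles n α + 1
        ≡⟨ +-comm _ 1 ⟩
      suc (cycles n α) ∎
      where
      open ≡.≡-Reasoning
      α′ = insert n α n

    cycles-insert : ∀ {a} → a < n → cycles (suc n) (insert n α a) ≡ cycles n α
    cycles-insert {a} a<n = begin
      cycles (suc n) α′
        ≡⟨ countTo-suc _ n ⟩
      countTo (minimalᵇ (suc n) α′) n + (if minimalᵇ (suc n) α′ n then 1 else 0)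
        ≡⟨ cong₂ _+_ (countTo-cong n (insert-minimalᵇ p (<⇒≤ a<n)))
             (cong (λ b → if b then 1 else 0) (not-minimal (insert-perm p (<⇒≤ a<n)) ≤-refl
               (1 , subst (_< n) (sym (insert-new n α a)) (bounded p a<n)))) ⟩
      cycles n α + 0
        ≡⟨ +-identityʳ _ ⟩
      cycles n α ∎
      where
      open ≡.≡-Reasoning
      α′ = insert n α a

    exc-top : ∀ {a} → a ≤ n → exc (insert n α a) n ≡ false
    exc-top {a} a≤n = <ᵇ-false {n} (≤⇒≯ (subst (_≤ n) (sym (insert-new n α a)) (ℕ.s≤s⁻¹ (bounded (perm-suc p) (s≤s a≤n)))))

    exc-at : ∀ {a} → a < n → exc (insert n α a) a ≡ true
    exc-at {a} a<n = <ᵇ-true (subst (a <_) (sym (insert-at n α a p)) a<n)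

    exc-other : ∀ a {x} → x ≢ a → x < n → exc (insert n α a) x ≡ exc α x
    exc-other a {x} x≢a x<n = cong (x <ᵇ_) (insert-other n α a x≢a (<⇒≢ x<n))

    backs-fixed : backs (suc n) (insert n α n) ≡ backs n α
    backs-fixed = begin
      backs (suc n) α′
        ≡⟨ countTo-suc _ n ⟩
      countTo (backᵇ (suc n) α′) n + (if backᵇ (suc n) α′ n then 1 else 0)
        ≡⟨ cong₂ _+_ (countTo-cong n same) (cong (λ b → if b ∧ not (minimalᵇ (suc n) α′ (α′ n)) then 1 else 0) top) ⟩
      backs n α + 0
        ≡⟨ +-identityʳ _ ⟩
      backs n α ∎
      where
      open ≡.≡-Reasoning
      α′ = insert n α n
      same : ∀ {x} → x < n → backᵇ (suc n) α′ x ≡ backᵇ n α x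
      same {x} x<n = begin
        (α′ x <ᵇ x) ∧ not (minimalᵇ (suc n) α′ (α′ x)) ≡⟨ cong (λ y → (y <ᵇ x) ∧ not (minimalᵇ (suc n) α′ y))
                                                            (insert-other n α n (<⇒≢ x<n) (<⇒≢ x<n)) ⟩
        (α x <ᵇ x) ∧ not (minimalᵇ (suc n) α′ (α x))   ≡⟨ cong (λ b → (α x <ᵇ x) ∧ not b) (insert-minimalᵇ p ≤-refl (bounded p x<n)) ⟩
        backᵇ n α x ∎
      top : (α′ n <ᵇ n) ≡ false
      top = <ᵇ-false {α′ n} {n} (<-irrefl (insert-at n α n p))

    private
      -- The cases of `backs-insert`: here and in the next two lemmas `l`, `g`, `m` stand for α a <
      -- a, a < α a and the minimality of α a.
      descent : ∀ {l g} → l ≡ true → g ≡ false → ∀ m →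
        (if not m then 1 else 0) ≡ (if l ∧ not m then 1 else 0) + (if g then 1 else 0)
      descent refl refl m = sym (+-identityʳ _)

      fixed : ∀ {l g m} → l ≡ false → g ≡ false → m ≡ true →
        (if not m then 1 else 0) ≡ (if l ∧ not m then 1 else 0) + (if g then 1 else 0)
      fixed refl refl refl = refl

      ascent : ∀ {l g m} → l ≡ false → g ≡ true → m ≡ false →
        (if not m then 1 else 0) ≡ (if l ∧ not m then 1 else 0) + (if g then 1 else 0)
      ascent refl refl refl = refl

    -- Inserting n after a turns α a into the image of the non-excedance n, so a back point appears
    -- exactly when a used to be an excedance.
    backs-insert : ∀ {a} → a < n → backs (suc n) (insert n α a) ≡ (if exc α a then 1 else 0) + backs n α
    backs-insert {a} a<n = begin
      backs (suc n) α′
        ≡⟨ countTo-suc _ n ⟩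
      countTo (backᵇ (suc n) α′) n + (if backᵇ (suc n) α′ n then 1 else 0)
        ≡⟨ cong (λ b → countTo (backᵇ (suc n) α′) n + (if b then 1 else 0)) top ⟩
      countTo (backᵇ (suc n) α′) n + (if not (minimalᵇ n α (α a)) then 1 else 0)
        ≡⟨ cong (countTo (backᵇ (suc n) α′) n +_) moved ⟩
      countTo (backᵇ (suc n) α′) n + ((if backᵇ n α a then 1 else 0) + (if exc α a then 1 else 0))
        ≡⟨ +-assoc (countTo (backᵇ (suc n) α′) n) _ _ ⟨
      countTo (backᵇ (suc n) α′) n + (if backᵇ n α a then 1 else 0) + (if exc α a then 1 else 0)
        ≡⟨ cong (_+ (if exc α a then 1 else 0)) (countTo-update {backᵇ (suc n) α′} {backᵇ n α} n a<n same) ⟩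
      backs n α + (if backᵇ (suc n) α′ a then 1 else 0) + (if exc α a then 1 else 0)
        ≡⟨ cong (λ b → backs n α + (if b ∧ not (minimalᵇ (suc n) α′ (α′ a)) then 1 else 0) + (if exc α a then 1 else 0)) notBack ⟩
      backs n α + 0 + (if exc α a then 1 else 0)
        ≡⟨ ≡.trans (cong (_+ (if exc α a then 1 else 0)) (+-identityʳ _)) (+-comm (backs n α) _) ⟩
      (if exc α a then 1 else 0) + backs n α ∎
      where
      open ≡.≡-Reasoning
      α′ = insert n α a
      same : ∀ {x} → x < n → x ≢ a → backᵇ (suc n) α′ x ≡ backᵇ n α x
      same {x} x<n x≢a = begin
        (α′ x <ᵇ x) ∧ not (minimalᵇ (suc n) α′ (α′ x)) ≡⟨ cong (λ y → (y <ᵇ x) ∧ not (minimalᵇ (suc n) α′ y))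
                                                            (insert-other n α a x≢a (<⇒≢ x<n)) ⟩
        (α x <ᵇ x) ∧ not (minimalᵇ (suc n) α′ (α x))   ≡⟨ cong (λ b → (α x <ᵇ x) ∧ not b)
                                                            (insert-minimalᵇ p (<⇒≤ a<n) (bounded p x<n)) ⟩
        backᵇ n α x ∎
      notBack : (α′ a <ᵇ a) ≡ false
      notBack = <ᵇ-false {α′ a} (λ lt → <-asym a<n (subst (_< a) (insert-at n α a p) lt))
      top : backᵇ (suc n) α′ n ≡ not (minimalᵇ n α (α a))
      top = begin
        (α′ n <ᵇ n) ∧ not (minimalᵇ (suc n) α′ (α′ n)) ≡⟨ cong (λ y → (y <ᵇ n) ∧ not (minimalᵇ (suc n) α′ y)) (insert-new n α a) ⟩
        (α a <ᵇ n) ∧ not (minimalᵇ (suc n) α′ (α a))   ≡⟨ cong₂ (λ b c → b ∧ not c) (<ᵇ-true (bounded p a<n))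
                                                            (insert-minimalᵇ p (<⇒≤ a<n) (bounded p a<n)) ⟩
        not (minimalᵇ n α (α a)) ∎
      -- `a` lies on the cycle of `α a`, so the image of an excedance is never the minimum of its
      -- cycle.
      returns : a < α a → ∃ λ t → iterate α t (α a) < α a
      returns gt with period p a<n
      ... | e , _ , eq = e , subst (_< α a) (≡.trans (sym eq) (iterate-sucʳ α e a)) gt
      moved : (if not (minimalᵇ n α (α a)) then 1 else 0) ≡ (if backᵇ n α a then 1 else 0) + (if exc α a then 1 else 0)
      moved with <-cmp (α a) a
      ... | tri< lt _ ngt = descent (<ᵇ-true lt) (<ᵇ-false {a} {α a} ngt) _
      ... | tri≈ nlt eq ngt = fixed (<ᵇ-false {α a} {a} nlt) (<ᵇ-false {a} {α a} ngt)
                                (minimalᵇ⁺ n {α} (fixed-minimal {α} (cong α eq)))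
      ... | tri> nlt _ gt = ascent (<ᵇ-false {α a} {a} nlt) (<ᵇ-true gt) (not-minimal p (bounded p a<n) (returns gt))

-- The effect of an insertion on the cycles of α⁻¹ζ

module CycleStates where

  open ClosedForms using (splits; picks; bump)
  open GeneratingTree using (sumBy; sumBy-map; F)
  open Permutations
  open import Relation.Binary.PropositionalEquality as ≡ using (_≡_; _≢_; refl; sym; cong; cong₂; subst)
  open import Function using (_∘_; id)
  open import Data.Bool using (Bool; true; false; if_then_else_; _∧_)
  open import Data.Nat as ℕ using (ℕ; zero; suc; _+_; _*_; _≤_; _<_; s≤s; _≡ᵇ_)
  open import Data.Nat.Properties
  open import Data.Integer as ℤ using (ℤ; +_)
  import Data.Integer.Properties as ℤ
  open import Data.Product using (_×_; _,_; proj₁; proj₂; ∃)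
  open import Data.List using (List; []; _∷_; _++_; _∷ʳ_; map; upTo; length; concat)
  open import Data.List.Properties using (upTo-∷ʳ; ++-assoc; map-++; map-cong-local)
  open import Data.List.Membership.Propositional.Properties using (∈-upTo⁻)
  open import Data.List.Relation.Unary.All as All using (All; []; _∷_)
  import Data.List.Relation.Unary.All.Properties as All
  open import Data.List.Relation.Unary.AllPairs using ([]; _∷_)
  open import Data.List.Relation.Unary.Unique.Propositional using (Unique)
  open import Data.List.Relation.Unary.Unique.Propositional.Properties using (upTo⁺)
  open import Data.List.Relation.Binary.Permutation.Propositional
    using (_↭_; ↭⇒↭ₛ; refl; prep; swap; trans; ↭-refl; ↭-sym; ↭-trans; ↭-reflexive; module PermutationReasoning)
  open import Data.List.Relation.Binary.Permutation.Propositional.Properties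
    using (↭-length; ++-commutativeMonoid; ++⁺ˡ; ++⁺ʳ; ++-comm; All-resp-↭; shift)
  import Data.List.Relation.Binary.Permutation.Setoid.Properties (≡.setoid ℕ) as Permutation
  open import Data.Empty using (⊥; ⊥-elim)
  open import Data.Unit using (⊤; tt)

  Path : (ℕ → ℕ) → ℕ → List ℕ → Set
  Path f x []       = ⊤
  Path f x (y ∷ ys) = f x ≡ y × Path f y ys

  end : ℕ → List ℕ → ℕ
  end x []       = x
  end x (y ∷ ys) = end y ys

  Cycle : (ℕ → ℕ) → List ℕ → Set
  Cycle f []       = ⊥
  Cycle f (x ∷ xs) = f (end x xs) ≡ x × Path f x xs

  end-++ : ∀ x xs ys → end x (xs ++ ys) ≡ end (end x xs) ys
  end-++ x []       ys = refl
  end-++ x (y ∷ xs) ys = end-++ y xs ys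

  Path-++⁺ : ∀ {f x} xs {ys} → Path f x xs → Path f (end x xs) ys → Path f x (xs ++ ys)
  Path-++⁺ []       p        q = q
  Path-++⁺ (y ∷ xs) (e , p) q = e , Path-++⁺ xs p q

  Path-++⁻ : ∀ {f x} xs {ys} → Path f x (xs ++ ys) → Path f x xs × Path f (end x xs) ys
  Path-++⁻ []       p       = tt , p
  Path-++⁻ (y ∷ xs) (e , p) with Path-++⁻ xs p
  ... | p₁ , p₂ = (e , p₁) , p₂

  module ++-Solver where
    open import Algebra.Solver.CommutativeMonoid (++-commutativeMonoid {A = ℕ}) public
      using (solve; _⊜_) renaming (_⊕_ to _⊙_)

  -- Here f = α⁻¹ζ, and inserting n after a into α replaces f by f′ = (a n) f (m n).
  open IsPerm

  module Step {m : ℕ} {f : ℕ → ℕ} (p : IsPerm (suc m) f) (a : ℕ) (a≤n : a ≤ suc m) where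

    n b : ℕ
    n = suc m
    b = f m

    f′ : ℕ → ℕ
    f′ x = transpose a n (f (transpose m n x))

    b≢n : b ≢ n
    b≢n = <⇒≢ (bounded p ≤-refl)

    -- Only `a`, `b` and `n` can get a new predecessor. For `a` different from `b` and `n`, the map
    -- `f′` sends `m` to `a`, the old predecessor of `a` to `n`, and `n` to `b`.
    Kept : ℕ → Set
    Kept y = y ≢ a × y ≢ b × y ≢ n

    f′-perm : IsPerm (suc n) f′
    f′-perm = ∘-perm (transpose-perm a n (s≤s a≤n) ≤-refl)
                     (∘-perm (perm-suc p) (transpose-perm m n (m<n⇒m<1+n ≤-refl) ≤-refl))

    private
      elsewhere : ∀ {y} → f y ≢ b → f y ≢ n → f (transpose m n y) ≡ f y
      elsewhere {y} ≢b ≢n = cong f (transpose-other m n (≢b ∘ cong f) (λ y≡n → ≢n (≡.trans (cong f y≡n) (fixes p ≤-refl))))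

    f′-kept : ∀ {y z} → f y ≡ z → Kept z → f′ y ≡ z
    f′-kept refl (≢a , ≢b , ≢n) = ≡.trans (cong (transpose a n) (elsewhere ≢b ≢n)) (transpose-other a n ≢a ≢n)

    f′-before : ∀ {y} → f y ≡ a → a ≢ b → a ≢ n → f′ y ≡ n
    f′-before refl ≢b ≢n = ≡.trans (cong (transpose a n) (elsewhere ≢b ≢n)) (transpose-l a n)

    f′-last : f′ m ≡ a
    f′-last = ≡.trans (cong (transpose a n ∘ f) (transpose-l m n))
      (≡.trans (cong (transpose a n) (fixes p ≤-refl)) (transpose-r a n))

    f′-new : f′ n ≡ transpose a n b
    f′-new = cong (transpose a n ∘ f) (transpose-r m n)

    f′-new-other : b ≢ a → f′ n ≡ b
    f′-new-other b≢a = ≡.trans f′-new (transpose-other a n b≢a b≢n)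

    Path-kept : ∀ {x} ys → All Kept ys → Path f x ys → Path f′ x ys
    Path-kept []       _          _       = tt
    Path-kept (y ∷ ys) (k ∷ ks) (e , q) = f′-kept e k , Path-kept ys ks q

    Cycle-kept : ∀ ys → All Kept ys → Cycle f ys → Cycle f′ ys
    Cycle-kept (y ∷ ys) (k ∷ ks) (e , q) = f′-kept e k , Path-kept ys ks q

    -- Here `a` is the head of w, that is `a = b`; nothing precedes the cut and `n` becomes a fixed
    -- point of `f′`.
    cut-first : ∀ q → end a q ≡ m → Cycle f (a ∷ q) → Cycle f′ (n ∷ [])
    cut-first q e (c , _) = ≡.trans f′-new (≡.trans (cong (transpose a n) (≡.trans (cong f (sym e)) c)) (transpose-l a n)) , tt

    cut-left : ∀ p′ q → end b (p′ ++ a ∷ q) ≡ m → Cycle f (b ∷ p′ ++ a ∷ q) → b ≢ a → a ≢ n → All Kept p′ →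
               Cycle f′ (b ∷ p′ ++ n ∷ [])
    cut-left p′ q e (_ , π) b≢a a≢n ks with Path-++⁻ p′ π
    ... | π₁ , (eq , _) = ≡.trans (cong f′ (end-++ b p′ (n ∷ []))) (f′-new-other b≢a) ,
          Path-++⁺ p′ (Path-kept p′ ks π₁) (f′-before eq (b≢a ∘ sym) a≢n , tt)

    cut-right : ∀ {x} p′ q → end a q ≡ m → Path f x (p′ ++ a ∷ q) → All Kept q → Cycle f′ (a ∷ q)
    cut-right p′ q e π ks = ≡.trans (cong f′ e) f′-last , Path-kept q ks (proj₂ (proj₂ (Path-++⁻ p′ π)))

    lengthen : ∀ w′ → end b w′ ≡ m → Cycle f (b ∷ w′) → b ≢ a → All Kept w′ → a ≡ n → Cycle f′ (b ∷ w′ ++ n ∷ [])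
    lengthen w′ e (_ , π) b≢a ks a≡n = ≡.trans (cong f′ (end-++ b w′ (n ∷ []))) (f′-new-other b≢a) ,
      Path-++⁺ w′ (Path-kept w′ ks π) (≡.trans (cong f′ e) (≡.trans f′-last a≡n) , tt)

    -- After `m` the path enters the other cycle at `a`, runs through `q` and `p′` to the old
    -- predecessor of `a`, and returns through `n` to `b`.
    join : ∀ w′ p′ q → end b w′ ≡ m → Cycle f (b ∷ w′) → Cycle f (p′ ++ a ∷ q) → b ≢ a → a ≢ n →
           All Kept w′ → All Kept p′ → All Kept q → Cycle f′ (b ∷ w′ ++ a ∷ q ++ p′ ++ n ∷ [])
    join w′ p′ q e (_ , π) c b≢a a≢n kw kp kq =
      ≡.trans (cong f′ last) (f′-new-other b≢a) ,
      Path-++⁺ w′ (Path-kept w′ kw π) (≡.trans (cong f′ e) f′-last ,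
        Path-++⁺ q (Path-kept q kq (πq p′ c)) (back p′ c kp))
      where
      last : end b (w′ ++ a ∷ q ++ p′ ++ n ∷ []) ≡ n
      last = ≡.trans (end-++ b w′ _) (≡.trans (end-++ a q _) (end-++ (end a q) p′ (n ∷ [])))
      πq : ∀ p′ → Cycle f (p′ ++ a ∷ q) → Path f a q
      πq []       (_ , π) = π
      πq (x ∷ p′) (_ , π) = proj₂ (proj₂ (Path-++⁻ p′ π))
      back : ∀ p′ → Cycle f (p′ ++ a ∷ q) → All Kept p′ → Path f′ (end a q) (p′ ++ n ∷ [])
      back []       (eq , _) _ = f′-before eq (b≢a ∘ sym) a≢n , tt
      back (x ∷ p′) (eq , π) (k ∷ ks) with Path-++⁻ p′ π
      ... | π₁ , (eq′ , _) = f′-kept (≡.trans (cong f (sym (end-++ x p′ (a ∷ q)))) eq) k ,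
            Path-++⁺ p′ (Path-kept p′ ks π₁) (f′-before eq′ (b≢a ∘ sym) a≢n , tt)

  sumBy-++ : ∀ {A : Set} (G : A → ℤ) xs ys → sumBy G (xs ++ ys) ≡ sumBy G xs ℤ.+ sumBy G ys
  sumBy-++ G []       ys = sym (ℤ.+-identityˡ _)
  sumBy-++ G (x ∷ xs) ys = ≡.trans (cong (λ r → G x ℤ.+ r) (sumBy-++ G xs ys)) (sym (ℤ.+-assoc (G x) _ _))

  sumBy-↭ : ∀ {A : Set} (G : A → ℤ) {xs ys} → xs ↭ ys → sumBy G xs ≡ sumBy G ys
  sumBy-↭ G refl          = refl
  sumBy-↭ G (prep x e)    = cong (λ r → G x ℤ.+ r) (sumBy-↭ G e)
  sumBy-↭ G (swap {xs = xs} {ys} x y e) = begin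
    G x ℤ.+ (G y ℤ.+ sumBy G xs) ≡⟨ cong (λ r → G x ℤ.+ (G y ℤ.+ r)) (sumBy-↭ G e) ⟩
    G x ℤ.+ (G y ℤ.+ sumBy G ys) ≡⟨ ℤ.+-assoc (G x) _ _ ⟨
    G x ℤ.+ G y ℤ.+ sumBy G ys   ≡⟨ cong (λ r → r ℤ.+ sumBy G ys) (ℤ.+-comm (G x) (G y)) ⟩
    G y ℤ.+ G x ℤ.+ sumBy G ys   ≡⟨ ℤ.+-assoc (G y) _ _ ⟩
    G y ℤ.+ (G x ℤ.+ sumBy G ys) ∎
    where open ≡.≡-Reasoning
  sumBy-↭ G (trans e f)   = ≡.trans (sumBy-↭ G e) (sumBy-↭ G f)

  sumBy-concat : ∀ {A : Set} (G : A → ℤ) xss → sumBy G (concat xss) ≡ sumBy (sumBy G) xss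
  sumBy-concat G []         = refl
  sumBy-concat G (xs ∷ xss) = ≡.trans (sumBy-++ G xs (concat xss)) (cong (λ r → sumBy G xs ℤ.+ r) (sumBy-concat G xss))

  sumBy-cong-All : ∀ {A : Set} {G H : A → ℤ} {xs} → All (λ x → G x ≡ H x) xs → sumBy G xs ≡ sumBy H xs
  sumBy-cong-All []       = refl
  sumBy-cong-All (e ∷ es) = cong₂ ℤ._+_ e (sumBy-cong-All es)

  sumBy-splits : ∀ {A : Set} (G : A → ℤ) xs → sumBy (λ (p , a , q) → G a) (splits xs) ≡ sumBy G xs
  sumBy-splits G []       = refl
  sumBy-splits G (x ∷ xs) = cong (λ r → G x ℤ.+ r)
    (≡.trans (sumBy-map (λ (p , a , q) → G a) _ (splits xs)) (sumBy-splits G xs))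

  sumBy-picks : ∀ {A : Set} (G : A → ℤ) xs → sumBy (λ (a , as) → G a) (picks xs) ≡ sumBy G xs
  sumBy-picks G []       = refl
  sumBy-picks G (x ∷ xs) = cong (λ r → G x ℤ.+ r)
    (≡.trans (sumBy-map (λ (a , as) → G a) _ (picks xs)) (sumBy-picks G xs))

  module _ {A B : Set} (h : A → B) where

    sumBy-splits-map : ∀ (G : List B × B × List B → ℤ) xs →
      sumBy G (splits (map h xs)) ≡ sumBy (λ (p , a , q) → G (map h p , h a , map h q)) (splits xs)
    sumBy-splits-map G []       = refl
    sumBy-splits-map G (x ∷ xs) = cong (λ r → G ([] , h x , map h xs) ℤ.+ r) (begin
      sumBy G (map (λ (p , a , q) → h x ∷ p , a , q) (splits (map h xs)))
        ≡⟨ sumBy-map G (λ (p , a , q) → h x ∷ p , a , q) (splits (map h xs)) ⟩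
      sumBy (λ (p , a , q) → G (h x ∷ p , a , q)) (splits (map h xs))
        ≡⟨ sumBy-splits-map (λ (p , a , q) → G (h x ∷ p , a , q)) xs ⟩
      sumBy (λ (p , a , q) → G (h x ∷ map h p , h a , map h q)) (splits xs)
        ≡⟨ sumBy-map (λ (p , a , q) → G (map h p , h a , map h q)) (λ (p , a , q) → x ∷ p , a , q) (splits xs) ⟨
      sumBy (λ (p , a , q) → G (map h p , h a , map h q)) (map (λ (p , a , q) → x ∷ p , a , q) (splits xs)) ∎)
      where open ≡.≡-Reasoning

    sumBy-picks-map : ∀ (G : B × List B → ℤ) xs →
      sumBy G (picks (map h xs)) ≡ sumBy (λ (a , as) → G (h a , map h as)) (picks xs)
    sumBy-picks-map G []       = refl
    sumBy-picks-map G (x ∷ xs) = cong (λ r → G (h x , map h xs) ℤ.+ r) (begin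
      sumBy G (map (λ (a , as) → a , h x ∷ as) (picks (map h xs)))
        ≡⟨ sumBy-map G (λ (a , as) → a , h x ∷ as) (picks (map h xs)) ⟩
      sumBy (λ (a , as) → G (a , h x ∷ as)) (picks (map h xs))
        ≡⟨ sumBy-picks-map (λ (a , as) → G (a , h x ∷ as)) xs ⟩
      sumBy (λ (a , as) → G (h a , h x ∷ map h as)) (picks xs)
        ≡⟨ sumBy-map (λ (a , as) → G (h a , map h as)) (λ (a , as) → a , x ∷ as) (picks xs) ⟨
      sumBy (λ (a , as) → G (h a , map h as)) (map (λ (a , as) → a , x ∷ as) (picks xs)) ∎)
      where open ≡.≡-Reasoning

  splits-++ : ∀ {A : Set} (xs : List A) → All (λ (p , a , q) → xs ≡ p ++ a ∷ q) (splits xs)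
  splits-++ []       = []
  splits-++ (x ∷ xs) = refl ∷ All.map⁺ (All.map (cong (x ∷_)) (splits-++ xs))

  picks-↭ : ∀ {A : Set} (xs : List A) → All (λ (a , as) → xs ↭ a ∷ as) (picks xs)
  picks-↭ []       = []
  picks-↭ (x ∷ xs) = ↭-refl ∷ All.map⁺ (All.map (λ e → trans (prep x e) (swap x _ ↭-refl)) (picks-↭ xs))

  concat-↭ : ∀ {A : Set} {xss yss : List (List A)} → xss ↭ yss → concat xss ↭ concat yss
  concat-↭ refl = refl
  concat-↭ (prep xs e) = ++⁺ˡ xs (concat-↭ e)
  concat-↭ (swap {xs = xss} {yss} xs ys e) = begin
    xs ++ ys ++ concat xss   ↭⟨ ++⁺ˡ xs (++⁺ˡ ys (concat-↭ e)) ⟩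
    xs ++ ys ++ concat yss   ≡⟨ ++-assoc xs ys _ ⟨
    (xs ++ ys) ++ concat yss ↭⟨ ++⁺ʳ (concat yss) (++-comm xs ys) ⟩
    (ys ++ xs) ++ concat yss ≡⟨ ++-assoc ys xs _ ⟩
    ys ++ xs ++ concat yss ∎
    where open PermutationReasoning
  concat-↭ (trans e f) = trans (concat-↭ e) (concat-↭ f)

  -- The cyclic permutation ζ as a product of adjacent transpositions, so that one more letter
  -- composes it with one more transposition on the right.
  rotate : ℕ → ℕ → ℕ
  rotate zero    x = x
  rotate (suc m) x = rotate m (transpose m (suc m) x)

  -- β = α⁻¹ζ on {0,…,m}; w is its cycle through m, written from β m to m.
  record State (m : ℕ) (α β : ℕ → ℕ) (w : List ℕ) (os : List (List ℕ)) (g b k : ℕ) : Set where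
    field
      permα    : IsPerm (suc m) α
      permβ    : IsPerm (suc m) β
      product  : ∀ x → α (β x) ≡ rotate m x
      cycle    : Cycle β w
      last     : end 0 w ≡ m
      others   : All (Cycle β) os
      cover    : w ++ concat os ↭ upTo (suc m)
      genus    : 2 * g + (k + suc (length os)) ≡ suc (suc m)
      cycles-α : cycles (suc m) α ≡ k
      backs-α  : backs (suc m) α ≡ b

    elements : ∀ {zs} → w ++ concat os ↭ zs → All (_< suc m) zs
    elements e = All-resp-↭ (trans (↭-sym cover) e) (All.tabulate ∈-upTo⁻)

    distinct : ∀ {zs} → w ++ concat os ↭ zs → Unique zs
    distinct e = Permutation.Unique-resp-↭ (↭⇒↭ₛ (trans (↭-sym cover) e)) (upTo⁺ (suc m))

    cover-suc : ∀ {zs} → w ++ concat os ↭ zs → suc m ∷ zs ↭ upTo (suc (suc m))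
    cover-suc {zs} e = begin
      suc m ∷ zs               ↭⟨ prep (suc m) (trans (↭-sym e) cover) ⟩
      suc m ∷ upTo (suc m)     ↭⟨ ++-comm (suc m ∷ []) (upTo (suc m)) ⟩
      upTo (suc m) ∷ʳ suc m    ≡⟨ upTo-∷ʳ (suc m) ⟩
      upTo (suc (suc m)) ∎
      where open PermutationReasoning

  open State

  map-exc : ∀ {n α a zs} → IsPerm n α → All (a ≢_) zs → All (_< n) zs → map (exc (insert n α a)) zs ≡ map (exc α) zs
  map-exc {a = a} p ≢a <n = map-cong-local (All.zipWith (λ (a≢x , x<n) → exc-other p a (a≢x ∘ sym) x<n) (≢a , <n))

  map-map-exc : ∀ {n α a os} → IsPerm n α → All (a ≢_) (concat os) → All (_< n) (concat os) →
    map (map (exc (insert n α a))) os ≡ map (map (exc α)) os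
  map-map-exc {os = os} p ≢a <n = map-cong-local (All.zipWith (λ (≢a , <n) → map-exc p ≢a <n)
    (All.concat⁻ {xss = os} ≢a , All.concat⁻ {xss = os} <n))

  head-of : ∀ {f m x} xs → Cycle f (x ∷ xs) → end x xs ≡ m → f m ≡ x
  head-of {f} xs (e , _) q = ≡.trans (cong f (sym q)) e

  module _ {m : ℕ} {α β : ℕ → ℕ} {w : List ℕ} {os : List (List ℕ)} {g b k : ℕ} (s : State m α β w os g b k) where
    private
      n = suc m

    module _ {a : ℕ} (a≤n : a ≤ n) where
      open Step (permβ s) a a≤n using (f′; Kept)

      keep : ∀ {zs} → All (a ≢_) zs → All (β m ≢_) zs → All (_< n) zs → All Kept zs
      keep ≢a ≢b <n = All.zipWith (λ (a≢ , b≢ , <n) → a≢ ∘ sym , b≢ ∘ sym , <⇒≢ <n) (≢a , All.zip (≢b , <n))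

      product′ : ∀ x → insert n α a (f′ x) ≡ rotate n x
      product′ x = ≡.trans (cong α (transpose-involutive a n _)) (product s (transpose m n x))

    state-fixed : State n (insert n α n) (Step.f′ (permβ s) n ≤-refl) (w ++ n ∷ []) os g b (suc k)
    -- The word is generalised so that it can be matched; `head-of` then identifies its first letter
    -- with `β m`.
    state-fixed = go w s
      where
      go : ∀ w → State m α β w os g b k → State n (insert n α n) (Step.f′ (permβ s) n ≤-refl) (w ++ n ∷ []) os g b (suc k)
      go [] s′ = ⊥-elim (cycle s′)
      go (x ∷ w′) s′ with head-of w′ (cycle s′) (last s′) | distinct s′ ↭-refl | elements s′ ↭-refl
      ... | refl | x≢ ∷ _ | x<n ∷ <n = record
        { permα = insert-perm (permα s) ≤-refl
        ; permβ = Step.f′-perm (permβ s) n ≤-refl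
        ; product = product′ ≤-refl
        ; cycle = Step.lengthen (permβ s) n ≤-refl w′ (last s′) (cycle s′) (<⇒≢ x<n) (All.++⁻ˡ w′ kept) refl
        ; last = end-++ (β m) w′ (n ∷ [])
        ; others = All.zipWith (λ (c , ks) → Step.Cycle-kept (permβ s) n ≤-refl _ ks c)
                     (others s , All.concat⁻ {xss = os} (All.++⁻ʳ w′ kept))
        ; cover = trans (↭-reflexive (++-assoc (β m ∷ w′) (n ∷ []) (concat os)))
                    (trans (shift n (β m ∷ w′) (concat os)) (cover-suc s′ ↭-refl))
        ; genus = ≡.trans (+-suc (2 * g) _) (cong suc (genus s))
        ; cycles-α = ≡.trans (cycles-fixed (permα s)) (cong suc (cycles-α s))
        ; backs-α = ≡.trans (backs-fixed (permα s)) (backs-α s) }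
        where
        kept : All (Step.Kept (permβ s) n ≤-refl) (w′ ++ concat os)
        kept = keep ≤-refl (All.map (λ y<n n≡y → <⇒≢ y<n (sym n≡y)) <n) x≢ <n

  bump-+ : ∀ c b → (if c then 1 else 0) + b ≡ bump c b
  bump-+ true  b = refl
  bump-+ false b = refl

  -- One more letter and one more cycle of β balance in the genus equation, so `g` stays.
  state-cut : ∀ {m α β os g b k} p {a} q → State m α β (p ++ a ∷ q) os g b k → (a<n : a < suc m) →
    ∃ λ β′ → State (suc m) (insert (suc m) α a) β′ (p ++ suc m ∷ []) ((a ∷ q) ∷ os) g (bump (exc α a) b) k
  state-cut {m} {α} {β} {os} {g} {b} {k} p {a} q s a<n = f′ , record
    { permα = insert-perm (permα s) a≤n
    ; permβ = f′-perm
    ; product = product′ s a≤n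
    ; cycle = proj₁ (cycles′ p q s)
    ; last = end-++ 0 p (n ∷ [])
    ; others = proj₂ (cycles′ p q s)
    ; cover = trans (↭-reflexive (++-assoc p (n ∷ []) _)) (trans (shift n p _)
                (cover-suc s (↭-reflexive (++-assoc p (a ∷ q) (concat os)))))
    ; genus = ≡.trans (cong (λ r → 2 * g + r) (+-suc k _)) (≡.trans (+-suc (2 * g) _) (cong suc (genus s)))
    ; cycles-α = ≡.trans (cycles-insert (permα s) a<n) (cycles-α s)
    ; backs-α = ≡.trans (backs-insert (permα s) a<n) (≡.trans (cong (λ r → (if exc α a then 1 else 0) + r) (backs-α s)) (bump-+ (exc α a) b)) }
    where
    n = suc m
    a≤n = <⇒≤ a<n
    open Step (permβ s) a a≤n
      using (f′; f′-perm; Kept; Cycle-kept; cut-first; cut-left; cut-right)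
    end-q : ∀ p q → end 0 (p ++ a ∷ q) ≡ m → end a q ≡ m
    end-q p q e = ≡.trans (sym (end-++ 0 p (a ∷ q))) e
    keepOs : All Kept (concat os) → All (Cycle β) os → All (Cycle f′) os
    keepOs ks cs = All.zipWith (λ (c , ks) → Cycle-kept _ ks c) (cs , All.concat⁻ {xss = os} ks)
    cycles′ : ∀ p q → State m α β (p ++ a ∷ q) os g b k → Cycle f′ (p ++ n ∷ []) × All (Cycle f′) ((a ∷ q) ∷ os)
    cycles′ [] q s′ with head-of q (cycle s′) (last s′) | distinct s′ ↭-refl | elements s′ ↭-refl
    ... | eq | a≢ ∷ _ | _ ∷ <n = cut-first q (last s′) (cycle s′) ,
        cut-right {end a q} [] q (last s′) (cycle s′) (All.++⁻ˡ q kept) ∷ keepOs (All.++⁻ʳ q kept) (others s′)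
      where
      kept : All Kept (q ++ concat os)
      kept = keep s a≤n a≢ (subst (λ x → All (x ≢_) (q ++ concat os)) (sym eq) a≢) <n
    cycles′ (x ∷ p′) q s′ with head-of (p′ ++ a ∷ q) (cycle s′) (last s′) | distinct s′ perm | elements s′ perm
      where
      perm : (x ∷ p′ ++ a ∷ q) ++ concat os ↭ a ∷ x ∷ p′ ++ q ++ concat os
      perm = solve 5 (λ x p a q o → (x ⊙ (p ⊙ (a ⊙ q))) ⊙ o ⊜ a ⊙ (x ⊙ (p ⊙ (q ⊙ o)))) ↭-refl
               (x ∷ []) p′ (a ∷ []) q (concat os)
        where open ++-Solver
    ... | refl | (a≢b ∷ a≢) ∷ b≢ ∷ _ | _ ∷ _ ∷ <n =
        cut-left p′ q (last s′) (cycle s′) (a≢b ∘ sym) (<⇒≢ a<n) (All.++⁻ˡ p′ kept) ,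
        cut-right p′ q (end-q (β m ∷ p′) q (last s′)) (proj₂ (cycle s′)) (All.++⁻ˡ q (All.++⁻ʳ p′ kept)) ∷
        keepOs (All.++⁻ʳ q (All.++⁻ʳ p′ kept)) (others s′)
      where
      kept : All Kept (p′ ++ q ++ concat os)
      kept = keep s a≤n a≢ b≢ <n

  -- One more letter and one cycle of β fewer leave a deficit of two in the genus equation, so `g`
  -- grows by one.
  state-join : ∀ {m α β w os os′ g b k} p {a} q → State m α β w os g b k → os ↭ (p ++ a ∷ q) ∷ os′ → (a<n : a < suc m) →
    ∃ λ β′ → State (suc m) (insert (suc m) α a) β′ (w ++ a ∷ q ++ p ++ suc m ∷ []) os′ (suc g) (bump (exc α a) b) k
  state-join {w = []} p q s _ _ = ⊥-elim (cycle s)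
  state-join {m} {α} {β} {x ∷ w′} {os} {os′} {g} {b} {k} p {a} q s os↭ a<n
    with head-of w′ (cycle s) (last s) | distinct s perm | elements s perm
    where
    perm : (x ∷ w′) ++ concat os ↭ a ∷ x ∷ w′ ++ p ++ q ++ concat os′
    perm = trans (++⁺ˡ (x ∷ w′) (concat-↭ os↭))
      (solve 6 (λ x w p a q o → (x ⊙ w) ⊙ ((p ⊙ (a ⊙ q)) ⊙ o) ⊜ a ⊙ (x ⊙ (w ⊙ (p ⊙ (q ⊙ o))))) ↭-refl
        (x ∷ []) w′ p (a ∷ []) q (concat os′))
      where open ++-Solver
  ... | refl | (a≢b ∷ a≢) ∷ b≢ ∷ _ | _ ∷ _ ∷ <n = f′ , record
    { permα = insert-perm (permα s) a≤n
    ; permβ = f′-perm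
    ; product = product′ s a≤n
    ; cycle = join w′ p q (last s) (cycle s) (All.head cs) (a≢b ∘ sym) (<⇒≢ a<n)
                (All.++⁻ˡ w′ kept) (All.++⁻ˡ p kept′) (All.++⁻ˡ q (All.++⁻ʳ p kept′))
    ; last = ≡.trans (end-++ (β m) w′ _) (≡.trans (end-++ a q _) (end-++ (end a q) p (n ∷ [])))
    ; others = All.zipWith (λ (c , ks) → Cycle-kept _ ks c)
                 (All.tail cs , All.concat⁻ {xss = os′} (All.++⁻ʳ q (All.++⁻ʳ p kept′)))
    ; cover = trans (solve 6 (λ w a q p n o → (w ⊙ (a ⊙ (q ⊙ (p ⊙ n)))) ⊙ o ⊜ n ⊙ (w ⊙ ((p ⊙ (a ⊙ q)) ⊙ o))) ↭-refl
                (β m ∷ w′) (a ∷ []) q p (n ∷ []) (concat os′)) (cover-suc s (++⁺ˡ (β m ∷ w′) (concat-↭ os↭)))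
    ; genus = ≡.trans (cong (_+ (k + suc (length os′))) (*-suc 2 g))
                (cong suc (≡.trans (≡.trans (sym (+-suc (2 * g) _)) (cong (λ r → 2 * g + r) (sym (+-suc k _))))
                  (≡.trans (cong (λ l → 2 * g + (k + suc l)) (sym (↭-length os↭))) (genus s))))
    ; cycles-α = ≡.trans (cycles-insert (permα s) a<n) (cycles-α s)
    ; backs-α = ≡.trans (backs-insert (permα s) a<n) (≡.trans (cong (λ r → (if exc α a then 1 else 0) + r) (backs-α s)) (bump-+ (exc α a) b)) }
    where
    n = suc m
    a≤n = <⇒≤ a<n
    open Step (permβ s) a a≤n using (f′; f′-perm; Kept; Cycle-kept; join)
    open ++-Solver using (solve; _⊙_; _⊜_)
    cs = All-resp-↭ os↭ (others s)
    kept : All Kept (w′ ++ p ++ q ++ concat os′)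
    kept = keep s a≤n a≢ b≢ <n
    kept′ : All Kept (p ++ q ++ concat os′)
    kept′ = All.++⁻ʳ w′ kept

  descend : ((ℕ → ℕ) → ℤ) → ℕ → ℕ → (ℕ → ℕ) → ℤ
  descend f zero    n α = f α
  descend f (suc N) n α = sumBy (λ a → descend f N (suc n) (insert n α a)) (upTo (suc n))

  sumBy-upTo-suc : ∀ (G : ℕ → ℤ) n → sumBy G (upTo (suc n)) ≡ G n ℤ.+ sumBy G (upTo n)
  sumBy-upTo-suc G n = begin
    sumBy G (upTo (suc n))                   ≡⟨ cong (sumBy G) (upTo-∷ʳ n) ⟨
    sumBy G (upTo n ∷ʳ n)                    ≡⟨ sumBy-++ G (upTo n) (n ∷ []) ⟩
    sumBy G (upTo n) ℤ.+ (G n ℤ.+ + 0)       ≡⟨ cong (λ r → sumBy G (upTo n) ℤ.+ r) (ℤ.+-identityʳ (G n)) ⟩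
    sumBy G (upTo n) ℤ.+ G n                 ≡⟨ ℤ.+-comm (sumBy G (upTo n)) (G n) ⟩
    G n ℤ.+ sumBy G (upTo n) ∎
    where open ≡.≡-Reasoning

  module _ (ω : ℕ → ℤ) (κ M : ℕ) (f : (ℕ → ℕ) → ℤ)
    (leaf : ∀ {m α β w os g b k} → State m α β w os g b k → suc m ≡ M →
            f α ≡ (if (g ≡ᵇ 1) ∧ (k ≡ᵇ κ) then ω b else + 0)) where

    -- By `cover` every old letter occurs exactly once on w or on another cycle, so the sum over
    -- insertion places regroups into the three sums of `F`.
    descend-F : ∀ N {m α β w os g b k} → State m α β w os g b k → suc m + N ≡ M →
      descend f N (suc m) α ≡ F ω N g b k (map (exc α) w) (map (map (exc α)) os) κ
    descend-F zero {m} s eq = leaf s (≡.trans (cong suc (sym (+-identityʳ m))) eq)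
    descend-F (suc N) {m} {α} {β} {w} {os} {g} {b} {k} s eq = begin
      sumBy D (upTo (suc n))
        ≡⟨ sumBy-upTo-suc D n ⟩
      D n ℤ.+ sumBy D (upTo n)
        ≡⟨ cong (λ r → D n ℤ.+ r) (≡.trans (sumBy-↭ D (↭-sym (cover s))) (sumBy-++ D w (concat os))) ⟩
      D n ℤ.+ (sumBy D w ℤ.+ sumBy D (concat os))
        ≡⟨ cong₂ ℤ._+_ fixed (cong₂ ℤ._+_ cuts joins) ⟩
      F ω N g b (suc k) (map e w ++ false ∷ []) (map (map e) os) κ ℤ.+
        (sumBy cut (splits (map e w)) ℤ.+ sumBy join (picks (map (map e) os))) ∎
      where
      open ≡.≡-Reasoning
      n = suc m
      e = exc α
      D : ℕ → ℤ
      D a = descend f N (suc n) (insert n α a)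
      cut : List Bool × Bool × List Bool → ℤ
      cut (p , a , q) = F ω N g (bump a b) k (p ++ false ∷ []) ((true ∷ q) ∷ map (map e) os) κ
      join : List Bool × List (List Bool) → ℤ
      join (c , os′) = sumBy (λ (p , a , q) → F ω N (suc g) (bump a b) k (map e w ++ true ∷ q ++ p ++ false ∷ []) os′ κ) (splits c)
      eq′ : suc n + N ≡ M
      eq′ = ≡.trans (cong suc (sym (+-suc m N))) eq
      p = permα s

      ≢n : ∀ {zs} → All (_< n) zs → All (n ≢_) zs
      ≢n = All.map (λ y<n n≡y → <⇒≢ y<n (sym n≡y))

      fixed : D n ≡ F ω N g b (suc k) (map e w ++ false ∷ []) (map (map e) os) κ
      fixed = ≡.trans (descend-F N (state-fixed s) eq′) (cong₂ (λ u v → F ω N g b (suc k) u v κ)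
        (≡.trans (map-++ (exc (insert n α n)) w (n ∷ []))
          (cong₂ (λ u c → u ++ c ∷ []) (map-exc p (≢n <w) <w) (exc-top p ≤-refl)))
        (map-map-exc p (≢n <os) <os))
        where
        <w : All (_< n) w
        <w = All.++⁻ˡ w (elements s ↭-refl)
        <os : All (_< n) (concat os)
        <os = All.++⁻ʳ w (elements s ↭-refl)

      cuts : sumBy D w ≡ sumBy cut (splits (map e w))
      cuts = begin
        sumBy D w                              ≡⟨ sumBy-splits D w ⟨
        sumBy (λ (p , a , q) → D a) (splits w) ≡⟨ sumBy-cong-All (All.map (λ {(p , a , q)} → one p a q) (splits-++ w)) ⟩
        sumBy (λ (p , a , q) → cut (map e p , e a , map e q)) (splits w) ≡⟨ sumBy-splits-map e cut w ⟨
        sumBy cut (splits (map e w)) ∎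
        where
        one : ∀ p a q → w ≡ p ++ a ∷ q → D a ≡ cut (map e p , e a , map e q)
        one ls a rs refl with distinct s perm | elements s perm
          where
          perm : (ls ++ a ∷ rs) ++ concat os ↭ a ∷ ls ++ rs ++ concat os
          perm = ↭-trans (↭-reflexive (++-assoc ls (a ∷ rs) (concat os))) (shift a ls (rs ++ concat os))
        ... | a≢ ∷ _ | a<n ∷ <n with state-cut ls rs s a<n
        ... | β′ , s′ = ≡.trans (descend-F N s′ eq′) (cong₂ (λ u v → F ω N g (bump (e a) b) k u v κ)
          (≡.trans (map-++ e′ ls (n ∷ [])) (cong₂ (λ u c → u ++ c ∷ []) (map-exc p (All.++⁻ˡ ls a≢) (All.++⁻ˡ ls <n)) (exc-top p (<⇒≤ a<n))))
          (cong₂ _∷_ (cong₂ _∷_ (exc-at p a<n) (map-exc p (All.++⁻ˡ rs a≢′) (All.++⁻ˡ rs <n′)))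
            (map-map-exc p (All.++⁻ʳ rs a≢′) (All.++⁻ʳ rs <n′))))
          where
          e′ = exc (insert n α a)
          a≢′ = All.++⁻ʳ ls a≢
          <n′ = All.++⁻ʳ ls <n

      joins : sumBy D (concat os) ≡ sumBy join (picks (map (map e) os))
      joins = begin
        sumBy D (concat os)                                     ≡⟨ sumBy-concat D os ⟩
        sumBy (sumBy D) os                                      ≡⟨ sumBy-picks (sumBy D) os ⟨
        sumBy (λ (c , os′) → sumBy D c) (picks os)
          ≡⟨ sumBy-cong-All (All.map (λ {(c , os′)} → each c os′) (picks-↭ os)) ⟩
        sumBy (λ (c , os′) → join (map e c , map (map e) os′)) (picks os) ≡⟨ sumBy-picks-map (map e) join os ⟨
        sumBy join (picks (map (map e) os)) ∎
        where
        each : ∀ c os′ → os ↭ c ∷ os′ → sumBy D c ≡ join (map e c , map (map e) os′)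
        each c os′ os↭ = begin
          sumBy D c                              ≡⟨ sumBy-splits D c ⟨
          sumBy (λ (p , a , q) → D a) (splits c) ≡⟨ sumBy-cong-All (All.map (λ {(p , a , q)} → one p a q) (splits-++ c)) ⟩
          sumBy (λ (p , a , q) → joined (map e p , e a , map e q)) (splits c) ≡⟨ sumBy-splits-map e joined c ⟨
          sumBy joined (splits (map e c)) ∎
          where
          joined : List Bool × Bool × List Bool → ℤ
          joined (p , a , q) = F ω N (suc g) (bump a b) k (map e w ++ true ∷ q ++ p ++ false ∷ []) (map (map e) os′) κ
          one : ∀ p a q → c ≡ p ++ a ∷ q → D a ≡ joined (map e p , e a , map e q)
          one ls a rs refl with distinct s perm | elements s perm
            where
            perm : w ++ concat os ↭ a ∷ w ++ rs ++ ls ++ concat os′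
            perm = ↭-trans (++⁺ˡ w (concat-↭ os↭))
              (++-Solver.solve 5 (λ w p a q o → w ++-Solver.⊙ ((p ++-Solver.⊙ (a ++-Solver.⊙ q)) ++-Solver.⊙ o) ++-Solver.⊜
                a ++-Solver.⊙ (w ++-Solver.⊙ (q ++-Solver.⊙ (p ++-Solver.⊙ o)))) ↭-refl w ls (a ∷ []) rs (concat os′))
          ... | a≢ ∷ _ | a<n ∷ <n with state-join ls rs s os↭ a<n
          ... | β′ , s′ = ≡.trans (descend-F N s′ eq′) (cong₂ (λ u v → F ω N (suc g) (bump (e a) b) k u v κ)
            (≡.trans (map-++ e′ w _) (cong₂ _++_ (map-exc p (All.++⁻ˡ w a≢) (All.++⁻ˡ w <n))
              (cong₂ _∷_ (exc-at p a<n) (≡.trans (map-++ e′ rs _) (cong₂ _++_ (map-exc p (All.++⁻ˡ rs a≢′) (All.++⁻ˡ rs <n′))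
                (≡.trans (map-++ e′ ls (n ∷ [])) (cong₂ (λ u c → u ++ c ∷ [])
                  (map-exc p (All.++⁻ˡ ls a≢″) (All.++⁻ˡ ls <n″)) (exc-top p (<⇒≤ a<n)))))))))
            (map-map-exc p (All.++⁻ʳ ls a≢″) (All.++⁻ʳ ls <n″)))
            where
            e′ = exc (insert n α a)
            a≢′ = All.++⁻ʳ w a≢
            <n′ = All.++⁻ʳ w <n
            a≢″ = All.++⁻ʳ rs a≢′
            <n″ = All.++⁻ʳ rs <n′

  state-one : State 0 (insert 0 id 0) id (0 ∷ []) [] 0 0 1
  state-one = record
    { permα = insert-perm (isPerm id (λ _ → refl)) ≤-refl
    ; permβ = isPerm id (λ _ → refl)
    ; product = λ x → same x
    ; cycle = refl , tt
    ; last = refl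
    ; others = []
    ; cover = ↭-refl
    ; genus = refl
    ; cycles-α = refl
    ; backs-α = refl }
    where
    same : ∀ x → insert 0 id 0 x ≡ x
    same zero    = refl
    same (suc x) = transpose-other 0 0 (λ ()) (λ ())

-- Enumeration of the symmetric group by insertion and comparison with the tables

module Enumeration where

  open GeneratingTree using (sumBy; sumBy-cong; sumBy-map; F)
  open Permutations
  open CycleStates
  open import Function using (_∘_; id; mk⇔)
  open import Function.Bundles using (module Equivalence)
  open import Data.Bool using (Bool; true; false; if_then_else_; _∧_; _∨_; not; T?)
  import Data.Bool.Properties as Bool
  open import Data.Nat as ℕ using (ℕ; zero; suc; _+_; _*_; _≤_; _<_; z≤n; s≤s; _≡ᵇ_; _<ᵇ_; _≤ᵇ_; _<?_)
  open import Data.Nat.Properties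
  open import Data.Integer as ℤ using (ℤ; +_)
  import Data.Integer.Properties as ℤ
  open import Data.Fin as Fin using (Fin; toℕ; fromℕ<)
  import Data.Fin.Properties as Fin
  open import Data.Vec as Vec using (Vec; lookup; tabulate)
  import Data.Vec.Properties as Vec
  open import Data.Product using (_×_; _,_; proj₁; proj₂; ∃)
  open import Data.List as List using (List; []; _∷_; _++_; map; upTo; length; concat; concatMap; allFin; filterᵇ; applyUpTo; cartesianProductWith)
  open import Data.List.Properties using (map-tabulate)
  open import Data.List.Membership.Propositional using (_∈_)
  open import Data.List.Membership.Propositional.Properties
  open import Data.List.Membership.Propositional.Properties.WithK using (unique∧set⇒bag)
  open import Data.List.Relation.Binary.BagAndSetEquality using (∼bag⇒↭)
  open import Data.List.Relation.Unary.Any using (here; there)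
  open import Data.List.Relation.Unary.All as All using (All; []; _∷_)
  import Data.List.Relation.Unary.All.Properties as All
  open import Data.List.Relation.Unary.AllPairs as AllPairs using (AllPairs; []; _∷_)
  import Data.List.Relation.Unary.AllPairs.Properties as AllPairs
  open import Data.List.Relation.Unary.Unique.Propositional using (Unique)
  import Data.List.Relation.Unary.Unique.Propositional.Properties as Unique
  open import Data.List.Relation.Binary.Permutation.Propositional using (_↭_; ↭-refl)
  open import Data.Empty using (⊥-elim)
  open import Data.Sum using (inj₁; inj₂)
  open import Relation.Nullary using (¬_; yes; no)
  open import Relation.Binary.PropositionalEquality as ≡ using (_≡_; _≢_; refl; sym; cong; cong₂; subst; trans; _≗_)

  open IsPerm
  open State

  count-zero : ∀ {A : Set} (p : A → Bool) {xs} → All (λ x → p x ≡ false) xs → count p xs ≡ 0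
  count-zero p []       = refl
  count-zero p (e ∷ es) = cong₂ (λ b c → (if b then 1 else 0) + c) e (count-zero p es)

  minimum : ∀ x xs → ∃ λ μ → μ ∈ x ∷ xs × All (μ ≤_) (x ∷ xs)
  minimum x []       = x , here refl , ≤-refl ∷ []
  minimum x (y ∷ ys) with minimum y ys
  ... | μ , μ∈ , μ≤ with ≤-total x μ
  ...   | inj₁ x≤μ = x , here refl , ≤-refl ∷ All.map (≤-trans x≤μ) μ≤
  ...   | inj₂ μ≤x = μ , there μ∈ , μ≤x ∷ μ≤

  Path-reach : ∀ {f} x {xs y} → Path f x xs → y ∈ xs → ∃ λ t → iterate f t x ≡ y
  Path-reach {f} x {z ∷ xs} (e , π) (here refl) = 1 , e
  Path-reach {f} x {z ∷ xs} (e , π) (there y∈) with Path-reach z π y∈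
  ... | t , eq = suc t , trans (iterate-sucʳ f t x) (trans (cong (iterate f t) e) eq)

  Path-end : ∀ {f} x xs → Path f x xs → ∃ λ t → iterate f t x ≡ end x xs
  Path-end x []       _       = 0 , refl
  Path-end {f} x (y ∷ xs) (e , π) with Path-end y xs π
  ... | t , eq = suc t , trans (iterate-sucʳ f t x) (trans (cong (iterate f t) e) eq)

  module _ {f : ℕ → ℕ} where
    Cycle-suffix : ∀ p {x} q → Cycle f (p ++ x ∷ q) → Path f x q
    Cycle-suffix []      q (_ , π) = π
    Cycle-suffix (y ∷ p) q (_ , π) = proj₂ (proj₂ (Path-++⁻ p π))

    Cycle-reach : ∀ {c x y} → Cycle f c → x ∈ c → y ∈ c → ∃ λ t → iterate f t x ≡ y
    Cycle-reach {c₀ ∷ cs} {x} cyc x∈ y∈ with ∈-∃++ x∈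
    ... | p , q , eq with Path-end x q (Cycle-suffix p q (subst (Cycle f) eq cyc))
    ...   | t , et = from y∈
      where
      start : iterate f (suc t) x ≡ c₀
      start = trans (cong f (trans et (trans (sym (end-++ 0 p (x ∷ q))) (cong (end 0) (sym eq))))) (proj₁ cyc)
      from : ∀ {y} → y ∈ c₀ ∷ cs → ∃ λ t → iterate f t x ≡ y
      from (here refl) = suc t , start
      from (there y∈) with Path-reach c₀ (proj₂ cyc) y∈
      ... | s , es = s + suc t , trans (iterate-+ f s (suc t) x) (trans (cong (iterate f s) start) es)

    Cycle-closed : ∀ {c x} → Cycle f c → x ∈ c → f x ∈ c
    Cycle-closed {c₀ ∷ cs} {x} cyc x∈ with ∈-∃++ x∈
    ... | p , [] , eq = here (trans (cong f (trans (sym (end-++ 0 p (x ∷ []))) (cong (end 0) (sym eq)))) (proj₁ cyc))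
    ... | p , y ∷ q , eq = subst (_∈ c₀ ∷ cs) (sym (proj₁ (Cycle-suffix p (y ∷ q) (subst (Cycle f) eq cyc))))
        (subst (y ∈_) (sym eq) (∈-++⁺ʳ p (there (here refl))))

    Cycle-iterate : ∀ {c x} → Cycle f c → x ∈ c → ∀ t → iterate f t x ∈ c
    Cycle-iterate cyc x∈ zero    = x∈
    Cycle-iterate cyc x∈ (suc t) = Cycle-closed cyc (Cycle-iterate cyc x∈ t)

  Unique-split : ∀ {A : Set} p {x : A} q → Unique (p ++ x ∷ q) → All (x ≢_) p × All (x ≢_) q
  Unique-split []      q (x≢ ∷ _) = [] , x≢
  Unique-split (y ∷ p) q (y≢ ∷ u) with Unique-split p q u
  ... | ≢p , ≢q = (All.head (All.++⁻ʳ p y≢) ∘ sym) ∷ ≢p , ≢q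

  -- Letters of one cycle reach each other, so only the least of them passes the test.
  Cycle-count : ∀ {n f} → IsPerm n f → ∀ c → Cycle f c → Unique c → All (_< n) c → count (minimalᵇ n f) c ≡ 1
  Cycle-count {n} {f} perm (x ∷ xs) cyc u <n with minimum x xs
  ... | μ , μ∈ , μ≤ with ∈-∃++ μ∈
  ...   | p , q , eq = begin
    count min (x ∷ xs)                                       ≡⟨ cong (count min) eq ⟩
    count min (p ++ μ ∷ q)                                   ≡⟨ count-++ min p (μ ∷ q) ⟩
    count min p + ((if min μ then 1 else 0) + count min q)   ≡⟨ cong₂ (λ a b → count min p + ((if a then 1 else 0) + b))
                                                                 (minimalᵇ⁺ n {f} (λ t → All.lookup μ≤ (Cycle-iterate cyc μ∈ t))) (count-zero min noq) ⟩
    count min p + 1                                          ≡⟨ cong (_+ 1) (count-zero min nop) ⟩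
    1 ∎
    where
    open ≡.≡-Reasoning
    min = minimalᵇ n f
    off = Unique-split p q (subst Unique eq u)
    larger : ∀ {y} → y ∈ x ∷ xs → μ ≢ y → min y ≡ false
    larger {y} y∈ μ≢y with Cycle-reach cyc y∈ μ∈
    ... | t , et = not-minimal perm (All.lookup <n y∈) (t , subst (_< y) (sym et) (≤∧≢⇒< (All.lookup μ≤ y∈) μ≢y))
    nop : All (λ y → min y ≡ false) p
    nop = All.tabulate (λ y∈ → larger (subst (_ ∈_) (sym eq) (∈-++⁺ˡ y∈)) (All.lookup (proj₁ off) y∈))
    noq : All (λ y → min y ≡ false) q
    noq = All.tabulate (λ y∈ → larger (subst (_ ∈_) (sym eq) (∈-++⁺ʳ p (there y∈))) (All.lookup (proj₂ off) y∈))

  -- Turns the number of listed cycles into the cycle count of α⁻¹ζ, which the definition of the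
  -- genus needs.
  cycles-β : ∀ {m α β w os g b k} → State m α β w os g b k → cycles (suc m) β ≡ suc (length os)
  cycles-β {m} {α} {β} {w} {os} s = begin
    count min (upTo (suc m))                  ≡⟨ count-↭ min (cover s) ⟨
    count min (concat (w ∷ os))               ≡⟨ all-one (w ∷ os) (cycle s ∷ others s) (distinct s ↭-refl) (elements s ↭-refl) ⟩
    suc (length os) ∎
    where
    open ≡.≡-Reasoning
    min = minimalᵇ (suc m) β
    Unique-++⁻ : ∀ xs {ys : List ℕ} → Unique (xs ++ ys) → Unique xs × Unique ys
    Unique-++⁻ []       u       = [] , u
    Unique-++⁻ (x ∷ xs) (h ∷ u) = All.++⁻ˡ xs h ∷ proj₁ (Unique-++⁻ xs u) , proj₂ (Unique-++⁻ xs u)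
    all-one : ∀ cs → All (Cycle β) cs → Unique (concat cs) → All (_< suc m) (concat cs) → count min (concat cs) ≡ length cs
    all-one []       _        _ _  = refl
    all-one (c ∷ cs) (z ∷ zs) u <n = trans (count-++ min c (concat cs)) (cong₂ _+_
      (Cycle-count (permβ s) c z (proj₁ (Unique-++⁻ c u)) (All.++⁻ˡ c <n))
      (all-one cs zs (proj₂ (Unique-++⁻ c u)) (All.++⁻ʳ c <n)))

  rotate-> : ∀ m {x} → m < x → rotate m x ≡ x
  rotate-> zero    _ = refl
  rotate-> (suc m) {x} m<x = trans (cong (rotate m) (transpose-other m (suc m) (λ { refl → <-irrefl refl (<-trans (n<1+n m) m<x) }) (<⇒≢ m<x ∘ sym)))
    (rotate-> m (<-trans (n<1+n m) m<x))

  rotate-≡ : ∀ m → rotate m m ≡ 0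
  rotate-≡ zero    = refl
  rotate-≡ (suc m) = trans (cong (rotate m) (transpose-r m (suc m))) (rotate-≡ m)

  rotate-< : ∀ m {x} → x < m → rotate m x ≡ suc x
  rotate-< (suc m) {x} x<1+m with m<1+n⇒m<n∨m≡n x<1+m
  ... | inj₂ refl = trans (cong (rotate m) (transpose-l m (suc m))) (rotate-> m (n<1+n m))
  ... | inj₁ x<m = trans (cong (rotate m) (transpose-other m (suc m) (<⇒≢ x<m) (<⇒≢ x<1+m))) (rotate-< m x<m)

  toℕ-ζ : ∀ {m} (i : Fin (suc m)) → toℕ (ζ i) ≡ rotate m (toℕ i)
  toℕ-ζ {m} i with toℕ i <? m
  ... | yes p = trans (Fin.toℕ-fromℕ< (s≤s p)) (sym (rotate-< m p))
  ... | no ¬p = sym (trans (cong (rotate m) (≤-antisym (ℕ.s≤s⁻¹ (Fin.toℕ<n i)) (≮⇒≥ ¬p))) (rotate-≡ m))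

  tabulate-toℕ : ∀ (g : ℕ → ℕ) n → List.tabulate {n = n} (g ∘ toℕ) ≡ applyUpTo g n
  tabulate-toℕ g zero    = refl
  tabulate-toℕ g (suc n) = cong (g 0 ∷_) (tabulate-toℕ (g ∘ suc) n)

  count-allFin : ∀ {n} {P : Fin n → Bool} {p : ℕ → Bool} → (∀ i → P i ≡ p (toℕ i)) → length (filterᵇ P (allFin n)) ≡ countTo p n
  count-allFin {n} {P} {p} e = begin
    length (filterᵇ P (allFin n))  ≡⟨ length-filterᵇ P (allFin n) ⟩
    count P (allFin n)             ≡⟨ count-cong (allFin n) (λ {i} _ → e i) ⟩
    count (p ∘ toℕ) (allFin n)     ≡⟨ count-map p toℕ (allFin n) ⟨
    count p (map toℕ (allFin n))   ≡⟨ cong (count p) (trans (map-tabulate id toℕ) (tabulate-toℕ id n)) ⟩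
    countTo p n ∎
    where open ≡.≡-Reasoning

  Restricts : ∀ {n} → (Fin n → Fin n) → (ℕ → ℕ) → Set
  Restricts f g = ∀ i → toℕ (f i) ≡ g (toℕ i)

  module _ {n : ℕ} {f : Fin n → Fin n} {g : ℕ → ℕ} (r : Restricts f g) where

    iter-restricts : ∀ t → Restricts (iter f t) (iterate g t)
    iter-restricts zero    i = refl
    iter-restricts (suc t) i = trans (r _) (cong g (iter-restricts t i))

    isCycleMin-restricts : ∀ i → isCycleMin f i ≡ minimalᵇ n g (toℕ i)
    isCycleMin-restricts i = allB-cong (λ t → cong (toℕ i ≤ᵇ_) (iter-restricts (suc t) i)) (upTo n)

    z-restricts : z f ≡ cycles n g
    z-restricts = count-allFin isCycleMin-restricts

    backPoints-restricts : backPoints f ≡ backs n g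
    backPoints-restricts = count-allFin (λ i → cong₂ (λ x b → (x <ᵇ toℕ i) ∧ not b) (r i)
      (trans (isCycleMin-restricts (f i)) (cong (minimalᵇ n g) (r i))))

  ≡ᵇ-true : ∀ {m n} → m ≡ n → (m ≡ᵇ n) ≡ true
  ≡ᵇ-true {m} {n} e = Equivalence.to Bool.T-≡ (≡⇒≡ᵇ m n e)

  ≡ᵇ-true⁻ : ∀ {m n} → (m ≡ᵇ n) ≡ true → m ≡ n
  ≡ᵇ-true⁻ {m} {n} e = ≡ᵇ⇒≡ m n (Equivalence.from Bool.T-≡ e)

  findPre-correct : ∀ {n} {f : Fin n → Fin n} → (∀ {i j} → f i ≡ f j → i ≡ j) →
    ∀ {i} is → i ∈ is → findPre f (f i) is ≡ i
  findPre-correct {f = f} inj {i} (j ∷ is) i∈ with f j == f i in eq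
  ... | true  = inj (Fin.toℕ-injective (≡ᵇ-true⁻ eq))
  ... | false with i∈
  ...   | there i∈is = findPre-correct inj is i∈is
  ...   | here refl with trans (sym eq) (≡ᵇ-true {toℕ (f i)} refl)
  ...     | ()

  -- The default `i` only makes the function total; values of a permutation of `n` letters stay in
  -- range.
  clamp : ∀ {n} → Fin n → ℕ → Fin n
  clamp {n} i x with x <? n
  ... | yes x<n = fromℕ< x<n
  ... | no  _   = i

  toℕ-clamp : ∀ {n} (i : Fin n) {x} → x < n → toℕ (clamp i x) ≡ x
  toℕ-clamp {n} i {x} x<n with x <? n
  ... | yes p = Fin.toℕ-fromℕ< p
  ... | no ¬p = ⊥-elim (¬p x<n)

  table : ∀ n → (ℕ → ℕ) → Vec (Fin n) n
  table n α = tabulate (λ i → clamp i (α (toℕ i)))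

  table-restricts : ∀ {n α} → IsPerm n α → Restricts (lookup (table n α)) α
  table-restricts {n} {α} p i = trans (cong toℕ (Vec.lookup∘tabulate (λ i → clamp i (α (toℕ i))) i))
    (toℕ-clamp i (bounded p (Fin.toℕ<n i)))

  restricts-injective : ∀ {n α f} → IsPerm n α → Restricts {n} f α → ∀ {i j} → f i ≡ f j → i ≡ j
  restricts-injective p r {i} {j} e = Fin.toℕ-injective (injective p (trans (sym (r i)) (trans (cong toℕ e) (r j))))

  inv-restricts : ∀ {m α β w os g b k} → State m α β w os g b k →
    Restricts (λ j → inv (lookup (table (suc m) α)) (ζ j)) β
  inv-restricts {m} {α} {β} s j = trans (cong toℕ inv≡) toℕ-i
    where
    f = lookup (table (suc m) α)
    r = table-restricts (permα s)
    i = fromℕ< (bounded (permβ s) (Fin.toℕ<n j))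
    toℕ-i : toℕ i ≡ β (toℕ j)
    toℕ-i = Fin.toℕ-fromℕ< _
    fi≡ζj : f i ≡ ζ j
    fi≡ζj = Fin.toℕ-injective (trans (r i) (trans (cong α toℕ-i) (trans (product s (toℕ j)) (sym (toℕ-ζ j)))))
    inv≡ : inv f (ζ j) ≡ i
    inv≡ = trans (cong (λ y → findPre f y (allFin (suc m))) (sym fi≡ζj))
      (findPre-correct (restricts-injective (permα s) r) (allFin (suc m)) (∈-allFin i))

  genus-test : ∀ g {r n} → 2 * g + r ≡ suc n → (n + 1 ≡ᵇ 2 + r) ≡ (g ≡ᵇ 1)
  genus-test g {r} {n} e = ≡-by-true
    (λ t → ≡ᵇ-true (*-cancelˡ-≡ g 1 2 (+-cancelʳ-≡ r (2 * g) 2 (trans e (trans (+-comm 1 n) (≡ᵇ-true⁻ {n + 1} t))))))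
    (λ t → ≡ᵇ-true (trans (+-comm n 1) (trans (sym e) (cong (λ h → 2 * h + r) (≡ᵇ-true⁻ {g} t)))))

  module _ (ω : ℕ → ℤ) (κ : ℕ) where

    weight : ∀ {n} → Vec (Fin n) n → ℤ
    weight v = if pStarB κ v then ω (backPoints (lookup v)) else + 0

    weight-state : ∀ {m α β w os g b k} → State m α β w os g b k →
      weight (table (suc m) α) ≡ (if (g ≡ᵇ 1) ∧ (k ≡ᵇ κ) then ω b else + 0)
    weight-state {m} {α} {g = g} {b} {k} s = cong₂ (λ t c → if t then ω c else + 0)
      (cong₂ _∧_ (trans (cong₂ (λ x y → (suc m + 1) ≡ᵇ (2 + (x + y)))
                     (trans (z-restricts r) (cycles-α s)) (trans (z-restricts (inv-restricts s)) (cycles-β s)))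
                   (genus-test g (genus s)))
                 (cong (_≡ᵇ κ) (trans (z-restricts r) (cycles-α s))))
      (trans (backPoints-restricts r) (backs-α s))
      where r = table-restricts (permα s)

  Perms : ℕ → List (ℕ → ℕ)
  Perms zero    = id ∷ []
  Perms (suc n) = concat (map (λ α → map (insert n α) (upTo (suc n))) (Perms n))

  Perms-perm : ∀ n → All (IsPerm n) (Perms n)
  Perms-perm zero    = isPerm id (λ _ → refl) ∷ []
  Perms-perm (suc n) = All.concat⁺ (All.map⁺ (All.map
    (λ p → All.map⁺ (All.tabulate (λ a∈ → insert-perm p (ℕ.s≤s⁻¹ (∈-upTo⁻ a∈))))) (Perms-perm n)))

  sumBy-Perms-suc : ∀ f n → sumBy f (Perms (suc n)) ≡ sumBy (descend f 1 n) (Perms n)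
  sumBy-Perms-suc f n = begin
    sumBy f (concat (map (λ α → map (insert n α) (upTo (suc n))) (Perms n)))
      ≡⟨ sumBy-concat f (map (λ α → map (insert n α) (upTo (suc n))) (Perms n)) ⟩
    sumBy (sumBy f) (map (λ α → map (insert n α) (upTo (suc n))) (Perms n))
      ≡⟨ sumBy-map (sumBy f) (λ α → map (insert n α) (upTo (suc n))) (Perms n) ⟩
    sumBy (λ α → sumBy f (map (insert n α) (upTo (suc n)))) (Perms n)
      ≡⟨ sumBy-cong (λ α → sumBy-map f (insert n α) (upTo (suc n))) (Perms n) ⟩
    sumBy (descend f 1 n) (Perms n) ∎
    where open ≡.≡-Reasoning

  sumBy-Perms : ∀ f N n → sumBy (descend f N n) (Perms n) ≡ sumBy f (Perms (N + n))
  sumBy-Perms f zero    n = refl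
  sumBy-Perms f (suc N) n = begin
    sumBy (descend f (suc N) n) (Perms n)     ≡⟨ sumBy-Perms-suc (descend f N (suc n)) n ⟨
    sumBy (descend f N (suc n)) (Perms (suc n)) ≡⟨ sumBy-Perms f N (suc n) ⟩
    sumBy f (Perms (N + suc n))               ≡⟨ cong (sumBy f ∘ Perms) (+-suc N n) ⟩
    sumBy f (Perms (suc N + n)) ∎
    where open ≡.≡-Reasoning

  AllPairs-with : ∀ {A : Set} {R : A → A → Set} {Q : A → Set} {xs} → All Q xs → AllPairs R xs →
    AllPairs (λ x y → Q x × Q y × R x y) xs
  AllPairs-with []       []       = []
  AllPairs-with (q ∷ qs) (r ∷ rs) = All.zipWith (λ (q′ , r′) → q , q′ , r′) (qs , r) ∷ AllPairs-with qs rs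

  -- Functions are compared pointwise. The place `a` is recovered as the preimage of `n`, and then
  -- `α` by undoing the transposition.
  Perms-distinct : ∀ n → AllPairs (λ α α′ → ¬ α ≗ α′) (Perms n)
  Perms-distinct zero    = [] ∷ []
  Perms-distinct (suc n) = AllPairs.concat⁺
    (All.map⁺ (All.map (λ p → AllPairs.map⁺ (AllPairs.applyUpTo⁺₁ id (suc n) (λ i<j j<1+n → siblings p i<j j<1+n))) (Perms-perm n)))
    (AllPairs.map⁺ (AllPairs.map (λ (p , p′ , d) → All.map⁺ (All.tabulate (λ _ → All.map⁺ (All.tabulate (λ _ → cousins p p′ d)))))
      (AllPairs-with (Perms-perm n) (Perms-distinct n))))
    where
    same-place : ∀ {α α′ a b} → IsPerm n α → IsPerm n α′ → insert n α a ≗ insert n α′ b → a ≡ b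
    same-place {α} {α′} {a} {b} p p′ e = transpose-injective b n (trans
      (injective p′ (trans (sym (e a)) (trans (insert-at n α a p) (sym (fixes p′ ≤-refl))))) (sym (transpose-l b n)))
    siblings : ∀ {α i j} → IsPerm n α → i < j → j < suc n → ¬ insert n α i ≗ insert n α j
    siblings p i<j _ e = <⇒≢ i<j (same-place p p e)
    cousins : ∀ {α α′ a b} → IsPerm n α → IsPerm n α′ → ¬ α ≗ α′ → ¬ insert n α a ≗ insert n α′ b
    cousins {α} {α′} {a} p p′ d e with same-place p p′ e
    ... | refl = d (λ x → trans (cong α (sym (transpose-involutive a n x)))
                    (trans (e (transpose a n x)) (cong α′ (transpose-involutive a n x))))

  -- The insertion place must be the preimage of `n`, which is the iterate one step before `n`
  -- returns to itself. Composing with the transposition undoes the insertion.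
  Perms-complete : ∀ n τ → IsPerm n τ → ∃ λ α → α ∈ Perms n × α ≗ τ
  Perms-complete zero    τ p = id , here refl , λ x → sym (fixes p z≤n)
  Perms-complete (suc n) τ p with period p (n<1+n n)
  ... | e , _ , τⁿ with Perms-complete n (τ ∘ transpose (iterate τ e n) n) (isPerm
          (transpose-injective (iterate τ e n) n ∘ injective p) fix)
    where
    a = iterate τ e n
    a≤n : a ≤ n
    a≤n = ℕ.s≤s⁻¹ (iterate-bounded p e (n<1+n n))
    fix : ∀ {x} → n ≤ x → τ (transpose a n x) ≡ x
    fix {x} n≤x with m≤n⇒m<n∨m≡n n≤x
    ... | inj₂ refl = trans (cong τ (transpose-r a n)) τⁿ
    ... | inj₁ n<x = trans (cong τ (transpose-other a n (λ { refl → <⇒≱ n<x a≤n }) (<⇒≢ n<x ∘ sym))) (fixes p n<x)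
  ... | α , α∈ , α≗ = insert n α a ,
        ∈-concat⁺′ (∈-map⁺ (insert n α) (∈-upTo⁺ (iterate-bounded p e (n<1+n n))))
          (∈-map⁺ (λ α → map (insert n α) (upTo (suc n))) α∈) ,
        λ x → trans (α≗ (transpose a n x)) (cong τ (transpose-involutive a n x))
    where a = iterate τ e n

  isInjective⁻ : ∀ {n} {v : Vec (Fin n) n} → isInjective v ≡ true → ∀ {i j} → lookup v i ≡ lookup v j → i ≡ j
  isInjective⁻ {n} {v} q {i} {j} e = by-or (allB⁻ _ {allFin n} (allB⁻ _ {allFin n} q (∈-allFin i)) (∈-allFin j))
    where
    by-or : (i == j) ∨ not (lookup v i == lookup v j) ≡ true → i ≡ j
    by-or t with i == j in eq
    ... | true  = Fin.toℕ-injective (≡ᵇ-true⁻ eq)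
    ... | false with trans (sym t) (cong not (≡ᵇ-true (cong toℕ e)))
    ...   | ()

  isInjective⁺ : ∀ {n} {v : Vec (Fin n) n} → (∀ {i j} → lookup v i ≡ lookup v j → i ≡ j) → isInjective v ≡ true
  isInjective⁺ {n} {v} inj = allB⁺ _ {allFin n} (λ {i} _ → allB⁺ _ {allFin n} (λ {j} _ → entry i j))
    where
    entry : ∀ i j → (i == j) ∨ not (lookup v i == lookup v j) ≡ true
    entry i j with i == j in eq
    ... | true = refl
    ... | false with lookup v i == lookup v j in eq′
    ...   | false = refl
    ...   | true with trans (sym eq) (≡ᵇ-true (cong toℕ (inj (Fin.toℕ-injective (≡ᵇ-true⁻ eq′)))))
    ...     | ()

  allTables-product : ∀ m n → allTables (suc m) n ≡ cartesianProductWith Vec._∷_ (allFin n) (allTables m n)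
  allTables-product m n = go (allFin n)
    where
    go : ∀ is → concatMap (λ i → map (i Vec.∷_) (allTables m n)) is ≡ cartesianProductWith Vec._∷_ is (allTables m n)
    go []       = refl
    go (i ∷ is) = cong (map (i Vec.∷_) (allTables m n) ++_) (go is)

  allTables-unique : ∀ m n → Unique (allTables m n)
  allTables-unique zero    n = [] ∷ []
  allTables-unique (suc m) n = subst Unique (sym (allTables-product m n))
    (Unique.cartesianProductWith⁺ Vec._∷_ Vec.∷-injective (Unique.allFin⁺ n) (allTables-unique m n))

  ∈-allTables : ∀ m n (v : Vec (Fin n) m) → v ∈ allTables m n
  ∈-allTables zero    n Vec.[]       = here refl
  ∈-allTables (suc m) n (i Vec.∷ v) = subst (i Vec.∷ v ∈_) (sym (allTables-product m n))
    (∈-cartesianProductWith⁺ Vec._∷_ (∈-allFin i) (∈-allTables m n v))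

  extend : ∀ {n} → Vec (Fin n) n → ℕ → ℕ
  extend {n} v x with x <? n
  ... | yes x<n = toℕ (lookup v (fromℕ< x<n))
  ... | no  _   = x

  extend-perm : ∀ {n} {v : Vec (Fin n) n} → (∀ {i j} → lookup v i ≡ lookup v j → i ≡ j) → IsPerm n (extend v)
  extend-perm {n} {v} inj = isPerm injective′ fixes′
    where
    injective′ : ∀ {x y} → extend v x ≡ extend v y → x ≡ y
    injective′ {x} {y} e with x <? n | y <? n
    ... | yes x<n | yes y<n = Fin.fromℕ<-injective x y x<n y<n (inj (Fin.toℕ-injective e))
    ... | yes x<n | no  y≮n = ⊥-elim (y≮n (subst (_< n) e (Fin.toℕ<n _)))
    ... | no  x≮n | yes y<n = ⊥-elim (x≮n (subst (_< n) (sym e) (Fin.toℕ<n _)))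
    ... | no  _   | no  _   = e
    fixes′ : ∀ {x} → n ≤ x → extend v x ≡ x
    fixes′ {x} n≤x with x <? n
    ... | yes x<n = ⊥-elim (<⇒≱ x<n n≤x)
    ... | no  _   = refl

  extend-toℕ : ∀ {n} (v : Vec (Fin n) n) i → extend v (toℕ i) ≡ toℕ (lookup v i)
  extend-toℕ {n} v i with toℕ i <? n
  ... | yes i<n = cong (toℕ ∘ lookup v) (Fin.fromℕ<-toℕ i i<n)
  ... | no  i≮n = ⊥-elim (i≮n (Fin.toℕ<n i))

  -- Both lists are free of repetitions and have the same members, so the order in which either is
  -- generated is irrelevant.
  Sym-↭ : ∀ n → Sym n ↭ map (table n) (Perms n)
  Sym-↭ n = ∼bag⇒↭ (unique∧set⇒bag
    (Unique.filter⁺ (T? ∘ isInjective) (allTables-unique n n))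
    (AllPairs.map⁺ (AllPairs.map (λ (p , p′ , d) e → d (agree p p′ e)) (AllPairs-with (Perms-perm n) (Perms-distinct n))))
    (mk⇔ forth back))
    where
    agree : ∀ {α α′} → IsPerm n α → IsPerm n α′ → table n α ≡ table n α′ → α ≗ α′
    agree {α} {α′} p p′ e x with x <? n
    ... | no  x≮n = trans (fixes p (≮⇒≥ x≮n)) (sym (fixes p′ (≮⇒≥ x≮n)))
    ... | yes x<n = begin
      α x                                    ≡⟨ cong α (Fin.toℕ-fromℕ< x<n) ⟨
      α (toℕ i)                              ≡⟨ table-restricts p i ⟨
      toℕ (lookup (table n α) i)             ≡⟨ cong (λ v → toℕ (lookup v i)) e ⟩
      toℕ (lookup (table n α′) i)            ≡⟨ table-restricts p′ i ⟩
      α′ (toℕ i)                             ≡⟨ cong α′ (Fin.toℕ-fromℕ< x<n) ⟩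
      α′ x ∎
      where
      open ≡.≡-Reasoning
      i = fromℕ< x<n
    forth : ∀ {v} → v ∈ Sym n → v ∈ map (table n) (Perms n)
    forth {v} v∈ with Perms-complete n (extend v) perm
      where perm = extend-perm (isInjective⁻ {v = v} (Equivalence.to Bool.T-≡ (proj₂ (∈-filter⁻ (T? ∘ isInjective) {xs = allTables n n} v∈))))
    ... | α , α∈ , α≗ = subst (_∈ map (table n) (Perms n)) (trans (Vec.tabulate-cong entry) (Vec.tabulate∘lookup v))
          (∈-map⁺ (table n) α∈)
      where
      entry : ∀ i → clamp i (α (toℕ i)) ≡ lookup v i
      entry i = Fin.toℕ-injective (trans (cong (toℕ ∘ clamp i) α≡) (toℕ-clamp i (Fin.toℕ<n (lookup v i))))
        where
        α≡ : α (toℕ i) ≡ toℕ (lookup v i)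
        α≡ = trans (α≗ (toℕ i)) (extend-toℕ v i)
    back : ∀ {v} → v ∈ map (table n) (Perms n) → v ∈ Sym n
    back v∈ with ∈-map⁻ (table n) v∈
    ... | α , α∈ , refl = ∈-filter⁺ (T? ∘ isInjective) (∈-allTables n n (table n α))
          (Equivalence.from Bool.T-≡ (isInjective⁺ {v = table n α} (restricts-injective p (table-restricts p))))
      where p = All.lookup (Perms-perm n) α∈

  sumBy-Sym : ∀ ω κ m → sumBy (weight ω κ) (Sym (suc m)) ≡ F ω m 0 0 1 (false ∷ []) [] κ
  sumBy-Sym ω κ m = begin
    sumBy (weight ω κ) (Sym (suc m))                         ≡⟨ sumBy-↭ (weight ω κ) (Sym-↭ (suc m)) ⟩
    sumBy (weight ω κ) (map (table (suc m)) (Perms (suc m))) ≡⟨ sumBy-map (weight ω κ) (table (suc m)) (Perms (suc m)) ⟩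
    sumBy f (Perms (suc m))                                  ≡⟨ cong (sumBy f ∘ Perms) (+-identityʳ (suc m)) ⟨
    sumBy f (Perms (suc m + 0))                              ≡⟨ sumBy-Perms f (suc m) 0 ⟨
    -- `Perms 0` is a singleton and the first insertion is forced; each of the two leaves a trailing
    -- zero.
    descend f (suc m) 0 id ℤ.+ + 0                           ≡⟨ ℤ.+-identityʳ _ ⟩
    descend f m 1 (insert 0 id 0) ℤ.+ + 0                    ≡⟨ ℤ.+-identityʳ _ ⟩
    descend f m 1 (insert 0 id 0)                            ≡⟨ descend-F ω κ (suc m) f leaf m state-one refl ⟩
    F ω m 0 0 1 (false ∷ []) [] κ ∎
    where
    open ≡.≡-Reasoning
    f : (ℕ → ℕ) → ℤ
    f α = weight ω κ (table (suc m) α)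
    leaf : ∀ {m′ α β w os g b k} → State m′ α β w os g b k → suc m′ ≡ suc m →
           f α ≡ (if (g ≡ᵇ 1) ∧ (k ≡ᵇ κ) then ω b else + 0)
    leaf s refl = weight-state ω κ s

  length-sumBy : ∀ {A : Set} (p : A → Bool) xs → + length (filterᵇ p xs) ≡ sumBy (λ x → if p x then + 1 else + 0) xs
  length-sumBy p []       = refl
  length-sumBy p (x ∷ xs) with p x
  ... | true  = cong (λ r → + 1 ℤ.+ r) (length-sumBy p xs)
  ... | false = trans (length-sumBy p xs) (sym (ℤ.+-identityˡ _))

-- Assembly of the four generating functions

open PowerSeries
open ClosedForms
open GeneratingTree
open Permutations
open CycleStates
open Enumeration
open import Data.Bool using (Bool; true; false; if_then_else_; _∧_)
open import Data.Nat as ℕ using (ℕ; zero; suc; _≡ᵇ_)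
open import Data.Integer as ℤ using (ℤ; +_)
open import Data.Product using (_×_; _,_)
open import Data.Vec using (Vec; lookup)
open import Data.Fin using (Fin)
open import Data.List using (length; filterᵇ; []; _∷_)
open import Relation.Binary.PropositionalEquality as ≡ using (_≡_; refl; sym; trans)

module Final (S : PS) (hS : IsInvSqrtΔ S) where

  module G = Generating S hS

  -- Row and column zero of `gf` are zero by definition, and those of the closed form vanish because
  -- of its factor xy; all other entries are counts along the tree.
  gf-total : ∀ ω (p : ∀ k {n} → Vec (Fin n) n → Bool) →
    (∀ k {n} (v : Vec (Fin n) n) → (if p k v then + 1 else + 0) ≡ weight ω k v) →
    gf (λ n k → length (filterᵇ (p k) (Sym n))) ≐ G.L.total ω
  gf-total ω p e zero    k       = sym (X⊗-zero (Y ⊗ G.L.live₀ ω 1 []) k)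
  gf-total ω p e (suc n) zero    =
    sym (trans (X⊗-suc (Y ⊗ G.L.live₀ ω 1 []) n 0) (Y⊗-zero (G.L.live₀ ω 1 []) n))
  gf-total ω p e (suc n) (suc k) = begin
    + length (filterᵇ (p (suc k)) (Sym (suc n)))                        ≡⟨ length-sumBy (p (suc k)) (Sym (suc n)) ⟩
    sumBy (λ v → if p (suc k) v then + 1 else + 0) (Sym (suc n))        ≡⟨ sumBy-cong (e (suc k)) (Sym (suc n)) ⟩
    sumBy (weight ω (suc k)) (Sym (suc n))                              ≡⟨ sumBy-Sym ω (suc k) n ⟩
    F ω n 0 0 1 (false ∷ []) [] (suc k)                                 ≡⟨ G.F-total ω n k ⟩
    G.L.total ω (suc n) (suc k) ∎
    where open ≡.≡-Reasoning

  δ : ℕ → ℕ → ℤ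
  δ j b = if b ≡ᵇ j then + 1 else + 0

  P*-total : P* ≐ G.L.total (λ _ → + 1)
  P*-total = gf-total (λ _ → + 1) (λ k → pStarB k) (λ _ _ → refl)

  P-total : ∀ j → P j ≐ G.L.total (δ j)
  P-total j = gf-total (δ j) (λ k v → pStarB k v ∧ (backPoints (lookup v) ≡ᵇ j)) (λ k v → cases (pStarB k v))
    where
    cases : ∀ a {b} → (if a ∧ b then + 1 else + 0) ≡ (if a then (if b then + 1 else + 0) else + 0)
    cases true  = refl
    cases false = refl

  pow≐ : ∀ f n → f CP.^ n ≐ pow f n
  pow≐ f zero    = λ _ _ → refl
  pow≐ f (suc n) = PSR.*-congˡ {f} {f CP.^ n} {pow f n} (pow≐ f n)

  infixl 7 _⊗-cong_
  _⊗-cong_ : ∀ {f f′ g g′} → f ≐ f′ → g ≐ g′ → PSR._*_ f g ≐ f′ ⊗ g′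
  _⊗-cong_ {f} {f′} {g} {g′} p q = PSR.*-cong {f} {f′} {g} {g′} p q

  infixr 5 _then_
  _then_ : ∀ {f g h : PS} → f ≐ g → g ≐ h → f ≐ h
  (p then q) n k = trans (p n k) (q n k)

  refl≐ : ∀ (f : PS) → f ≐ f
  refl≐ f n k = refl

theorem6p5 : (S : PS) → IsInvSqrtΔ S →
    (P* ≐ pow X 3 ⊗ Y ⊗ pow S 5)
    × (P 0 ≐ pow X 4 ⊗ pow Y 2 ⊗ pow S 5)
    × (P 2 ≐ pow X 4 ⊗ Y ⊗ pow S 5)
    × (P 1 ≐ pow X 3 ⊗ Y ⊗ (𝟙 ⊝ X ⊗ Y ⊝ X) ⊗ pow S 5)
theorem6p5 S hS =
    (P*-total then G.L.total₁₁₁ (λ _ → + 1) (refl≐ _) (refl≐ _) (refl≐ _) then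
      pow≐ X 3 ⊗-cong refl≐ Y ⊗-cong pow≐ S 5)
  , (P-total 0 then G.L.total₁₀₀ (δ 0) (refl≐ _) (refl≐ _) (refl≐ _) then
      pow≐ X 4 ⊗-cong pow≐ Y 2 ⊗-cong pow≐ S 5)
  , (P-total 2 then G.L.total₀₀₁ (δ 2) (refl≐ _) (refl≐ _) (refl≐ _) then
      pow≐ X 4 ⊗-cong refl≐ Y ⊗-cong pow≐ S 5)
  , (P-total 1 then G.L.total₀₁₀ (δ 1) (refl≐ _) (refl≐ _) (refl≐ _) then
      pow≐ X 3 ⊗-cong refl≐ Y ⊗-cong refl≐ (𝟙 ⊝ X ⊗ Y ⊝ X) ⊗-cong pow≐ S 5)
  where open Final S hS
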